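{- Let $k\in\mathbb{N}^+$ and $d,d'\in\mathbb{N}$. Let $R^{(1)},\dots,R^{(d)},R^{(-1)},\dots,R^{(-d')}\subseteq X\times Y$ be $(k,1)$-semi-equations, and let $$R=R^{(1)}\wedge\dots\wedge R^{(d)}\wedge\neg R^{(-1)}\wedge\dots\wedge\neg R^{(-d')}$$ (the empty conjunction being the full relation $X\times Y$). Then, for all $t,m,n\in\mathbb{N}^+$, $$z_t^R(m,n)\leq\begin{cases}(t-1)(m+n)&\text{if }d'=d=0,\\ 8^{d-1}k^{4d-3}(t-1)^2(m+n)\log^{2d-2}(m+1)&\text{if }d'=0\text{ and }d>0,\\ 8^{d+d'-1}k^{4d+d'}(d'!)\,t^{d'+1}(m+n)\log^{2d+d'-1}(m+1)&\text{if }d'>0.\end{cases}$$ Thus, any (finite) Boolean combination of $(k,1)$-semi-equations has almost linear Zarankiewicz bounds, and any $(k,1)$-semi-equational theory does not interpret an infinite field.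
   Context: $\mathbb{N}=\{0,1,2,\dots\}$, $\mathbb{N}^+=\{1,2,\dots\}$, $[k]=\{1,\dots,k\}$; $\log$ is the natural logarithm and $\log^{j}(x)=(\log x)^j$. $X,Y$ are arbitrary sets. For $R\subseteq X\times Y$ and $y\in Y$, $R_y:=\{x\in X:(x,y)\in R\}$ is a fibre of $R$; for $A\subseteq X$, $B\subseteq Y$, $R(A,B):=R\cap(A\times B)$. Boolean operations on relations are the set operations: $\wedge$ is intersection, $\vee$ is union, $\neg R=(X\times Y)\setminus R$. $R\subseteq X\times Y$ is a $(k,1)$-semi-equation if for all $y_1,\dots,y_k\in Y$ with $\bigcap_{i\in[k]}R_{y_i}\neq\emptyset$ there are distinct $i,j\in[k]$ such that $R_{y_i}\subseteq R_{y_j}$. A relation $E\subseteq A\times B$ is $K_{t,t}$-free if there are no $A'\subseteq A$, $B'\subseteq B$ with $|A'|=|B'|=t$ and $A'\times B'\subseteq E$. For $t,m,n\in\mathbb{N}^+$, $$z_t^R(m,n):=\max\{|R(A,B)|:A\subseteq X,\ B\subseteq Y,\ |A|=m,\ |B|=n,\ R(A,B)\text{ is }K_{t,t}\text{ -free}\},$$ with the maximum of the empty set taken to be $0$. $R$ has almost linear Zarankiewicz bounds if for all $t\in\mathbb{N}^+$ and real $\varepsilon>0$ there is a constant $C=C(t,\varepsilon)$ with $z_t^R(n,n)\leq Cn^{1+\varepsilon}$ for all $n\in\mathbb{N}^+$. A first-order theory $T$ is $(k,1)$-semi-equational if every formula $\varphi(x;y)$ ($x,y$ tuples of variables) is, modulo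 $T$, a Boolean combination of formulas $\varphi_1(x;y),\dots,\varphi_l(x;y)$ each of which defines a $(k,1)$-semi-equation (between the set of $x$-tuples and the set of $y$-tuples) in models of $T$. "$T$ does not interpret an infinite field" means that no infinite field is interpretable in a model of $T$. -}

module Defs where

open import Algebra.Bundles using (CommutativeRing; module Semiring)
open import Axiom.ExcludedMiddle using (ExcludedMiddle)
open import Data.Empty.Polymorphic using (⊥)
open import Data.Fin.Base using (Fin)
open import Data.List.Base using (List; length; filter; cartesianProduct)
open import Data.List.Membership.Propositional using (_∈_)
open import Data.List.Relation.Binary.Subset.Propositional using (_⊆_)
open import Data.List.Relation.Unary.Any using (Any)
open import Data.List.Relation.Unary.Unique.Propositional using (Unique)
open import Data.Nat.Base as ℕ using (ℕ; zero; suc; NonZero; _!)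
open import Data.Product.Base using (Σ; ∃; ∃-syntax; ∃₂; _×_; _,_; proj₁; proj₂)
open import Data.Sum.Base using (_⊎_)
open import Data.Unit.Polymorphic using (⊤)
open import Data.Vec.Base as Vec using (Vec; []; _∷_; _++_)
open import Function.Bundles using (_⇔_)
open import Level using (Level; _⊔_; 0ℓ) renaming (suc to lsuc)
open import Relation.Binary.Core using (Rel; REL)
open import Relation.Binary.PropositionalEquality.Core using (_≡_; _≢_)
open import Relation.Binary.Structures using (IsTotalOrder)
open import Relation.Nullary.Decidable.Core using (yes; no)
open import Relation.Nullary.Negation.Core using (¬_)
open import Relation.Unary using (Pred)

IsField : ∀ {c e} → CommutativeRing c e → Set (c ⊔ e)
IsField F = ¬ (1# ≈ 0#) × (∀ x → ¬ (x ≈ 0#) → ∃[ y ] x * y ≈ 1#)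
  where open CommutativeRing F

Infinite : ∀ {c e} → CommutativeRing c e → Set (c ⊔ e)
Infinite F = ¬ (∃[ xs ] ∀ x → Any (x ≈_) xs)
  where open CommutativeRing F

-- The real numbers enter as an arbitrary complete ordered field, which is
-- unique up to isomorphism.
record CompleteOrderedField : Set₁ where
  infix 4 _≤_ _<_
  field
    commutativeRing : CommutativeRing 0ℓ 0ℓ
  open CommutativeRing commutativeRing public
  field
    isField      : IsField commutativeRing
    _≤_          : Rel Carrier 0ℓ
    isTotalOrder : IsTotalOrder _≈_ _≤_
    +-monoˡ-≤    : ∀ z {x y} → x ≤ y → x + z ≤ y + z
    *-nonNeg     : ∀ {x y} → 0# ≤ x → 0# ≤ y → 0# ≤ x * y

  _<_ : Rel Carrier 0ℓ
  x < y = x ≤ y × ¬ (x ≈ y)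

  UpperBound : Pred Carrier 0ℓ → Carrier → Set
  UpperBound S b = ∀ x → S x → x ≤ b

  IsSupremum : Pred Carrier 0ℓ → Carrier → Set
  IsSupremum S s = UpperBound S s × (∀ b → UpperBound S b → s ≤ b)

  field
    complete : ∀ S → ∃ S → ∃ (UpperBound S) → ∃ (IsSupremum S)

  open import Algebra.Definitions.RawSemiring (Semiring.rawSemiring semiring)
    public using (_^_) renaming (_×_ to _·_)

  fromℕ : ℕ → Carrier
  fromℕ n = n · 1#

-- R relates x to y, so the fibre R_y is λ x → R x y.
SemiEquation : ∀ {a b r} {X : Set a} {Y : Set b} →
               ℕ → REL X Y r → Set (a ⊔ b ⊔ r)
SemiEquation {X = X} {Y} k R =
  (y : Fin k → Y) → (∃[ x ] ∀ i → R x (y i)) →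
  ∃₂ λ i j → i ≢ j × (∀ x → R x (y i) → R x (y j))

infixr 7 _and_
infixr 6 _or_

data BoolExpr (l : ℕ) : Set where
  var         : Fin l → BoolExpr l
  true        : BoolExpr l
  not         : BoolExpr l → BoolExpr l
  _and_ _or_  : BoolExpr l → BoolExpr l → BoolExpr l

⟦_⟧ᵇ : ∀ {l r} → BoolExpr l → (Fin l → Set r) → Set r
⟦ var i ⟧ᵇ   P = P i
⟦ true ⟧ᵇ    P = ⊤
⟦ not e ⟧ᵇ   P = ¬ ⟦ e ⟧ᵇ P
⟦ e and f ⟧ᵇ P = ⟦ e ⟧ᵇ P × ⟦ f ⟧ᵇ P
⟦ e or f ⟧ᵇ  P = ⟦ e ⟧ᵇ P ⊎ ⟦ f ⟧ᵇ P

BooleanCombination : ∀ {a b r l} {X : Set a} {Y : Set b} →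
                     (Fin l → REL X Y r) → REL X Y r → Set (a ⊔ b ⊔ r)
BooleanCombination {l = l} S R =
  ∃[ e ] ∀ x y → R x y ⇔ ⟦ e ⟧ᵇ (λ (i : Fin l) → S i x y)

Conjunction : ∀ {a b r d d'} {X : Set a} {Y : Set b} →
              (Fin d → REL X Y r) → (Fin d' → REL X Y r) → REL X Y r
Conjunction P N x y = (∀ i → P i x y) × (∀ j → ¬ N j x y)

-- Finite subsets are represented by duplicate-free lists.
KFree : ∀ {a b r} {X : Set a} {Y : Set b} →
        ℕ → REL X Y r → List X → List Y → Set (a ⊔ b ⊔ r)
KFree t R A B =
  ¬ (∃₂ λ A' B' →
       Unique A' × length A' ≡ t × A' ⊆ A ×
       Unique B' × length B' ≡ t × B' ⊆ B ×
       (∀ {x y} → x ∈ A' → y ∈ B' → R x y))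

-- The mathematics is classical: excluded middle is an explicit hypothesis, used
-- here to count edges, to take maxima and to make real functions total.
module Classical (em : ∀ {ℓ} → ExcludedMiddle ℓ) where

  edges : ∀ {a b r} {X : Set a} {Y : Set b} →
          REL X Y r → List X → List Y → ℕ
  edges R A B =
    length (filter (λ (x , y) → em {P = R x y}) (cartesianProduct A B))

  -- The largest s ≤ bound satisfying P, or 0 if there is none.
  greatest : ∀ {p} → Pred ℕ p → ℕ → ℕ
  greatest P zero = 0
  greatest P (suc bound) with em {P = P (suc bound)}
  ... | yes _ = suc bound
  ... | no  _ = greatest P bound

  -- The search bound loses nothing since |R(A,B)| ≤ |A||B|.
  zarankiewicz : ∀ {a b r} {X : Set a} {Y : Set b} →
                 REL X Y r → (t m n : ℕ) → ℕ
  zarankiewicz R t m n = greatest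
    (λ s → ∃₂ λ A B → Unique A × length A ≡ m × Unique B × length B ≡ n ×
                      KFree t R A B × edges R A B ≡ s)
    (m ℕ.* n)

  module RealFunctions (ℝ : CompleteOrderedField) where
    open CompleteOrderedField ℝ

    infix  9 _⁻¹
    infixr 8 _^ʳ_

    -- Junk value 0 at 0.
    _⁻¹ : Carrier → Carrier
    x ⁻¹ with em {P = x ≈ 0#}
    ... | yes _  = 0#
    ... | no x≉0 = proj₁ (proj₂ isField x x≉0)

    -- Junk value 0 for sets that are empty or unbounded above.
    sup : Pred Carrier 0ℓ → Carrier
    sup S with em {P = ∃ S × ∃ (UpperBound S)}
    ... | yes (inhabited , bounded) = proj₁ (complete S inhabited bounded)
    ... | no _                      = 0#

    -- The limit inferior, which is the limit for convergent sequences.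
    lim : (ℕ → Carrier) → Carrier
    lim s = sup (λ a → ∃[ N ] ∀ n → N ℕ.≤ n → a ≤ s n)

    expSum : Carrier → ℕ → Carrier
    expSum x zero    = 0#
    expSum x (suc n) = expSum x n + x ^ n * fromℕ (n !) ⁻¹

    exp : Carrier → Carrier
    exp x = lim (expSum x)

    -- The inverse of exp for positive arguments.
    log : Carrier → Carrier
    log y = sup (λ x → exp x ≤ y)

    -- Real powers of a positive base.
    _^ʳ_ : Carrier → Carrier → Carrier
    x ^ʳ a = exp (a * log x)

    zBound : (k d d' t m n : ℕ) → Carrier
    zBound k zero zero t m n = fromℕ ((t ℕ.∸ 1) ℕ.* (m ℕ.+ n))
    zBound k d@(suc _) zero t m n =
      fromℕ (8 ℕ.^ (d ℕ.∸ 1) ℕ.* k ℕ.^ (4 ℕ.* d ℕ.∸ 3) ℕ.*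
             (t ℕ.∸ 1) ℕ.^ 2 ℕ.* (m ℕ.+ n))
      * log (fromℕ (m ℕ.+ 1)) ^ (2 ℕ.* d ℕ.∸ 2)
    zBound k d d'@(suc _) t m n =
      fromℕ (8 ℕ.^ (d ℕ.+ d' ℕ.∸ 1) ℕ.* k ℕ.^ (4 ℕ.* d ℕ.+ d') ℕ.*
             d' ! ℕ.* t ℕ.^ (d' ℕ.+ 1) ℕ.* (m ℕ.+ n))
      * log (fromℕ (m ℕ.+ 1)) ^ (2 ℕ.* d ℕ.+ d' ℕ.∸ 1)

    AlmostLinearZarankiewiczBounds :
      ∀ {a b r} {X : Set a} {Y : Set b} → REL X Y r → Set
    AlmostLinearZarankiewiczBounds R =
      ∀ t → .{{NonZero t}} → ∀ ε → 0# < ε →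
      ∃[ C ] ∀ n → .{{NonZero n}} →
        fromℕ (zarankiewicz R t n n) ≤ C * fromℕ n ^ʳ (1# + ε)

record Language (s : Level) : Set (lsuc s) where
  field
    Function Relation : ℕ → Set s

module _ {s} (L : Language s) where
  open Language L

  data Term (n : ℕ) : Set s where
    var : Fin n → Term n
    fun : ∀ {k} → Function k → Vec (Term n) k → Term n

  -- Formulas with n free variables; a quantifier binds variable 0.
  data Formula (n : ℕ) : Set s where
    equal           : Term n → Term n → Formula n
    rel             : ∀ {k} → Relation k → Vec (Term n) k → Formula n
    false           : Formula n
    and or implies  : Formula n → Formula n → Formula n
    all exists      : Formula (suc n) → Formula n

  Theory : ∀ t → Set (s ⊔ lsuc t)
  Theory t = Pred (Formula 0) t

  record Structure (ℓ : Level) : Set (s ⊔ lsuc ℓ) where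
    field
      Carrier    : Set ℓ
      inhabitant : Carrier
      function   : ∀ {k} → Function k → Vec Carrier k → Carrier
      relation   : ∀ {k} → Relation k → Vec Carrier k → Set ℓ

module _ {s ℓ} {L : Language s} (M : Structure L ℓ) where
  open Structure M

  evalTerm  : ∀ {n} → Vec Carrier n → Term L n → Carrier
  evalTerms : ∀ {n k} → Vec Carrier n → Vec (Term L n) k → Vec Carrier k
  evalTerm  ρ (var i)    = Vec.lookup ρ i
  evalTerm  ρ (fun f ts) = function f (evalTerms ρ ts)
  evalTerms ρ []         = []
  evalTerms ρ (t ∷ ts)   = evalTerm ρ t ∷ evalTerms ρ ts

  Sat : ∀ {n} → Formula L n → Vec Carrier n → Set ℓ
  Sat (equal t u)   ρ = evalTerm ρ t ≡ evalTerm ρ u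
  Sat (rel R ts)    ρ = relation R (evalTerms ρ ts)
  Sat false         ρ = ⊥
  Sat (and φ ψ)     ρ = Sat φ ρ × Sat ψ ρ
  Sat (or φ ψ)      ρ = Sat φ ρ ⊎ Sat ψ ρ
  Sat (implies φ ψ) ρ = Sat φ ρ → Sat ψ ρ
  Sat (all φ)       ρ = ∀ a → Sat φ (a ∷ ρ)
  Sat (exists φ)    ρ = ∃[ a ] Sat φ (a ∷ ρ)

  Model : ∀ {t} → Theory L t → Set (s ⊔ t ⊔ ℓ)
  Model T = ∀ φ → T φ → Sat φ []

  -- The relation between p-tuples and q-tuples defined by φ(x;y).
  Defined : ∀ p q → Formula L (p ℕ.+ q) → REL (Vec Carrier p) (Vec Carrier q) ℓ
  Defined p q φ x y = Sat φ (x ++ y)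

-- The formulas ψᵢ and the Boolean expression are chosen uniformly over all
-- models of T.
SemiEquational : ∀ {s t} (ℓ : Level) {L : Language s} →
                 ℕ → Theory L t → Set (s ⊔ t ⊔ lsuc ℓ)
SemiEquational ℓ {L} k T =
  ∀ p q (φ : Formula L (p ℕ.+ q)) →
  ∃[ l ] Σ (Fin l → Formula L (p ℕ.+ q)) λ ψ → Σ (BoolExpr l) λ e →
    ∀ (M : Structure L ℓ) → Model M T →
      (∀ i → SemiEquation k (Defined M p q (ψ i))) ×
      (∀ x y → Defined M p q φ x y ⇔ ⟦ e ⟧ᵇ (λ i → Defined M p q (ψ i) x y))

-- An interpretation, with parameters, of F in M.  The interpreted field is
-- the quotient of the definable set `domain` by the definable equivalence
-- `equality`; `coordinate` identifies this quotient with F, and its values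
-- outside `domain` are irrelevant.  The constants and the additive inverse
-- of F are definable from the graphs of addition and multiplication.
record Interpretation {s ℓ c e} {L : Language s}
                      (M : Structure L ℓ) (F : CommutativeRing c e) :
                      Set (s ⊔ ℓ ⊔ c ⊔ e) where
  open Structure M using () renaming (Carrier to ∣M∣)
  open CommutativeRing F using (_≈_; _+_; _*_) renaming (Carrier to ∣F∣)
  field
    {arity parameterCount} : ℕ
    parameters     : Vec ∣M∣ parameterCount
    domain         : Formula L (parameterCount ℕ.+ arity)
    equality       : Formula L (parameterCount ℕ.+ (arity ℕ.+ arity))
    addition       : Formula L (parameterCount ℕ.+ (arity ℕ.+ (arity ℕ.+ arity)))
    multiplication : Formula L (parameterCount ℕ.+ (arity ℕ.+ (arity ℕ.+ arity)))
    coordinate     : Vec ∣M∣ arity → ∣F∣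

  InDomain : Vec ∣M∣ arity → Set ℓ
  InDomain a = Sat M domain (parameters ++ a)

  field
    surjective : ∀ u → ∃[ a ] InDomain a × coordinate a ≈ u
    equality-correct : ∀ a b → InDomain a → InDomain b →
      Sat M equality (parameters ++ (a ++ b)) ⇔ coordinate a ≈ coordinate b
    addition-correct : ∀ a b c → InDomain a → InDomain b → InDomain c →
      Sat M addition (parameters ++ (a ++ (b ++ c))) ⇔
      coordinate a + coordinate b ≈ coordinate c
    multiplication-correct : ∀ a b c → InDomain a → InDomain b → InDomain c →
      Sat M multiplication (parameters ++ (a ++ (b ++ c))) ⇔
      coordinate a * coordinate b ≈ coordinate c

InterpretsInfiniteField : ∀ {s t} (ℓ c e : Level) {L : Language s} →
                          Theory L t → Set (s ⊔ t ⊔ lsuc (ℓ ⊔ c ⊔ e))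
InterpretsInfiniteField ℓ c e {L} T =
  Σ (Structure L ℓ) λ M → Model M T ×
  Σ (CommutativeRing c e) λ F → IsField F × Infinite F × Interpretation M F

{-# OPTIONS --safe #-}

-- Among the fibres of a (k,1)-semi-equation that contain a given point there is no antichain
-- of length k.  Hence a chain-wise bound on edges extends to all of Y by a weighted form of
-- Mirsky's theorem, applied to the excess of the degrees over the average that the chain
-- bound allows; along a chain of fibres, membership is a linear order and decomposes into
-- log |A| layers of bicliques.  Adding a positive conjunct groups its fibres by dyadic size,
-- which costs a second logarithm; for purely negative conjunctions the K_{t,t}-freeness
-- bounds the total excess.  A Boolean combination is a disjoint union of conjunctions.
-- Since these bounds are linear up to powers of log n, a field is excluded by the lines
-- y = a x + b over a finite set U with |U U + V| comparable to |V|: an initial segment of ℕ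
-- in characteristic 0, and otherwise a large finite subring or polynomials in an element
-- outside a maximal finite subring.
module Submission where

open import Defs
open import Algebra.Bundles using (CommutativeRing; module Semiring)
open import Axiom.ExcludedMiddle using (ExcludedMiddle)
open import Data.Empty using (⊥-elim)
open import Data.Fin.Base as Fin using (Fin)
open import Data.List.Base using (List; []; _∷_; length; map; cartesianProductWith; upTo)
open import Data.List.Membership.Propositional using (_∈_; find; lose)
open import Data.List.Membership.Propositional.Properties
  using (∈-lookup; ∈-map⁺; ∈-map⁻; ∈-upTo⁺; ∈-upTo⁻; ∈-++⁺ˡ; ∈-++⁺ʳ; ∈-++⁻; ∈-filter⁻; ∈-allFin; ∈-cartesianProductWith⁺; ∈-cartesianProductWith⁻)
open import Data.List.Properties
  using (length-++; length-map; length-take; length-drop; length-upTo; length-tabulate; filter-++; filter-all; take++drop≡id)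
open import Data.List.Relation.Unary.All as All using (All; []; _∷_)
import Data.List.Relation.Unary.AllPairs.Properties as AllPairsₚ
open import Data.List.Relation.Unary.AllPairs as AllPairs using (AllPairs; []; _∷_)
open import Data.List.Relation.Unary.Any as Any using (Any; here; there)
open import Data.List.Relation.Unary.Unique.Propositional using (Unique)
import Data.List.Relation.Unary.Unique.Propositional.Properties as Uniqueₚ
open import Data.Nat.Base as ℕ using (ℕ; zero; suc; z≤n; s≤s; NonZero; _!)
import Data.Nat.Properties as ℕₚ
open import Data.Nat.Tactic.RingSolver using (solve-∀)
open import Data.Product.Base using (∃; ∃-syntax; _×_; _,_; proj₁; proj₂)
open import Data.Product.Function.NonDependent.Propositional using (_×-⇔_)
open import Data.Sum.Base using (_⊎_; inj₁; inj₂; [_,_]′)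
open import Data.Sum.Function.Propositional using (_⊎-⇔_)
open import Data.Vec.Base as Vec using (Vec; []; _∷_)
open import Function.Base using (_∘_; id; flip; case_of_)
open import Function.Bundles using (_⇔_; mk⇔; Equivalence)
open import Function.Related.TypeIsomorphisms using (→-cong-⇔; ¬-cong-⇔)
open import Level using (Level; 0ℓ)
open import Relation.Binary.Core using (Rel; REL)
open import Relation.Binary.PropositionalEquality as ≡ using (_≡_; _≢_)
open import Relation.Nullary.Decidable.Core using (Dec; yes; no; does)
open import Relation.Nullary.Negation.Core using (¬_; contradiction)

-- The obstacle is that `P ∧ Q` can be free of large bicliques while `Q` is not, so a bound for `Q`
-- says nothing about A × B as a whole. It applies on every A′ × B′ contained in `P`, since the two
-- relations agree there; this is why chains of fibres are cut into bicliques. A chain bound reads α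
-- (|A| + |C|). Summed over many chains its first part would be paid too often, while α |C| is
-- harmless. Degrees are therefore replaced by their truncated excess over α: on each chain the
-- excess has a total independent of |C|, which is the hypothesis that the weighted Mirsky theorem
-- needs. Complements of a chain of fibres form a chain again, so a negated conjunct is stripped
-- along chains in the same way. Its fibres in the conjunction are however large, and grouping by
-- size gains nothing; there the freeness has to control vertices that miss few points. All counting
-- takes place in ℕ, with q a rounded binary logarithm. Real logarithms enter through the single
-- estimate log 2 ≥ 1/2, hence q ≤ 2 log (m + 1), and the resulting powers of 2 turn the
-- coefficients 2 and 4 of the counting bounds into the 8 of the theorem.

module Combinatorics (em : ∀ {ℓ} → ExcludedMiddle ℓ) where
  open Classical em
  open import Data.Bool.Base using (Bool; true; false; if_then_else_)
  import Data.Empty.Polymorphic as Empty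
  open import Data.Fin.Base using (inject≤; punchIn; punchOut)
  open import Data.Fin.Properties as Finₚ using (inject≤-injective; punchIn-punchOut)
  open import Data.List.Base using (_++_; filter; cartesianProduct; take; drop; lookup; allFin)
  open import Data.List.Relation.Binary.Permutation.Propositional as Perm using (_↭_; ↭-sym)
  open import Data.List.Relation.Binary.Permutation.Propositional.Properties using (↭-length; ∈-resp-↭)
  import Data.List.Relation.Binary.Permutation.Setoid.Properties as PermSetoid
  import Data.List.Relation.Binary.Sublist.Propositional as Sublist
  open import Data.List.Relation.Binary.Sublist.Propositional.Properties using (take-⊆; drop-⊆)
  open import Data.List.Relation.Binary.Subset.Propositional using (_⊆_)
  open import Data.List.Relation.Unary.Linked.Properties using (Linked⇒AllPairs)
  open import Data.List.Sort using (sort; sort-↭; sort-↗)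
  open import Data.Nat
  open import Data.Nat.Properties
  import Data.Unit.Polymorphic as Unit
  import Data.Vec.Properties as Vecₚ
  open import Relation.Binary.Bundles using (DecTotalOrder)
  import Relation.Binary.Construct.Flip.EqAndOrd as Flip
  import Relation.Binary.Construct.On as On
  open import Relation.Binary.Definitions using (Reflexive; Transitive)
  open import Relation.Binary.PropositionalEquality

  private
    variable
      a b p r : Level
      A X : Set a
      B Y : Set b

  -- Finite sums

  ∑ : List A → (A → ℕ) → ℕ
  ∑ []       f = 0
  ∑ (x ∷ xs) f = f x + ∑ xs f

  syntax ∑ xs (λ x → e) = ∑[ x ∈ xs ] e

  ∑-mono : ∀ (xs : List A) {f g} → (∀ {x} → x ∈ xs → f x ≤ g x) → ∑ xs f ≤ ∑ xs g
  ∑-mono []       f≤g = z≤n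
  ∑-mono (x ∷ xs) f≤g = +-mono-≤ (f≤g (here refl)) (∑-mono xs (f≤g ∘ there))

  ∑-cong : ∀ (xs : List A) {f g} → (∀ {x} → x ∈ xs → f x ≡ g x) → ∑ xs f ≡ ∑ xs g
  ∑-cong []       f≡g = refl
  ∑-cong (x ∷ xs) f≡g = cong₂ _+_ (f≡g (here refl)) (∑-cong xs (f≡g ∘ there))

  ∑-+ : ∀ (xs : List A) f g → (∑[ x ∈ xs ] (f x + g x)) ≡ ∑ xs f + ∑ xs g
  ∑-+ []       f g = refl
  ∑-+ (x ∷ xs) f g = begin
    f x + g x + (∑[ x ∈ xs ] (f x + g x))  ≡⟨ cong (f x + g x +_) (∑-+ xs f g) ⟩
    f x + g x + (∑ xs f + ∑ xs g)        ≡⟨ interchange (f x) (g x) (∑ xs f) (∑ xs g) ⟩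
    (f x + ∑ xs f) + (g x + ∑ xs g)      ∎
    where
    open ≡-Reasoning
    interchange : ∀ a b c d → a + b + (c + d) ≡ (a + c) + (b + d)
    interchange = solve-∀

  ∑-*ʳ : ∀ (xs : List A) f c → (∑[ x ∈ xs ] (f x * c)) ≡ ∑ xs f * c
  ∑-*ʳ []       f c = refl
  ∑-*ʳ (x ∷ xs) f c = trans (cong (f x * c +_) (∑-*ʳ xs f c)) (sym (*-distribʳ-+ c (f x) (∑ xs f)))

  ∑-const : ∀ (xs : List A) c → (∑[ _ ∈ xs ] c) ≡ length xs * c
  ∑-const []       c = refl
  ∑-const (x ∷ xs) c = cong (c +_) (∑-const xs c)

  ∑-bounded : ∀ (xs : List A) {f c} → (∀ {x} → x ∈ xs → f x ≤ c) → ∑ xs f ≤ length xs * c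
  ∑-bounded xs {c = c} f≤c = ≤-trans (∑-mono xs f≤c) (≤-reflexive (∑-const xs c))

  ∑-++ : ∀ (xs ys : List A) f → ∑ (xs ++ ys) f ≡ ∑ xs f + ∑ ys f
  ∑-++ []       ys f = refl
  ∑-++ (x ∷ xs) ys f = trans (cong (f x +_) (∑-++ xs ys f)) (sym (+-assoc (f x) _ _))

  ∑-map : ∀ (g : A → B) xs f → ∑ (map g xs) f ≡ ∑ xs (f ∘ g)
  ∑-map g []       f = refl
  ∑-map g (x ∷ xs) f = cong (f (g x) +_) (∑-map g xs f)

  ∑-swap : ∀ (xs : List A) (ys : List B) (f : A → B → ℕ) →
           (∑[ x ∈ xs ] ∑[ y ∈ ys ] f x y) ≡ (∑[ y ∈ ys ] ∑[ x ∈ xs ] f x y)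
  ∑-swap []       ys f = sym (trans (∑-const ys 0) (*-zeroʳ (length ys)))
  ∑-swap (x ∷ xs) ys f = trans (cong (∑ ys (f x) +_) (∑-swap xs ys f)) (sym (∑-+ ys (f x) _))

  ∑-↭ : ∀ {xs ys : List A} f → xs ↭ ys → ∑ xs f ≡ ∑ ys f
  ∑-↭ f Perm.refl       = refl
  ∑-↭ f (Perm.prep x p) = cong (f x +_) (∑-↭ f p)
  ∑-↭ f (Perm.swap {xs} {ys} x y p) = begin
    f x + (f y + ∑ xs f)  ≡⟨ +-comm-assoc (f x) (f y) _ ⟩
    f y + (f x + ∑ xs f)  ≡⟨ cong (λ s → f y + (f x + s)) (∑-↭ f p) ⟩
    f y + (f x + ∑ ys f)  ∎
    where
    open ≡-Reasoning
    +-comm-assoc : ∀ a b c → a + (b + c) ≡ b + (a + c)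
    +-comm-assoc = solve-∀
  ∑-↭ f (Perm.trans p q) = trans (∑-↭ f p) (∑-↭ f q)

  ∑-cartesianProductWith : ∀ {c} {C : Set c} (f : A → B → C) xs ys (g : C → ℕ) →
    ∑ (cartesianProductWith f xs ys) g ≡ (∑[ x ∈ xs ] ∑[ y ∈ ys ] g (f x y))
  ∑-cartesianProductWith f []       ys g = refl
  ∑-cartesianProductWith f (x ∷ xs) ys g = trans (∑-++ (map (f x) ys) _ g)
    (cong₂ ℕ._+_ (∑-map (f x) ys g) (∑-cartesianProductWith f xs ys g))

  length≡∑1 : (xs : List A) → length xs ≡ (∑[ _ ∈ xs ] 1)
  length≡∑1 xs = sym (trans (∑-const xs 1) (*-identityʳ (length xs)))

  AllPairs-tabulate : ∀ {R : Rel A r} (xs : List A) → Unique xs →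
                      (∀ {x y} → x ∈ xs → y ∈ xs → x ≢ y → R x y) → AllPairs R xs
  AllPairs-tabulate []       []        f = []
  AllPairs-tabulate (x ∷ xs) (x∉ ∷ u) f =
    All.tabulate (λ y∈ → f (here refl) (there y∈) (All.lookup x∉ y∈)) ∷
    AllPairs-tabulate xs u (λ x∈ y∈ → f (there x∈) (there y∈))

  AllPairs-lookup : ∀ {R : Rel A r} {xs} → AllPairs R xs → (∀ {x y} → R x y → R y x) →
                    ∀ i j → i ≢ j → R (lookup xs i) (lookup xs j)
  AllPairs-lookup (_  ∷ _) s Fin.zero    Fin.zero    i≢j = contradiction refl i≢j
  AllPairs-lookup (px ∷ _) s Fin.zero    (Fin.suc j) i≢j = All.lookup px (∈-lookup j)
  AllPairs-lookup (px ∷ _) s (Fin.suc i) Fin.zero    i≢j = s (All.lookup px (∈-lookup i))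
  AllPairs-lookup (_  ∷ p) s (Fin.suc i) (Fin.suc j) i≢j = AllPairs-lookup p s i j (i≢j ∘ cong Fin.suc)

  -- Counting

  by-cases : ∀ (P : Set p) {Q : Set r} → (P → Q) → (¬ P → Q) → Q
  by-cases P f g with em {P = P}
  ... | yes p = f p
  ... | no ¬p = g ¬p

  private
    indicator : {P : Set p} → Dec P → ℕ
    indicator (yes _) = 1
    indicator (no _)  = 0

    indicator-yes : {P : Set p} (d : Dec P) → P → indicator d ≡ 1
    indicator-yes (yes _) x = refl
    indicator-yes (no ¬x) x = contradiction x ¬x

    indicator-no : {P : Set p} (d : Dec P) → ¬ P → indicator d ≡ 0
    indicator-no (yes x) ¬x = contradiction x ¬x
    indicator-no (no _)  ¬x = refl

    indicator≤1 : {P : Set p} (d : Dec P) → indicator d ≤ 1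
    indicator≤1 (yes _) = ≤-refl
    indicator≤1 (no _)  = z≤n

  -- Abstract, so that unification recovers P from ⟨ P ⟩.
  abstract
    ⟨_⟩ : Set p → ℕ
    ⟨ P ⟩ = indicator (em {P = P})

    ⟨⟩≡1 : {P : Set p} → P → ⟨ P ⟩ ≡ 1
    ⟨⟩≡1 = indicator-yes em

    ⟨⟩≡0 : {P : Set p} → ¬ P → ⟨ P ⟩ ≡ 0
    ⟨⟩≡0 = indicator-no em

    ⟨⟩≤1 : (P : Set p) → ⟨ P ⟩ ≤ 1
    ⟨⟩≤1 P = indicator≤1 em

  ⟨⟩-bound : {P : Set p} {n : ℕ} → (P → 1 ≤ n) → ⟨ P ⟩ ≤ n
  ⟨⟩-bound {P = P} f = by-cases P
    (λ x  → ≤-trans (⟨⟩≤1 P) (f x))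
    (λ ¬x → ≤-trans (≤-reflexive (⟨⟩≡0 ¬x)) z≤n)

  ⟨⟩-mono : {P : Set p} {Q : Set r} → (P → Q) → ⟨ P ⟩ ≤ ⟨ Q ⟩
  ⟨⟩-mono f = ⟨⟩-bound (λ x → ≤-reflexive (sym (⟨⟩≡1 (f x))))

  ⟨⟩-¬ : (P : Set p) → ⟨ P ⟩ + ⟨ ¬ P ⟩ ≡ 1
  ⟨⟩-¬ P = by-cases P
    (λ x  → cong₂ _+_ (⟨⟩≡1 x) (⟨⟩≡0 (λ ¬x → ¬x x)))
    (λ ¬x → cong₂ _+_ (⟨⟩≡0 ¬x) (⟨⟩≡1 ¬x))

  select : (A → Set p) → List A → List A
  select P = filter (λ x → em {P = P x})

  ∈-select⁻ : ∀ {P : A → Set p} {x xs} → x ∈ select P xs → x ∈ xs × P x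
  ∈-select⁻ {xs = xs} = ∈-filter⁻ (λ x → em) {xs = xs}

  select-⊆ : ∀ {P : A → Set p} {xs} → select P xs ⊆ xs
  select-⊆ {xs = xs} x∈ = proj₁ (∈-select⁻ {xs = xs} x∈)

  select-unique : ∀ {P : A → Set p} {xs} → Unique xs → Unique (select P xs)
  select-unique = Uniqueₚ.filter⁺ (λ x → em)

  ∑-select : ∀ (P : A → Set p) xs f → ∑ (select P xs) f ≡ (∑[ x ∈ xs ] (⟨ P x ⟩ * f x))
  ∑-select P []       f = refl
  ∑-select P (x ∷ xs) f with em {P = P x}
  ... | yes px = cong₂ _+_
    (sym (trans (cong (_* f x) (⟨⟩≡1 px)) (*-identityˡ (f x)))) (∑-select P xs f)
  ... | no ¬px = trans (∑-select P xs f)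
    (sym (cong (λ n → n * f x + (∑[ x ∈ xs ] (⟨ P x ⟩ * f x))) (⟨⟩≡0 ¬px)))

  length-select : ∀ (P : A → Set p) xs → length (select P xs) ≡ (∑[ x ∈ xs ] ⟨ P x ⟩)
  length-select P xs = trans (length≡∑1 (select P xs))
    (trans (∑-select P xs _) (∑-cong xs λ {x} _ → *-identityʳ ⟨ P x ⟩))

  length-select-≤ : ∀ (P : A → Set p) xs → length (select P xs) ≤ length xs
  length-select-≤ P xs = ≤-trans (≤-reflexive (length-select P xs))
    (≤-trans (∑-bounded xs (λ {x} _ → ⟨⟩≤1 (P x))) (≤-reflexive (*-identityʳ (length xs))))

  ∑-partition : ∀ (P : A → Set p) xs f →
                ∑ xs f ≡ ∑ (select P xs) f + ∑ (select (¬_ ∘ P) xs) f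
  ∑-partition P xs f = begin
    ∑ xs f                                                        ≡⟨ ∑-cong xs (λ {x} _ → sym (split x)) ⟩
    (∑[ x ∈ xs ] (⟨ P x ⟩ * f x + ⟨ ¬ P x ⟩ * f x))                 ≡⟨ ∑-+ xs _ _ ⟩
    (∑[ x ∈ xs ] (⟨ P x ⟩ * f x)) + (∑[ x ∈ xs ] (⟨ ¬ P x ⟩ * f x)) ≡⟨ cong₂ _+_ (sym (∑-select P xs f)) (sym (∑-select (¬_ ∘ P) xs f)) ⟩
    ∑ (select P xs) f + ∑ (select (¬_ ∘ P) xs) f                  ∎
    where
    open ≡-Reasoning
    split : ∀ x → ⟨ P x ⟩ * f x + ⟨ ¬ P x ⟩ * f x ≡ f x
    split x = trans (sym (*-distribʳ-+ (f x) ⟨ P x ⟩ ⟨ ¬ P x ⟩))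
      (trans (cong (_* f x) (⟨⟩-¬ (P x))) (*-identityˡ (f x)))

  length-partition : ∀ (P : A → Set p) xs →
                     length xs ≡ length (select P xs) + length (select (¬_ ∘ P) xs)
  length-partition P xs = trans (length≡∑1 xs) (trans (∑-partition P xs _)
    (cong₂ _+_ (sym (length≡∑1 (select P xs))) (sym (length≡∑1 (select (¬_ ∘ P) xs)))))

  deg : {X : Set a} {Y : Set b} → REL X Y r → List X → Y → ℕ
  deg R xs y = ∑[ x ∈ xs ] ⟨ R x y ⟩

  private
    length-filter-map : ∀ {X : Set a} {Y : Set b} (R : REL X Y r) x (ys : List Y) →
      length (filter (λ (x , y) → em {P = R x y}) (map (x ,_) ys)) ≡ (∑[ y ∈ ys ] ⟨ R x y ⟩)
    length-filter-map R x []       = refl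
    length-filter-map R x (y ∷ ys) with em {P = R x y}
    ... | yes rxy = cong₂ _+_ (sym (⟨⟩≡1 rxy)) (length-filter-map R x ys)
    ... | no ¬rxy = cong₂ _+_ (sym (⟨⟩≡0 ¬rxy)) (length-filter-map R x ys)

  edges≡∑ : ∀ {X : Set a} {Y : Set b} (R : REL X Y r) xs ys →
            edges R xs ys ≡ (∑[ x ∈ xs ] ∑[ y ∈ ys ] ⟨ R x y ⟩)
  edges≡∑ R []       ys = refl
  edges≡∑ R (x ∷ xs) ys = begin
    length (filter R? (map (x ,_) ys ++ cartesianProduct xs ys))
      ≡⟨ cong length (filter-++ R? (map (x ,_) ys) (cartesianProduct xs ys)) ⟩
    length (filter R? (map (x ,_) ys) ++ filter R? (cartesianProduct xs ys))
      ≡⟨ length-++ (filter R? (map (x ,_) ys)) ⟩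
    length (filter R? (map (x ,_) ys)) + edges R xs ys
      ≡⟨ cong₂ _+_ (length-filter-map R x ys) (edges≡∑ R xs ys) ⟩
    (∑[ y ∈ ys ] ⟨ R x y ⟩) + (∑[ x ∈ xs ] ∑[ y ∈ ys ] ⟨ R x y ⟩) ∎
    where
    open ≡-Reasoning
    R? = λ xy → em {P = R (proj₁ xy) (proj₂ xy)}

  edges≡∑deg : ∀ {X : Set a} {Y : Set b} (R : REL X Y r) xs ys → edges R xs ys ≡ ∑ ys (deg R xs)
  edges≡∑deg R xs ys = trans (edges≡∑ R xs ys) (∑-swap xs ys (λ x y → ⟨ R x y ⟩))

  ∑-strict : ∀ (xs : List A) {f g} → (∀ {x} → x ∈ xs → f x ≤ g x) →
             ∀ {y} → y ∈ xs → f y < g y → ∑ xs f < ∑ xs g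
  ∑-strict (x ∷ xs) f≤g (here refl) fy<gy = +-mono-<-≤ fy<gy (∑-mono xs (f≤g ∘ there))
  ∑-strict (x ∷ xs) f≤g (there y∈)  fy<gy = +-mono-≤-< (f≤g (here refl)) (∑-strict xs (f≤g ∘ there) y∈ fy<gy)

  ∑-member : ∀ (xs : List A) f {y} → y ∈ xs → f y ≤ ∑ xs f
  ∑-member (x ∷ xs) f (here refl) = m≤m+n (f x) _
  ∑-member (x ∷ xs) f (there y∈)  = ≤-trans (∑-member xs f y∈) (m≤n+m _ (f x))

  take-⊆ˢ : ∀ n (xs : List A) → take n xs ⊆ xs
  take-⊆ˢ n xs = Sublist.lookup (take-⊆ n xs)

  Unique-resp-↭ : {xs ys : List A} → xs ↭ ys → Unique xs → Unique ys
  Unique-resp-↭ {A = A} p = PermSetoid.Unique-resp-↭ (setoid A) (Perm.↭⇒↭ₛ p)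

  module _ (f : A → ℕ) where
    private
      order : DecTotalOrder _ _ _
      order = On.decTotalOrder (Flip.decTotalOrder ≤-decTotalOrder) f

    descending : List A → List A
    descending = sort order

    descending-↭ : ∀ xs → xs ↭ descending xs
    descending-↭ xs = ↭-sym (sort-↭ order xs)

    descending-sorted : ∀ xs → AllPairs (λ x y → f y ≤ f x) (descending xs)
    descending-sorted xs = Linked⇒AllPairs (λ p q → ≤-trans q p) (sort-↗ order xs)

  -- Chains and antichains

  Chain Antichain : Rel A r → List A → Set _
  Chain     _⊑_ C = ∀ {y z} → y ∈ C → z ∈ C → y ⊑ z ⊎ z ⊑ y
  Antichain _⊑_ S = AllPairs (λ y z → ¬ y ⊑ z × ¬ z ⊑ y) S

  Chain-⊆ : {_⊑_ : Rel A r} {C D : List A} → D ⊆ C → Chain _⊑_ C → Chain _⊑_ D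
  Chain-⊆ D⊆C ch y∈ z∈ = ch (D⊆C y∈) (D⊆C z∈)

  chain-minimum : {_⊑_ : Rel A r} → Reflexive _⊑_ → Transitive _⊑_ → ∀ x xs →
                  Chain _⊑_ (x ∷ xs) → ∃[ m ] m ∈ x ∷ xs × (∀ {y} → y ∈ x ∷ xs → m ⊑ y)
  chain-minimum rfl tr x []        ch = x , here refl , λ { (here refl) → rfl }
  chain-minimum rfl tr x (x′ ∷ xs) ch
    with chain-minimum rfl tr x′ xs (λ y∈ z∈ → ch (there y∈) (there z∈))
  ... | m , m∈ , m⊑ with ch (here refl) (there m∈)
  ... | inj₁ x⊑m = x , here refl , λ { (here refl) → rfl ; (there y∈) → tr x⊑m (m⊑ y∈) }
  ... | inj₂ m⊑x = m , there m∈ , λ { (here refl) → m⊑x ; (there y∈) → m⊑ y∈ }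

  -- Turns a weight into a number of levels. Each unit of length adds the point at the right end,
  -- which lies below n.
  interval-length : ∀ l k n → l + k ≤ n → k ≤ (∑[ θ ∈ upTo n ] ⟨ l ≤ θ × θ < l + k ⟩)
  interval-length l zero    n l+k≤n = z≤n
  interval-length l (suc k) n l+k≤n = begin
    suc k
      ≡⟨ +-comm 1 k ⟩
    k + 1
      ≤⟨ +-mono-≤ (interval-length l k n (≤-trans (n≤1+n _) l+k<n))
                  (≤-trans (≤-reflexive (sym (⟨⟩≡1 refl)))
                           (∑-member (upTo n) (λ θ → ⟨ θ ≡ l + k ⟩) (∈-upTo⁺ l+k<n))) ⟩
    (∑[ θ ∈ upTo n ] ⟨ l ≤ θ × θ < l + k ⟩) + (∑[ θ ∈ upTo n ] ⟨ θ ≡ l + k ⟩)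
      ≡⟨ ∑-+ (upTo n) _ _ ⟨
    (∑[ θ ∈ upTo n ] (⟨ l ≤ θ × θ < l + k ⟩ + ⟨ θ ≡ l + k ⟩))
      ≤⟨ ∑-mono (upTo n) (λ {θ} _ → step θ) ⟩
    (∑[ θ ∈ upTo n ] ⟨ l ≤ θ × θ < l + suc k ⟩) ∎
    where
    open ≤-Reasoning
    l+k<n : l + k < n
    l+k<n = ≤-trans (≤-reflexive (sym (+-suc l k))) l+k≤n
    step : ∀ θ → ⟨ l ≤ θ × θ < l + k ⟩ + ⟨ θ ≡ l + k ⟩ ≤ ⟨ l ≤ θ × θ < l + suc k ⟩
    step θ = by-cases (θ ≡ l + k)
      (λ θ≡ → ≤-trans (+-mono-≤ (≤-reflexive (⟨⟩≡0 (λ (_ , θ<) → <-irrefl θ≡ θ<))) (⟨⟩≤1 _))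
        (≤-reflexive (sym (⟨⟩≡1 ( ≤-trans (m≤m+n l k) (≤-reflexive (sym θ≡))
                                , ≤-trans (≤-reflexive (cong suc θ≡)) (≤-reflexive (sym (+-suc l k))))))))
      (λ θ≢ → ≤-trans (+-monoʳ-≤ _ (≤-reflexive (⟨⟩≡0 θ≢))) (≤-trans (≤-reflexive (+-identityʳ _))
        (⟨⟩-mono (λ (l≤ , θ<) → l≤ , ≤-trans θ< (+-monoʳ-≤ l (n≤1+n k))))))

  -- Pigeonhole with S a longest list of the family; `P []` supplies S when the family is empty.
  average : ∀ (P : List B → Set p) → P [] → (c : A → List B) → (∀ x → P (c x)) → ∀ xs →
            ∃[ S ] P S × (∑[ x ∈ xs ] length (c x)) ≤ length S * length xs
  average P P[] c Pc []       = [] , P[] , z≤n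
  average P P[] c Pc (x ∷ xs) with average P P[] c Pc xs
  ... | S , PS , bound with ≤-total (length (c x)) (length S)
  ... | inj₁ cx≤S = S , PS , ≤-trans (+-mono-≤ cx≤S bound) (≤-reflexive (sym (*-suc (length S) (length xs))))
  ... | inj₂ S≤cx = c x , Pc x , ≤-trans (+-monoʳ-≤ _ (≤-trans bound (*-monoˡ-≤ (length xs) S≤cx)))
                                         (≤-reflexive (sym (*-suc (length (c x)) (length xs))))

  -- A weighted form of Mirsky's theorem: each y occupies the interval of length μ y
  -- that ends at the largest weight of a chain with top y, and the elements whose
  -- intervals share a point are pairwise incomparable.
  module Mirsky {Y : Set a} (_⊑_ : Rel Y r) (⊑-refl : Reflexive _⊑_) (⊑-trans : Transitive _⊑_)
                (f : Y → ℕ) (f-strict : ∀ {y z} → y ⊑ z → f z ≤ f y → z ⊑ y)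
                (μ : Y → ℕ) where

    height : List (Y × ℕ) → Y → ℕ
    height []            y = 0
    height ((z , l) ∷ D) y = ⟨ z ⊑ y ⟩ * (l + μ z) ⊔ height D y

    -- Built from the tail. In a list sorted by descending `f`, everything strictly below an element
    -- stands behind it, so its starting level is final when it is inserted.
    levels : List Y → List (Y × ℕ)
    levels []       = []
    levels (y ∷ ys) = (y , height (levels ys) y) ∷ levels ys

    map-levels : ∀ ys → map proj₁ (levels ys) ≡ ys
    map-levels []       = refl
    map-levels (y ∷ ys) = cong (y ∷_) (map-levels ys)

    height-above : ∀ D {z l y} → (z , l) ∈ D → z ⊑ y → l + μ z ≤ height D y
    height-above ((z , l) ∷ D) (here refl) z⊑y = ≤-trans
      (≤-reflexive (trans (sym (*-identityˡ _)) (cong (_* (l + μ z)) (sym (⟨⟩≡1 z⊑y)))))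
      (m≤m⊔n _ (height D _))
    height-above (_ ∷ D) (there z∈) z⊑y = ≤-trans (height-above D z∈ z⊑y) (m≤n⊔m _ _)

    ChainBelow : List Y → Y → ℕ → Set _
    ChainBelow ys y h =
      ∃[ C ] Unique C × C ⊆ ys × Chain _⊑_ C × (∀ {c} → c ∈ C → c ⊑ y) × ∑ C μ ≡ h

    extend : ∀ {y ys h} → All (y ≢_) ys → ChainBelow ys y h → ChainBelow (y ∷ ys) y (h + μ y)
    extend {y} y∉ (C , u , C⊆ , ch , below , s) =
      y ∷ C , All.tabulate (λ c∈ → All.lookup y∉ (C⊆ c∈)) ∷ u ,
      (λ { (here refl) → here refl ; (there c∈) → there (C⊆ c∈) }) ,
      (λ { (here refl) (here refl) → inj₁ ⊑-refl ; (here refl) (there c∈) → inj₂ (below c∈)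
         ; (there c∈) (here refl) → inj₁ (below c∈) ; (there c∈) (there d∈) → ch c∈ d∈ }) ,
      (λ { (here refl) → ⊑-refl ; (there c∈) → below c∈ }) ,
      trans (+-comm (μ y) _) (cong (_+ μ y) s)

    weaken : ∀ {y z ys h} → ChainBelow ys y h → ChainBelow (z ∷ ys) y h
    weaken (C , u , C⊆ , rest) = C , u , (λ c∈ → there (C⊆ c∈)) , rest

    raise : ∀ {y z ys h} → z ⊑ y → ChainBelow ys z h → ChainBelow ys y h
    raise z⊑y (C , u , C⊆ , ch , below , s) = C , u , C⊆ , ch , (λ c∈ → ⊑-trans (below c∈) z⊑y) , s

    height-chain : ∀ ys → Unique ys → ∀ y → ChainBelow ys y (height (levels ys) y)
    height-chain []       u y = [] , [] , (λ ()) , (λ ()) , (λ ()) , refl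
    -- The head decides the maximum exactly when z ⊑ y and z ends at least as high as the tail
    -- reaches. Then the best chain below z, extended by z, is the witness; otherwise the chain
    -- found in the tail is kept.
    height-chain (z ∷ ys) (z∉ ∷ u) y = by-cases (z ⊑ y × height (levels ys) y ≤ height (levels ys) z + μ z)
      (λ (z⊑y , ≤z) → subst (ChainBelow (z ∷ ys) y)
        (sym (trans (m≥n⇒m⊔n≡m (≤-trans ≤z (≤-reflexive (sym (one z⊑y))))) (one z⊑y)))
        (raise z⊑y (extend z∉ (height-chain ys u z))))
      (λ ¬both → subst (ChainBelow (z ∷ ys) y) (sym (m≤n⇒m⊔n≡n (small ¬both)))
        (weaken (height-chain ys u y)))
      where
      h = height (levels ys) z + μ z
      one : z ⊑ y → ⟨ z ⊑ y ⟩ * h ≡ h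
      one z⊑y = trans (cong (_* h) (⟨⟩≡1 z⊑y)) (*-identityˡ h)
      small : ¬ (z ⊑ y × height (levels ys) y ≤ h) → ⟨ z ⊑ y ⟩ * h ≤ height (levels ys) y
      small ¬both = by-cases (z ⊑ y)
        (λ z⊑y → ≤-trans (≤-reflexive (one z⊑y)) (<⇒≤ (≰⇒> (λ ≤h → ¬both (z⊑y , ≤h)))))
        (λ ¬z⊑y → ≤-trans (≤-reflexive (cong (_* h) (⟨⟩≡0 ¬z⊑y))) z≤n)

    BoundedChains : List Y → ℕ → Set _
    BoundedChains ys H = ∀ C → Unique C → C ⊆ ys → Chain _⊑_ C → ∑ C μ ≤ H

    levels-bounded : ∀ ys {H} → Unique ys → BoundedChains ys H →
                     All (λ (y , l) → l + μ y ≤ H) (levels ys)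
    levels-bounded []       u         bound = []
    levels-bounded (y ∷ ys) (y∉ ∷ u) bound =
      (case extend y∉ (height-chain ys u y) of λ
        (C , uC , C⊆ , ch , _ , s) → ≤-trans (≤-reflexive (sym s)) (bound C uC C⊆ ch)) ∷
      levels-bounded ys u (λ C uC C⊆ → bound C uC (λ c∈ → there (C⊆ c∈)))

    levels-disjoint : ∀ ys → AllPairs (λ (y , l) (z , l′) → z ⊑ y → l′ + μ z ≤ l) (levels ys)
    levels-disjoint []       = []
    levels-disjoint (y ∷ ys) = All.tabulate (λ z∈ z⊑y → height-above (levels ys) z∈ z⊑y) ∷ levels-disjoint ys

    AtLevel : ℕ → Y × ℕ → Set
    AtLevel θ (y , l) = l ≤ θ × θ < l + μ y

    level : List Y → ℕ → List Y
    level ys θ = map proj₁ (select (AtLevel θ) (levels ys))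

    -- Let y stand before z with both intervals containing θ. By disjointness z ⊑ y is impossible;
    -- and y ⊑ z would, since z is not larger in `f`, imply z ⊑ y through `f-strict`.
    level-antichain : ∀ ys → AllPairs (λ y z → f z ≤ f y) ys → ∀ θ → Antichain _⊑_ (level ys θ)
    level-antichain ys sorted θ = AllPairsₚ.map⁺
      (go (levels ys) (levels-disjoint ys)
        (AllPairsₚ.map⁻ (subst (AllPairs _) (sym (map-levels ys)) sorted)))
      where
      go : ∀ D → AllPairs (λ (y , l) (z , l′) → z ⊑ y → l′ + μ z ≤ l) D →
           AllPairs (λ (y , _) (z , _) → f z ≤ f y) D →
           AllPairs (λ (y , _) (z , _) → ¬ y ⊑ z × ¬ z ⊑ y) (select (AtLevel θ) D)
      go D dis srt = AllPairs-combine (AllPairsₚ.filter⁺ _ dis) (AllPairsₚ.filter⁺ _ srt)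
                                      (λ x∈ → proj₂ (∈-select⁻ {xs = D} x∈))
        where
        AllPairs-combine : ∀ {D′} → AllPairs (λ (y , l) (z , l′) → z ⊑ y → l′ + μ z ≤ l) D′ →
          AllPairs (λ (y , _) (z , _) → f z ≤ f y) D′ → (∀ {d} → d ∈ D′ → AtLevel θ d) →
          AllPairs (λ (y , _) (z , _) → ¬ y ⊑ z × ¬ z ⊑ y) D′
        AllPairs-combine []        []        at = []
        AllPairs-combine (d₁ ∷ ds) (s₁ ∷ ss) at =
          All.tabulate (λ z∈ →
            let ¬z⊑y = λ z⊑y → <-irrefl refl
                  (≤-trans (proj₂ (at (there z∈))) (≤-trans (All.lookup d₁ z∈ z⊑y) (proj₁ (at (here refl)))))
            in (λ y⊑z → ¬z⊑y (f-strict y⊑z (All.lookup s₁ z∈))) , ¬z⊑y) ∷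
          AllPairs-combine ds ss (at ∘ there)

    level-⊆ : ∀ ys θ → level ys θ ⊆ ys
    level-⊆ ys θ y∈ with ∈-map⁻ proj₁ y∈
    ... | d , d∈ , refl = subst (_ ∈_) (map-levels ys)
      (∈-map⁺ proj₁ (select-⊆ {xs = levels ys} d∈))

    -- Double counting of pairs of an element and a level below H in its interval: y accounts for
    -- `μ y` pairs, so some level contains at least the average number of elements.
    mirsky-sorted : ∀ ys {H} → Unique ys → AllPairs (λ y z → f z ≤ f y) ys → BoundedChains ys H →
                    ∃[ S ] (S ⊆ ys × Antichain _⊑_ S) × ∑ ys μ ≤ length S * H
    mirsky-sorted ys {H} u sorted bound
      with average (λ S → S ⊆ ys × Antichain _⊑_ S) ((λ ()) , [])
                   (level ys) (λ θ → level-⊆ ys θ , level-antichain ys sorted θ) (upTo H)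
    ... | S , PS , le = S , PS , (begin
      ∑ ys μ
        ≡⟨ cong (λ zs → ∑ zs μ) (sym (map-levels ys)) ⟩
      ∑ (map proj₁ D) μ
        ≡⟨ ∑-map proj₁ D μ ⟩
      (∑[ d ∈ D ] μ (proj₁ d))
        ≤⟨ ∑-mono D (λ {(y , l)} d∈ → interval-length l (μ y) H (All.lookup (levels-bounded ys u bound) d∈)) ⟩
      (∑[ d ∈ D ] ∑[ θ ∈ upTo H ] ⟨ AtLevel θ d ⟩)
        ≡⟨ ∑-swap D (upTo H) (λ d θ → ⟨ AtLevel θ d ⟩) ⟩
      (∑[ θ ∈ upTo H ] ∑[ d ∈ D ] ⟨ AtLevel θ d ⟩)
        ≡⟨ ∑-cong (upTo H) (λ {θ} _ → sym (trans (length-map proj₁ (select (AtLevel θ) D)) (length-select (AtLevel θ) D))) ⟩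
      (∑[ θ ∈ upTo H ] length (level ys θ))
        ≤⟨ le ⟩
      length S * length (upTo H)
        ≡⟨ cong (length S *_) (length-upTo H) ⟩
      length S * H ∎)
      where
      open ≤-Reasoning
      D = levels ys

    mirsky : ∀ ys {H} → Unique ys → BoundedChains ys H →
             ∃[ S ] S ⊆ ys × Antichain _⊑_ S × ∑ ys μ ≤ length S * H
    mirsky ys u bound with mirsky-sorted (descending f ys) (Unique-resp-↭ perm u) (descending-sorted f ys)
                             (λ C uC C⊆ → bound C uC (λ c∈ → ∈-resp-↭ (↭-sym perm) (C⊆ c∈)))
      where perm = descending-↭ f ys
    ... | S , (S⊆ , anti) , le = S , (λ y∈ → ∈-resp-↭ (↭-sym (descending-↭ f ys)) (S⊆ y∈)) , anti ,
                                 ≤-trans (≤-reflexive (∑-↭ μ (descending-↭ f ys))) le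

  AllPairs-++⁻ : ∀ {R : Rel A r} xs {ys} → AllPairs R (xs ++ ys) → ∀ {x y} → x ∈ xs → y ∈ ys → R x y
  AllPairs-++⁻ (x ∷ xs) (px ∷ pxs) (here refl) y∈ = All.lookup px (∈-++⁺ʳ xs y∈)
  AllPairs-++⁻ (x ∷ xs) (px ∷ pxs) (there x∈)  y∈ = AllPairs-++⁻ xs pxs x∈ y∈

  -- Fibres and bicliques

  Below : REL X Y r → List X → Rel Y _
  Below R A y z = ∀ {x} → x ∈ A → R x y → R x z

  Below-refl : (R : REL X Y r) (A : List X) → Reflexive (Below R A)
  Below-refl R A _ Rxy = Rxy

  Below-trans : (R : REL X Y r) (A : List X) → Transitive (Below R A)
  Below-trans R A y⊑z z⊑w x∈ Rxy = z⊑w x∈ (y⊑z x∈ Rxy)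

  -- A finite set contained in one that is not larger equals it. This makes the degree an admissible
  -- `f` for `Mirsky`.
  Below-strict : (R : REL X Y r) (A : List X) → ∀ {y z} → Below R A y z → deg R A z ≤ deg R A y → Below R A z y
  Below-strict R A {y} {z} y⊑z z≤y {x} x∈ Rxz = by-cases (R x y) id λ ¬Rxy →
    contradiction z≤y (<⇒≱ (∑-strict A (λ x∈ → ⟨⟩-mono (y⊑z x∈)) x∈
      (≤-trans (s≤s (≤-reflexive (⟨⟩≡0 ¬Rxy))) (≤-reflexive (sym (⟨⟩≡1 Rxz))))))

  mirsky-fibres : (R : REL X Y r) (A : List X) (μ : Y → ℕ) → ∀ B {H} → Unique B →
    (∀ C → Unique C → C ⊆ B → Chain (Below R A) C → ∑ C μ ≤ H) →
    ∃[ S ] S ⊆ B × Antichain (Below R A) S × ∑ B μ ≤ length S * H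
  mirsky-fibres R A = Mirsky.mirsky (Below R A) (λ {y} → Below-refl R A {y})
    (λ {x} {y} {z} → Below-trans R A {x} {y} {z}) (deg R A) (Below-strict R A)

  -- The first k members would have a common point, so the semi-equation nests two of them. That
  -- nesting holds on all of X, in particular within A.
  antichain-length : ∀ k (R : REL X Y r) A S {x} → SemiEquation k R → Antichain (Below R A) S →
                     (∀ {y} → y ∈ S → R x y) → length S < k
  antichain-length k R A S {x} semi anti RxS with k ≤? length S
  ... | no k≰ = ≰⇒> k≰
  ... | yes k≤ with semi (λ i → lookup S (inject≤ i k≤)) (x , λ i → RxS (∈-lookup (inject≤ i k≤)))
  ... | i , j , i≢j , nested = contradiction (λ {x} (_ : x ∈ A) → nested x)
    (proj₁ (AllPairs-lookup anti (λ (f , g) → g , f) (inject≤ i k≤) (inject≤ j k≤)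
      (i≢j ∘ inject≤-injective k≤ k≤ i j)))

  KFree-mono : ∀ {q t} {R : REL X Y r} {Q : REL X Y q} {A A′ B B′} → A′ ⊆ A → B′ ⊆ B →
    (∀ {x y} → x ∈ A′ → y ∈ B′ → Q x y → R x y) → KFree t R A B → KFree t Q A′ B′
  KFree-mono A′⊆A B′⊆B Q⇒R free (A″ , B″ , uA , lA , A″⊆ , uB , lB , B″⊆ , Q″) =
    free (A″ , B″ , uA , lA , (λ x∈ → A′⊆A (A″⊆ x∈)) , uB , lB , (λ y∈ → B′⊆B (B″⊆ y∈)) ,
          λ x∈ y∈ → Q⇒R (A″⊆ x∈) (B″⊆ y∈) (Q″ x∈ y∈))

  Unique-take : ∀ n {xs : List X} → Unique xs → Unique (take n xs)
  Unique-take n = Uniqueₚ.take⁺ n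

  length-take-≤ : ∀ n (xs : List X) → n ≤ length xs → length (take n xs) ≡ n
  length-take-≤ n xs n≤ = trans (length-take n xs) (m≤n⇒m⊓n≡m n≤)

  biclique : ∀ {t} {R : REL X Y r} {A B} {A′ B′} → Unique A′ → t ≤ length A′ → A′ ⊆ A →
             Unique B′ → t ≤ length B′ → B′ ⊆ B →
             (∀ {x y} → x ∈ A′ → y ∈ B′ → R x y) → ¬ KFree t R A B
  biclique {t = t} {A′ = A′} {B′} uA t≤A A′⊆ uB t≤B B′⊆ R′ free = free
    ( take t A′ , take t B′
    , Unique-take t uA , length-take-≤ t A′ t≤A , (λ x∈ → A′⊆ (take-⊆ˢ t A′ x∈))
    , Unique-take t uB , length-take-≤ t B′ t≤B , (λ y∈ → B′⊆ (take-⊆ˢ t B′ y∈))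
    , λ x∈ y∈ → R′ (take-⊆ˢ t A′ x∈) (take-⊆ˢ t B′ y∈))

  Heavy : ∀ (R : REL X Y r) → List X → ℕ → Y → Set
  Heavy R A t y = t ≤ deg R A y

  -- The least of t nested fibres with at least t points lies in all the others, which makes a
  -- biclique.
  heavy-chain : ∀ t → .{{NonZero t}} → (R : REL X Y r) → ∀ {A C} → Unique A → Unique C →
                Chain (Below R A) C → KFree t R A C → length (select (Heavy R A t) C) < t
  heavy-chain t R {A} {C} uA uC ch free with t ≤? length (select (Heavy R A t) C)
  ... | no t≰ = ≰⇒> t≰
  ... | yes t≤ = go (select (Heavy R A t) C) refl
    where
    go : ∀ D → select (Heavy R A t) C ≡ D → length (select (Heavy R A t) C) < t
    -- The minimum exists because t is positive.
    go []      eq = contradiction (subst (λ D → t ≤ length D) eq t≤) (<⇒≱ (>-nonZero⁻¹ t))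
    go (y ∷ D) eq
      with chain-minimum {_⊑_ = Below R A} (λ {y} → Below-refl R A {y}) (λ {x} {y} {z} → Below-trans R A {x} {y} {z}) y D
             (Chain-⊆ {_⊑_ = Below R A} (λ z∈ → select-⊆ {xs = C} (subst (_ ∈_) (sym eq) z∈)) ch)
    ... | m , m∈ , m⊑ = ⊥-elim (biclique
      (select-unique {P = λ x → R x m} uA)
      (≤-trans (proj₂ (∈-select⁻ {xs = C} (subst (m ∈_) (sym eq) m∈)))
               (≤-reflexive (sym (length-select (λ x → R x m) A))))
      (select-⊆ {xs = A})
      (select-unique {P = Heavy R A t} uC) t≤ (select-⊆ {xs = C})
      (λ x∈ y∈ → m⊑ (subst (_ ∈_) eq y∈) (proj₁ (∈-select⁻ {xs = A} x∈)) (proj₂ (∈-select⁻ {xs = A} x∈)))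
      free)

  E : REL X Y r → List X → List Y → ℕ
  E R A B = ∑[ y ∈ B ] deg R A y

  E-++ : ∀ (R : REL X Y r) A₁ A₂ B → E R (A₁ ++ A₂) B ≡ E R A₁ B + E R A₂ B
  E-++ R A₁ A₂ B = trans (∑-cong B (λ {y} _ → ∑-++ A₁ A₂ (λ x → ⟨ R x y ⟩))) (∑-+ B (deg R A₁) (deg R A₂))

  E-mono : ∀ {q} (R : REL X Y r) (Q : REL X Y q) A B →
           (∀ {x y} → x ∈ A → y ∈ B → R x y → Q x y) → E R A B ≤ E Q A B
  E-mono R Q A B R⇒Q = ∑-mono B (λ y∈ → ∑-mono A (λ x∈ → ⟨⟩-mono (R⇒Q x∈ y∈)))

  E-empty : ∀ (R : REL X Y r) A B → (∀ {x y} → x ∈ A → y ∈ B → ¬ R x y) → E R A B ≡ 0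
  E-empty R A B ¬R = n≤0⇒n≡0 (≤-trans
    (∑-bounded B (λ y∈ → ≤-trans (∑-bounded A (λ x∈ → ≤-reflexive (⟨⟩≡0 (¬R x∈ y∈))))
                                 (≤-reflexive (*-zeroʳ (length A)))))
    (≤-reflexive (*-zeroʳ (length B))))

  E-trivial : ∀ (R : REL X Y r) A B → E R A B ≤ length A * length B
  E-trivial R A B = ≤-trans (∑-bounded B (λ {y} _ → deg-trivial y)) (≤-reflexive (*-comm (length B) (length A)))
    where
    deg-trivial : ∀ y → deg R A y ≤ length A
    deg-trivial y = ≤-trans (∑-bounded A (λ {x} _ → ⟨⟩≤1 (R x y))) (≤-reflexive (*-identityʳ (length A)))

  -- Here `m` only bounds |A|. The property therefore passes to subsets of A with the same α, so
  -- that a logarithmic factor in α can be fixed once in terms of m.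
  Lin : ℕ → ℕ → REL X Y r → ℕ → Set _
  Lin t m R α = ∀ {A B} → Unique A → Unique B → length A ≤ m → KFree t R A B →
                E R A B ≤ α * (length A + length B)

  Lin-≤ : ∀ {t m} {R : REL X Y r} {α β} → α ≤ β → Lin t m R α → Lin t m R β
  Lin-≤ α≤β lin {A} {B} uA uB A≤ free = ≤-trans (lin uA uB A≤ free) (*-monoˡ-≤ (length A + length B) α≤β)

  Lin-resp : ∀ {q t m} {R : REL X Y r} {Q : REL X Y q} {α} →
             (∀ {x y} → R x y → Q x y) → (∀ {x y} → Q x y → R x y) → Lin t m R α → Lin t m Q α
  Lin-resp {R = R} {Q} R⇒Q Q⇒R lin {A} {B} uA uB A≤ free =
    ≤-trans (E-mono Q R A B (λ _ _ → Q⇒R)) (lin uA uB A≤ (KFree-mono id id (λ _ _ → R⇒Q) free))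

  infixr 7 _∧_
  _∧_ : ∀ {q} → REL X Y r → REL X Y q → REL X Y _
  (P ∧ Q) x y = P x y × Q x y

  module _ {q : Level} {t m α : ℕ} {Q : REL X Y q} (lin : Lin t m Q α) (P : REL X Y r) where

    -- Inside `P` the relations `P ∧ Q` and `Q` coincide, so freeness of the former is freeness of
    -- the latter.
    full-bound : ∀ {A B} → Unique A → Unique B → length A ≤ m → (∀ {x y} → x ∈ A → y ∈ B → P x y) →
                 KFree t (P ∧ Q) A B → E (P ∧ Q) A B ≤ α * (length A + length B)
    full-bound {A} {B} uA uB A≤ P! free = ≤-trans (E-mono (P ∧ Q) Q A B (λ _ _ → proj₂))
      (lin uA uB A≤ (KFree-mono id id (λ x∈ y∈ Qxy → P! x∈ y∈ , Qxy) free))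

    -- The points of A are ordered so that every fibre is an initial segment.
    Initial : List X → List Y → Set _
    Initial A C = AllPairs (λ x x′ → ∀ {y} → y ∈ C → P x′ y → P x y) A

    -- Divide and conquer: A is halved into A₁ before A₂, and C into the fibres C₂ containing A₁ and
    -- the rest C₁. A₁ × C₂ is a biclique of `P`, A₂ × C₁ has no edges, and the other two blocks
    -- recurse. The blocks that recurse are disjoint in both coordinates, so each of the s + 1
    -- layers costs at most α (|A| + |C|).
    initial-bound : ∀ s {A C} → length A ≤ 2 ^ s → length A ≤ m → Unique A → Unique C → Initial A C →
                    KFree t (P ∧ Q) A C → E (P ∧ Q) A C ≤ suc s * α * (length A + length C)
    initial-bound zero {[]} {C} A≤ _ uA uC init free = ≤-trans (≤-reflexive (E-empty (P ∧ Q) [] C λ ())) z≤n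
    initial-bound zero {x ∷ []} {C} A≤ A≤m uA uC init free = begin
      E (P ∧ Q) (x ∷ []) C
        ≡⟨ ∑-partition (P x) C (deg (P ∧ Q) (x ∷ [])) ⟩
      E (P ∧ Q) (x ∷ []) C₁ + E (P ∧ Q) (x ∷ []) (select (¬_ ∘ P x) C)
        ≡⟨ cong (E (P ∧ Q) (x ∷ []) C₁ +_) (E-empty (P ∧ Q) (x ∷ []) (select (¬_ ∘ P x) C) λ { (here refl) y∈ (Pxy , _) → proj₂ (∈-select⁻ {xs = C} y∈) Pxy }) ⟩
      E (P ∧ Q) (x ∷ []) C₁ + 0
        ≡⟨ +-identityʳ _ ⟩
      E (P ∧ Q) (x ∷ []) C₁
        ≤⟨ full-bound uA (select-unique uC) A≤m (λ { (here refl) y∈ → proj₂ (∈-select⁻ {xs = C} y∈) })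
             (KFree-mono id (select-⊆ {xs = C}) (λ _ _ → id) free) ⟩
      α * (1 + length C₁)
        ≤⟨ *-mono-≤ (≤-reflexive (sym (*-identityˡ α))) (+-monoʳ-≤ 1 (length-select-≤ (P x) C)) ⟩
      1 * α * (1 + length C) ∎
      where
      open ≤-Reasoning
      C₁ = select (P x) C
    initial-bound zero {_ ∷ _ ∷ _} (s≤s ()) A≤m uA uC init free
    initial-bound (suc s) {A} {C} A≤ A≤m uA uC init free =
      subst₂ (λ e n → e ≤ suc (suc s) * α * (n + length C))
        (cong (λ A → E (P ∧ Q) A C) (take++drop≡id h A)) (cong length (take++drop≡id h A)) (begin
      E (P ∧ Q) (A₁ ++ A₂) C
        ≡⟨ E-++ (P ∧ Q) A₁ A₂ C ⟩
      E (P ∧ Q) A₁ C + E (P ∧ Q) A₂ C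
        ≡⟨ cong₂ _+_ (∑-partition All₁ C _) (∑-partition All₁ C _) ⟩
      (E (P ∧ Q) A₁ C₂ + E (P ∧ Q) A₁ C₁) + (E (P ∧ Q) A₂ C₂ + E (P ∧ Q) A₂ C₁)
        ≤⟨ +-mono-≤ (+-mono-≤
             (full-bound uA₁ uC₂ (≤-trans A₁≤A A≤m) (λ x∈ y∈ → proj₂ (∈-select⁻ {P = All₁} {xs = C} y∈) x∈) (sub A₁⊆ C₂⊆))
             (initial-bound s A₁≤ (≤-trans A₁≤A A≤m) uA₁ uC₁ (initial-⊆ C₁⊆ (AllPairsₚ.take⁺ h init)) (sub A₁⊆ C₁⊆)))
             (+-mono-≤
             (initial-bound s A₂≤ (≤-trans A₂≤A A≤m) uA₂ uC₂ (initial-⊆ C₂⊆ (AllPairsₚ.drop⁺ h init)) (sub A₂⊆ C₂⊆))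
             (≤-reflexive (E-empty (P ∧ Q) A₂ C₁ none))) ⟩
      (α * (a₁ + c₂) + suc s * α * (a₁ + c₁)) + (suc s * α * (a₂ + c₂) + 0)
        -- A₂ and C₁ take no part in the biclique of this layer; paying for them as well makes the
        -- sum factor.
        ≤⟨ m≤m+n _ (α * (a₂ + c₁)) ⟩
      (α * (a₁ + c₂) + suc s * α * (a₁ + c₁)) + (suc s * α * (a₂ + c₂) + 0) + α * (a₂ + c₁)
        ≡⟨ arith (suc s) α a₁ a₂ c₁ c₂ ⟩
      suc (suc s) * α * (a₁ + a₂ + (c₂ + c₁))
        ≡⟨ cong₂ (λ a c → suc (suc s) * α * (a + c)) (sym (length-++ A₁)) (sym (length-partition All₁ C)) ⟩
      suc (suc s) * α * (length (A₁ ++ A₂) + length C) ∎)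
      where
      open ≤-Reasoning
      h = 2 ^ s
      A₁ = take h A
      A₂ = drop h A
      All₁ : Y → Set _
      All₁ y = ∀ {x} → x ∈ A₁ → P x y
      C₁ = select (¬_ ∘ All₁) C
      C₂ = select All₁ C
      a₁ = length A₁
      a₂ = length A₂
      c₁ = length C₁
      c₂ = length C₂
      uA₁ : Unique A₁
      uA₁ = Uniqueₚ.take⁺ h uA
      uA₂ : Unique A₂
      uA₂ = Uniqueₚ.drop⁺ h uA
      uC₁ : Unique C₁
      uC₁ = select-unique uC
      uC₂ : Unique C₂
      uC₂ = select-unique uC
      A₁⊆ : A₁ ⊆ A
      A₁⊆ = take-⊆ˢ h A
      A₂⊆ : A₂ ⊆ A
      A₂⊆ x∈ = Sublist.lookup (drop-⊆ h A) x∈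
      C₁⊆ : C₁ ⊆ C
      C₁⊆ = select-⊆ {xs = C}
      C₂⊆ : C₂ ⊆ C
      C₂⊆ = select-⊆ {xs = C}
      A₁≤ : a₁ ≤ h
      A₁≤ = ≤-trans (≤-reflexive (length-take h A)) (m⊓n≤m h _)
      A₁≤A : a₁ ≤ length A
      A₁≤A = ≤-trans (≤-reflexive (length-take h A)) (m⊓n≤n h _)
      A₂≤A : a₂ ≤ length A
      A₂≤A = ≤-trans (≤-reflexive (length-drop h A)) (m∸n≤m _ h)
      A₂≤ : a₂ ≤ h
      A₂≤ = ≤-trans (≤-reflexive (length-drop h A)) (≤-trans (∸-monoˡ-≤ h A≤)
        (≤-reflexive (trans (m+n∸m≡n h (h + 0)) (+-identityʳ h))))
      sub : ∀ {A′ C′} → A′ ⊆ A → C′ ⊆ C → KFree t (P ∧ Q) A′ C′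
      sub A′⊆ C′⊆ = KFree-mono A′⊆ C′⊆ (λ _ _ → id) free
      initial-⊆ : ∀ {A C C′} → C′ ⊆ C → Initial A C → Initial A C′
      initial-⊆ C′⊆ = AllPairs.map (λ f {y} y∈ → f {y} (C′⊆ y∈))
      crossing : ∀ {x x′ y} → x ∈ A₁ → x′ ∈ A₂ → y ∈ C → P x′ y → P x y
      crossing x∈ x′∈ = AllPairs-++⁻ A₁ (subst (λ A → Initial A C) (sym (take++drop≡id h A)) init) x∈ x′∈
      none : ∀ {x y} → x ∈ A₂ → y ∈ C₁ → ¬ (P ∧ Q) x y
      none x∈ y∈ (Pxy , _) = proj₂ (∈-select⁻ {P = ¬_ ∘ All₁} {xs = C} y∈) (λ x′∈ → crossing x′∈ x∈ (C₁⊆ y∈) Pxy)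
      arith : ∀ s α a₁ a₂ c₁ c₂ →
        (α * (a₁ + c₂) + s * α * (a₁ + c₁)) + (s * α * (a₂ + c₂) + 0) + α * (a₂ + c₁)
        ≡ suc s * α * (a₁ + a₂ + (c₂ + c₁))
      arith = solve-∀

    -- Points are ordered by the number of fibres of C through them. If a fibre contained x′ but not
    -- an earlier x, every fibre of the chain through x would also contain x′, so x′ would lie on
    -- strictly more fibres than x.
    chain-initial : ∀ A C → Chain (Below P A) C → ∀ {A′} → A′ ⊆ A →
                    AllPairs (λ x x′ → (∑[ y ∈ C ] ⟨ P x′ y ⟩) ≤ (∑[ y ∈ C ] ⟨ P x y ⟩)) A′ → Initial A′ C
    chain-initial A C ch A′⊆ [] = []
    chain-initial A C ch {x ∷ A′} A′⊆ (x≥ ∷ sorted) =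
      All.tabulate (λ {x′} x′∈ {y} y∈ Px′y → by-cases (P x y) id λ ¬Pxy →
        contradiction (All.lookup x≥ x′∈) (<⇒≱ (∑-strict C
          (λ z∈ → ⟨⟩-mono (λ Pxz → [ (λ y⊑z → y⊑z (A′⊆ (there x′∈)) Px′y)
                                   , (λ z⊑y → contradiction (z⊑y (A′⊆ (here refl)) Pxz) ¬Pxy) ]′ (ch y∈ z∈)))
          y∈ (≤-trans (s≤s (≤-reflexive (⟨⟩≡0 ¬Pxy))) (≤-reflexive (sym (⟨⟩≡1 Px′y)))))))
      ∷ chain-initial A C ch (λ x∈ → A′⊆ (there x∈)) sorted

    chain-bound : ∀ s {A C} → length A ≤ 2 ^ s → length A ≤ m → Unique A → Unique C → Chain (Below P A) C →
                  KFree t (P ∧ Q) A C → E (P ∧ Q) A C ≤ suc s * α * (length A + length C)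
    chain-bound s {A} {C} A≤ A≤m uA uC ch free =
      subst₂ (λ e n → e ≤ suc s * α * (n + length C))
        (∑-cong C (λ {y} _ → sym (∑-↭ (λ x → ⟨ (P ∧ Q) x y ⟩) perm))) (sym len)
        (initial-bound s (≤-trans (≤-reflexive (sym len)) A≤) (≤-trans (≤-reflexive (sym len)) A≤m)
          (Unique-resp-↭ perm uA) uC (chain-initial A C ch back (descending-sorted count A))
          (KFree-mono back id (λ _ _ → id) free))
      where
      count : X → ℕ
      count x = ∑[ y ∈ C ] ⟨ P x y ⟩
      perm = descending-↭ count A
      len = ↭-length perm
      back : descending count A ⊆ A
      back = ∈-resp-↭ (↭-sym perm)

  -- Adding a positive conjunct

  dyadic : ∀ q {d} → 1 ≤ d → d < 2 ^ suc q → ∃[ j ] j < suc q × 2 ^ j ≤ d × d < 2 ^ suc j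
  dyadic zero    1≤d d< = 0 , s≤s z≤n , 1≤d , d<
  dyadic (suc q) {d} 1≤d d< with d <? 2 ^ suc q
  ... | no d≮ = suc q , ≤-refl , ≮⇒≥ d≮ , d<
  ... | yes d<′ with dyadic q 1≤d d<′
  ... | j , j< , rest = j , m<n⇒m<1+n j< , rest

  select-all : ∀ {P : A → Set p} xs → (∀ {x} → x ∈ xs → P x) → select P xs ≡ xs
  select-all xs holds = filter-all _ (All.tabulate holds)

  Chain-within : ∀ (R : REL X Y r) {A A′ C} → A′ ⊆ A → Chain (Below R A) C → Chain (Below R A′) C
  Chain-within R A′⊆A ch y∈ z∈ with ch y∈ z∈
  ... | inj₁ y⊑z = inj₁ (λ x∈ → y⊑z (A′⊆A x∈))
  ... | inj₂ z⊑y = inj₂ (λ x∈ → z⊑y (A′⊆A x∈))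

  -- Truncated subtraction removes the vertices with `d` below α. For the others the assumed bound
  -- allows α per vertex, and only H remains.
  excess : ∀ (d : Y → ℕ) α C {H} →
           ∑ (select (λ y → α ≤ d y) C) d ≤ α * length (select (λ y → α ≤ d y) C) + H →
           (∑[ y ∈ C ] (d y ∸ α)) ≤ H
  excess {Y = Y} d α C {H} bound = begin
    ∑ C μ
      ≡⟨ ∑-partition L C μ ⟩
    ∑ C₁ μ + ∑ (select (¬_ ∘ L) C) μ
      ≤⟨ +-monoʳ-≤ (∑ C₁ μ) (∑-bounded (select (¬_ ∘ L) C) (λ y∈ →
           ≤-reflexive (m≤n⇒m∸n≡0 (<⇒≤ (≰⇒> (proj₂ (∈-select⁻ {xs = C} y∈))))))) ⟩
    ∑ C₁ μ + length (select (¬_ ∘ L) C) * 0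
      ≡⟨ cong (∑ C₁ μ +_) (*-zeroʳ (length (select (¬_ ∘ L) C))) ⟩
    ∑ C₁ μ + 0
      ≡⟨ +-identityʳ _ ⟩
    ∑ C₁ μ
      ≤⟨ +-cancelˡ-≤ (α * length C₁) _ _ (≤-trans (≤-reflexive (sym total)) bound) ⟩
    H ∎
    where
    open ≤-Reasoning
    μ : Y → ℕ
    μ y = d y ∸ α
    L : Y → Set
    L y = α ≤ d y
    C₁ = select L C
    total : ∑ C₁ d ≡ α * length C₁ + ∑ C₁ μ
    total = trans (∑-cong C₁ (λ y∈ → sym (m+[n∸m]≡n (proj₂ (∈-select⁻ {xs = C} y∈)))))
      (trans (∑-+ C₁ (λ _ → α) μ) (cong (_+ ∑ C₁ μ) (trans (∑-const C₁ α) (*-comm (length C₁) α))))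

  within-excess : ∀ (d : Y → ℕ) α B → ∑ B d ≤ (∑[ y ∈ B ] (d y ∸ α)) + α * length B
  within-excess d α B = ≤-trans (∑-mono B (λ {y} _ → ≤-trans (m≤n+m∸n (d y) α) (≤-reflexive (+-comm α _))))
    (≤-reflexive (trans (∑-+ B (λ y → d y ∸ α) (λ _ → α))
      (cong (∑ B (λ y → d y ∸ α) +_) (trans (∑-const B α) (*-comm (length B) α)))))

  -- No logarithm arises, because the chain consists of fibres of the whole relation: at most τ of
  -- them have more than τ points, and each of these costs at most |A|.
  chain-linear : ∀ τ (R : REL X Y r) {A C} → Unique A → Unique C → Chain (Below R A) C →
                 KFree (suc τ) R A C → E R A C ≤ τ * (length A + length C)
  chain-linear {X = X} τ R {A} {C} uA uC ch free = begin
    E R A C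
      ≡⟨ ∑-partition (Heavy R A (suc τ)) C (deg R A) ⟩
    E R A Cʰ + E R A Cˡ
      ≤⟨ +-mono-≤ (E-trivial R A Cʰ)
           (∑-bounded Cˡ (λ y∈ → ≤-pred (≰⇒> (proj₂ (∈-select⁻ {xs = C} y∈))))) ⟩
    length A * length Cʰ + length Cˡ * τ
      ≤⟨ +-mono-≤ (*-monoʳ-≤ (length A) (≤-pred (heavy-chain (suc τ) R uA uC ch free)))
                  (*-monoˡ-≤ τ (length-select-≤ _ C)) ⟩
    length A * τ + length C * τ
      ≡⟨ *-distribʳ-+ τ (length A) (length C) ⟨
    (length A + length C) * τ
      ≡⟨ *-comm _ τ ⟩
    τ * (length A + length C) ∎
    where
    open ≤-Reasoning
    Cʰ = select (Heavy R A (suc τ)) C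
    Cˡ = select (¬_ ∘ Heavy R A (suc τ)) C

  -- Among the fibres with more than τ points that pass through a fixed x, chains have at most τ
  -- members and antichains at most κ; Mirsky with unit weights leaves at most κ τ of them. One
  -- semi-equation alone thus costs no logarithm.
  lin-semi : ∀ κ τ m (P : REL X Y r) → SemiEquation (suc κ) P → Lin (suc τ) m P (suc κ * τ)
  lin-semi κ τ m P semi {A} {B} uA uB _ free = begin
    E P A B
      ≡⟨ ∑-partition (Heavy P A (suc τ)) B (deg P A) ⟩
    E P A Bʰ + E P A Bˡ
      ≤⟨ +-mono-≤ heavy (∑-bounded Bˡ (λ y∈ → ≤-pred (≰⇒> (proj₂ (∈-select⁻ {xs = B} y∈))))) ⟩
    length A * (κ * τ) + length Bˡ * τ
      ≤⟨ +-monoʳ-≤ _ (*-monoˡ-≤ τ (length-select-≤ _ B)) ⟩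
    length A * (κ * τ) + length B * τ
      ≤⟨ m≤m+n _ (length A * τ + length B * (κ * τ)) ⟩
    length A * (κ * τ) + length B * τ + (length A * τ + length B * (κ * τ))
      ≡⟨ arith κ τ (length A) (length B) ⟩
    suc κ * τ * (length A + length B) ∎
    where
    open ≤-Reasoning
    Bʰ = select (Heavy P A (suc τ)) B
    Bˡ = select (¬_ ∘ Heavy P A (suc τ)) B
    arith : ∀ κ τ m n → m * (κ * τ) + n * τ + (m * τ + n * (κ * τ)) ≡ suc κ * τ * (m + n)
    arith = solve-∀
    through : ∀ x → (∑[ y ∈ Bʰ ] ⟨ P x y ⟩) ≤ κ * τ
    through x with mirsky-fibres P A (λ _ → 1) (select (P x) Bʰ) {τ} (select-unique (select-unique uB))
      (λ C uC C⊆ ch → ≤-pred (≤-trans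
        (s≤s (≤-reflexive (trans (sym (length≡∑1 C))
          (cong length (sym (select-all C (λ y∈ → proj₂ (∈-select⁻ {xs = B} (select-⊆ {xs = Bʰ} (C⊆ y∈))))))))))
        (heavy-chain (suc τ) P uA uC ch (KFree-mono id (λ y∈ → select-⊆ {xs = B} (select-⊆ {xs = Bʰ} (C⊆ y∈))) (λ _ _ → id) free))))
    ... | S , S⊆ , anti , le = ≤-trans (≤-reflexive (sym (length-select (P x) Bʰ)))
      (≤-trans (≤-reflexive (length≡∑1 (select (P x) Bʰ))) (≤-trans le (*-monoˡ-≤ τ
        (≤-pred (antichain-length (suc κ) P A S semi anti (λ y∈ → proj₂ (∈-select⁻ {xs = Bʰ} (S⊆ y∈))))))))
    heavy : E P A Bʰ ≤ length A * (κ * τ)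
    heavy = ≤-trans (≤-reflexive (∑-swap Bʰ A (λ y x → ⟨ P x y ⟩))) (∑-bounded A (λ {x} _ → through x))

  -- The fibres of P are grouped by dyadic size, so that in each group an antichain of
  -- fibres has at most κ |A| / 2 ^ j members while a chain covers at most 2 ^ suc j points.
  lin-∧ : ∀ {q} κ {t m α s} (P : REL X Y r) (Q : REL X Y q) → SemiEquation (suc κ) P → m < 2 ^ suc s →
          Lin t m Q α → Lin t m (P ∧ Q) (suc (suc s) * α * (2 * κ * suc s + 1))
  lin-∧ {X = X} {Y = Y} κ {t} {m} {α} {s} P Q semi m<2^ lin {A} {B} uA uB A≤m free = begin
    E (P ∧ Q) A B
      ≤⟨ within-excess d α′ B ⟩
    ∑ B μ + α′ * length B
      ≤⟨ +-monoˡ-≤ (α′ * length B) (≤-trans spread (∑-bounded (upTo (suc s)) (λ {j} _ → level-bound j))) ⟩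
    length (upTo (suc s)) * (2 * α′ * (κ * length A)) + α′ * length B
      ≡⟨ cong (λ n → n * (2 * α′ * (κ * length A)) + α′ * length B) (length-upTo (suc s)) ⟩
    suc s * (2 * α′ * (κ * length A)) + α′ * length B
      ≤⟨ m≤m+n _ (α′ * length A + 2 * κ * suc s * α′ * length B) ⟩
    suc s * (2 * α′ * (κ * length A)) + α′ * length B + (α′ * length A + 2 * κ * suc s * α′ * length B)
      ≡⟨ arith κ (suc s) α′ (length A) (length B) ⟩
    α′ * (2 * κ * suc s + 1) * (length A + length B) ∎
    where
    open ≤-Reasoning
    α′ = suc (suc s) * α
    d : Y → ℕ
    d = deg (P ∧ Q) A
    μ : Y → ℕ
    μ y = d y ∸ α′
    arith : ∀ κ s α m n → s * (2 * α * (κ * m)) + α * n + (α * m + 2 * κ * s * α * n)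
                          ≡ α * (2 * κ * s + 1) * (m + n)
    arith = solve-∀
    OfSize : ℕ → Y → Set
    OfSize j y = 2 ^ j ≤ deg P A y × deg P A y < 2 ^ suc j
    deg≤m : ∀ y → deg P A y ≤ m
    deg≤m y = ≤-trans (≤-reflexive (sym (length-select (λ x → P x y) A))) (≤-trans (length-select-≤ _ A) A≤m)
    -- The size classes begin at 1. A vertex with empty fibre in `P` has degree 0 in `P ∧ Q`, hence
    -- no excess, and belongs to no class.
    spread-at : ∀ y → μ y ≤ (∑[ j ∈ upTo (suc s) ] (⟨ OfSize j y ⟩ * μ y))
    spread-at y with deg P A y in eq
    ... | zero = ≤-trans (m∸n≤m (d y) α′) (≤-trans
          (∑-mono A (λ _ → ⟨⟩-mono proj₁)) (≤-trans (≤-reflexive eq) z≤n))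
    ... | suc d′ with dyadic s (≤-trans (s≤s z≤n) (≤-reflexive (sym eq))) (≤-trans (s≤s (deg≤m y)) m<2^)
    ... | j , j< , of = ≤-trans
          (≤-reflexive (trans (sym (*-identityˡ (μ y))) (cong (_* μ y) (sym (⟨⟩≡1 (subst (λ e → 2 ^ j ≤ e × e < 2 ^ suc j) eq of))))))
          (∑-member (upTo (suc s)) (λ j → ⟨ 2 ^ j ≤ suc d′ × suc d′ < 2 ^ suc j ⟩ * μ y) (∈-upTo⁺ j<))
    spread : ∑ B μ ≤ (∑[ j ∈ upTo (suc s) ] ∑ (select (OfSize j) B) μ)
    spread = ≤-trans (∑-mono B (λ {y} _ → spread-at y)) (≤-reflexive
      (trans (∑-swap B (upTo (suc s)) (λ y j → ⟨ OfSize j y ⟩ * μ y))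
             (∑-cong (upTo (suc s)) (λ {j} _ → sym (∑-select (OfSize j) B μ)))))
    -- All edges over the chain lie in its largest fibre U, so the chain bound is charged to |U|
    -- instead of |A|.
    chain-sum : ∀ j C → Unique C → C ⊆ select (OfSize j) B → Chain (Below P A) C → E (P ∧ Q) A C ≤ α′ * length C + α′ * 2 ^ suc j
    chain-sum j []      uC C⊆ ch = z≤n
    chain-sum j (y ∷ C) uC C⊆ ch
      with chain-minimum {_⊑_ = flip (Below P A)} (λ {y} → Below-refl P A {y}) (λ {x} {y} {z} f g → Below-trans P A {z} {y} {x} g f) y C
             (λ y∈ z∈ → ch z∈ y∈)
    ... | top , top∈ , ⊑top = begin
      E (P ∧ Q) A (y ∷ C)
        ≤⟨ ∑-mono (y ∷ C) (λ {z} z∈ → ≤-trans (∑-mono A (λ {x} x∈ → ≤-trans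
             (⟨⟩-bound (λ (Pxz , Qxz) → ≤-reflexive (sym (cong₂ _*_ (⟨⟩≡1 (⊑top z∈ x∈ Pxz)) (⟨⟩≡1 (Pxz , Qxz))))))
             ≤-refl)) (≤-reflexive (sym (∑-select (λ x → P x top) A (λ x → ⟨ (P ∧ Q) x z ⟩))))) ⟩
      E (P ∧ Q) U (y ∷ C)
        ≤⟨ chain-bound {α = α} lin P (suc s) (<⇒≤ (≤-trans (s≤s U≤m) m<2^)) U≤m (select-unique uA) uC
             (λ {y} {z} → Chain-within P (select-⊆ {xs = A}) ch {y} {z})
             (KFree-mono (select-⊆ {xs = A}) (λ y∈ → select-⊆ {xs = B} (C⊆ y∈)) (λ _ _ → id) free) ⟩
      α′ * (length U + length (y ∷ C))
        ≤⟨ *-monoʳ-≤ α′ (+-monoˡ-≤ _ (≤-trans (≤-reflexive (length-select (λ x → P x top) A))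
             (<⇒≤ (proj₂ (proj₂ (∈-select⁻ {xs = B} (C⊆ top∈))))))) ⟩
      α′ * (2 ^ suc j + length (y ∷ C))
        ≡⟨ trans (*-distribˡ-+ α′ (2 ^ suc j) _) (+-comm (α′ * 2 ^ suc j) _) ⟩
      α′ * length (y ∷ C) + α′ * 2 ^ suc j ∎
      where
      U = select (λ x → P x top) A
      U≤m : length U ≤ m
      U≤m = ≤-trans (length-select-≤ _ A) A≤m
    antichain-count : ∀ j S → S ⊆ select (OfSize j) B → Antichain (Below P A) S → length S * 2 ^ j ≤ κ * length A
    antichain-count j S S⊆ anti = begin
      length S * 2 ^ j
        ≡⟨ ∑-const S (2 ^ j) ⟨
      (∑[ _ ∈ S ] (2 ^ j))
        ≤⟨ ∑-mono S (λ y∈ → proj₁ (proj₂ (∈-select⁻ {xs = B} (S⊆ y∈)))) ⟩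
      (∑[ y ∈ S ] ∑[ x ∈ A ] ⟨ P x y ⟩)
        ≡⟨ ∑-swap S A (λ y x → ⟨ P x y ⟩) ⟩
      (∑[ x ∈ A ] ∑[ y ∈ S ] ⟨ P x y ⟩)
        ≤⟨ ∑-bounded A (λ {x} _ → ≤-trans (≤-reflexive (sym (length-select (P x) S)))
             (≤-pred (antichain-length (suc κ) P A (select (P x) S) semi (AllPairsₚ.filter⁺ _ anti)
               (λ y∈ → proj₂ (∈-select⁻ {xs = S} y∈))))) ⟩
      length A * κ
        ≡⟨ *-comm (length A) κ ⟩
      κ * length A ∎
    -- The chain bound grows with 2 ^ j while the antichain bound shrinks with it. The powers
    -- cancel, and every size class contributes the same amount.
    level-bound : ∀ j → ∑ (select (OfSize j) B) μ ≤ 2 * α′ * (κ * length A)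
    level-bound j with mirsky-fibres P A μ (select (OfSize j) B) {α′ * 2 ^ suc j} (select-unique uB)
      (λ C uC C⊆ ch → excess d α′ C (chain-sum j (select (λ y → α′ ≤ d y) C) (select-unique uC)
        (λ y∈ → C⊆ (select-⊆ {xs = C} y∈)) (Chain-⊆ {_⊑_ = Below P A} (select-⊆ {xs = C}) ch)))
    ... | S , S⊆ , anti , le = ≤-trans le (≤-trans (≤-reflexive (rearrange (length S) α′ (2 ^ j)))
      (*-monoʳ-≤ (2 * α′) (antichain-count j S S⊆ anti)))
      where
      rearrange : ∀ l α n → l * (α * (2 * n)) ≡ 2 * α * (l * n)
      rearrange = solve-∀

  -- Conjunctions of negations

  Neither : ∀ {D} → (Fin D → REL X Y r) → REL X Y r
  Neither N x y = ∀ i → ¬ N i x y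

  ¬∀⇒∃ : ∀ {D} {P : Fin D → Set p} → ¬ (∀ i → ¬ P i) → ∃ P
  ¬∀⇒∃ {P = P} ¬∀ = by-cases (∃ P) id (λ ¬∃ → contradiction (λ i Pi → ¬∃ (i , Pi)) ¬∀)

  -- The excess degrees μ y = deg y ∸ α weigh at most H = α |A| on every chain of every
  -- N i, so each point lies in fibres of N of total weight at most D κ H.  On the other
  -- hand, fewer than t vertices y can have a union of fibres ⋃ᵢ (N i)_y that misses
  -- so much of A that t of these unions always leave t points uncovered.
  module _ {δ κ τ : ℕ} (N : Fin (suc δ) → REL X Y r) (semi : ∀ i → SemiEquation (suc κ) (N i))
           {A : List X} {B : List Y} (uA : Unique A) (uB : Unique B) (free : KFree (suc τ) (Neither N) A B) (α : ℕ)
           (chains : ∀ i C → Unique C → C ⊆ B → Chain (Below (N i) A) C →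
                     E (Neither N) A C ≤ α * (length A + length C)) where
    private
      D = suc δ
      k = suc κ
      t = suc τ
      m = length A
      H = α * m
      G = Neither N
      d : Y → ℕ
      d = deg G A
      μ : Y → ℕ
      μ y = d y ∸ α
      c : Y → ℕ
      c y = ∑[ x ∈ A ] ⟨ ¬ G x y ⟩
      -- A form of c y ≤ (m - t) / t without division: t such vertices together miss at most m - t
      -- points.
      Good : Y → Set
      Good y = c y * t + t ≤ m

      light-chains : ∀ i C → Unique C → C ⊆ B → Chain (Below (N i) A) C → ∑ C μ ≤ H
      light-chains i C uC C⊆ ch = excess d α C (≤-trans
        (chains i C₁ (select-unique uC) (λ y∈ → C⊆ (select-⊆ {xs = C} y∈))
          (Chain-⊆ {_⊑_ = Below (N i) A} (select-⊆ {xs = C}) ch))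
        (≤-reflexive (trans (*-distribˡ-+ α m (length C₁)) (+-comm H _))))
        where C₁ = select (λ y → α ≤ d y) C

      -- A single vertex is a chain for any member of the family, which is nonempty.
      light : ∀ {y} → y ∈ B → μ y ≤ H
      light {y} y∈ = ≤-trans (m≤m+n (μ y) 0) (light-chains Fin.zero (y ∷ []) ([] ∷ []) (λ { (here refl) → y∈ })
        (λ { (here refl) (here refl) → inj₁ (λ {x} → Below-refl (N Fin.zero) A {y} {x}) }))

      covered : (∑[ y ∈ B ] (c y * μ y)) ≤ m * (D * (κ * H))
      covered = begin
        (∑[ y ∈ B ] (c y * μ y))
          ≡⟨ ∑-cong B (λ {y} _ → sym (∑-*ʳ A (λ x → ⟨ ¬ G x y ⟩) (μ y))) ⟩
        (∑[ y ∈ B ] ∑[ x ∈ A ] (⟨ ¬ G x y ⟩ * μ y))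
          ≡⟨ ∑-swap B A (λ y x → ⟨ ¬ G x y ⟩ * μ y) ⟩
        (∑[ x ∈ A ] ∑[ y ∈ B ] (⟨ ¬ G x y ⟩ * μ y))
          ≤⟨ ∑-bounded A (λ {x} _ → at x) ⟩
        m * (D * (κ * H)) ∎
        where
        open ≤-Reasoning
        through : ∀ x i → (∑[ y ∈ B ] (⟨ N i x y ⟩ * μ y)) ≤ κ * H
        through x i with mirsky-fibres (N i) A μ (select (N i x) B) {H} (select-unique uB)
                           (λ C uC C⊆ → light-chains i C uC (λ y∈ → select-⊆ {xs = B} (C⊆ y∈)))
        ... | S , S⊆ , anti , le = ≤-trans (≤-reflexive (sym (∑-select (N i x) B μ))) (≤-trans le
          (*-monoˡ-≤ H (≤-pred (antichain-length k (N i) A S (semi i) anti (λ y∈ → proj₂ (∈-select⁻ {xs = B} (S⊆ y∈)))))))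
        at : ∀ x → (∑[ y ∈ B ] (⟨ ¬ G x y ⟩ * μ y)) ≤ D * (κ * H)
        at x = begin
          (∑[ y ∈ B ] (⟨ ¬ G x y ⟩ * μ y))
            ≤⟨ ∑-mono B (λ {y} _ → *-monoˡ-≤ (μ y) (⟨⟩-bound (λ ¬Gxy → let (i , Nixy) = ¬∀⇒∃ ¬Gxy in
                 ≤-trans (≤-reflexive (sym (⟨⟩≡1 Nixy))) (∑-member (allFin D) (λ i → ⟨ N i x y ⟩) (∈-allFin i))))) ⟩
          (∑[ y ∈ B ] ((∑[ i ∈ allFin D ] ⟨ N i x y ⟩) * μ y))
            ≡⟨ ∑-cong B (λ {y} _ → sym (∑-*ʳ (allFin D) (λ i → ⟨ N i x y ⟩) (μ y))) ⟩
          (∑[ y ∈ B ] ∑[ i ∈ allFin D ] (⟨ N i x y ⟩ * μ y))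
            ≡⟨ ∑-swap B (allFin D) (λ y i → ⟨ N i x y ⟩ * μ y) ⟩
          (∑[ i ∈ allFin D ] ∑[ y ∈ B ] (⟨ N i x y ⟩ * μ y))
            ≤⟨ ∑-bounded (allFin D) (λ {i} _ → through x i) ⟩
          length (allFin D) * (κ * H)
            ≡⟨ cong (_* (κ * H)) (length-tabulate {n = D} id) ⟩
          D * (κ * H) ∎

      few-good : length (select Good B) ≤ τ
      few-good with t ≤? length (select Good B)
      ... | no t≰ = ≤-pred (≰⇒> t≰)
      ... | yes t≤ = ⊥-elim (biclique (select-unique {P = Common} uA) common-large (select-⊆ {xs = A})
          (Unique-take t (select-unique uB)) (≤-reflexive (sym lengthB′)) (λ y∈ → select-⊆ {xs = B} (take-⊆ˢ t (select Good B) y∈))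
          (λ x∈ y∈ → proj₂ (∈-select⁻ {xs = A} x∈) y∈) free)
        where
        B′ = take t (select Good B)
        lengthB′ : length B′ ≡ t
        lengthB′ = length-take-≤ t (select Good B) t≤
        Common : X → Set _
        Common x = ∀ {y} → y ∈ B′ → G x y
        missing : (∑[ x ∈ A ] ⟨ ¬ Common x ⟩) ≤ ∑ B′ c
        missing = ≤-trans (∑-mono A (λ {x} _ → ⟨⟩-bound (λ ¬common → by-cases (∃[ y ] y ∈ B′ × ¬ G x y)
            (λ (y , y∈ , ¬Gxy) → ≤-trans (≤-reflexive (sym (⟨⟩≡1 ¬Gxy))) (∑-member B′ (λ y → ⟨ ¬ G x y ⟩) y∈))
            (λ ¬∃ → contradiction (λ {y} y∈ → by-cases (G x y) id (λ ¬Gxy → contradiction (y , y∈ , ¬Gxy) ¬∃)) ¬common))))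
          (≤-reflexive (∑-swap A B′ (λ x y → ⟨ ¬ G x y ⟩)))
        sum-c : ∑ B′ c + t ≤ m
        sum-c = *-cancelʳ-≤ _ _ t (begin
          (∑ B′ c + t) * t             ≡⟨ *-distribʳ-+ t (∑ B′ c) t ⟩
          ∑ B′ c * t + t * t           ≡⟨ cong₂ _+_ (∑-*ʳ B′ c t) (trans (∑-const B′ t) (cong (_* t) lengthB′)) ⟨
          (∑[ y ∈ B′ ] (c y * t)) + (∑[ _ ∈ B′ ] t) ≡⟨ ∑-+ B′ _ _ ⟨
          (∑[ y ∈ B′ ] (c y * t + t))  ≤⟨ ∑-bounded B′ (λ y∈ → proj₂ (∈-select⁻ {xs = B} (take-⊆ˢ t (select Good B) y∈))) ⟩
          length B′ * m                ≡⟨ cong (_* m) lengthB′ ⟩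
          t * m                        ≡⟨ *-comm t m ⟩
          m * t ∎)
          where open ≤-Reasoning
        common-large : t ≤ length (select Common A)
        common-large = +-cancelˡ-≤ (∑ B′ c) _ _ (≤-trans sum-c (≤-trans
          (≤-reflexive (trans (length-partition Common A) (+-comm (length (select Common A)) _)))
          (+-monoˡ-≤ _ (≤-trans (≤-reflexive (length-select (¬_ ∘ Common) A)) missing))))

      -- At most τ good vertices carry H each. A bad vertex misses more than (m - t) / t points, so
      -- `covered` bounds the bad excess by t D κ H m / (m - t); the size of m makes this at most t
      -- D κ H + H. The estimate `bad` is multiplied through by M = m - t.
      total : t * t * k * D < m → ∑ B μ ≤ t * D * k * H
      total large = begin
        ∑ B μ
          ≡⟨ ∑-partition Good B μ ⟩
        ∑ (select Good B) μ + ∑ Bad μ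
          ≤⟨ +-mono-≤ (≤-trans (∑-bounded (select Good B) (λ y∈ → light (select-⊆ {xs = B} y∈))) (*-monoˡ-≤ H few-good)) bad ⟩
        τ * H + (t * D * κ * H + H)
          -- The terms τ H + H = t H are enlarged to t D H, so that the sum becomes a product with k
          -- = κ + 1.
          ≤⟨ m≤m+n _ (t * δ * H) ⟩
        τ * H + (t * D * κ * H + H) + t * δ * H
          ≡⟨ arith τ δ κ H ⟩
        t * D * k * H ∎
        where
        open ≤-Reasoning
        arith : ∀ τ δ κ H → τ * H + (suc τ * suc δ * κ * H + H) + suc τ * δ * H ≡ suc τ * suc δ * suc κ * H
        arith = solve-∀
        Bad = select (¬_ ∘ Good) B
        M = m ∸ t
        t≤ttkD : t ≤ t * t * k * D
        t≤ttkD = ≤-trans (m≤m+n t _) (≤-reflexive (spread τ κ δ))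
          where
          spread : ∀ τ κ δ → suc τ + (suc τ * τ + suc τ * suc τ * (κ + δ + κ * δ)) ≡ suc τ * suc τ * suc κ * suc δ
          spread = solve-∀
        t≤m : t ≤ m
        t≤m = ≤-trans t≤ttkD (<⇒≤ large)
        M+t : M + t ≡ m
        M+t = m∸n+n≡m t≤m
        M-large : t * t * D * κ ≤ M
        M-large = +-cancelʳ-≤ t _ _ (≤-trans (≤-trans (m≤m+n _ (t * τ + t * t * δ)) (≤-reflexive (spread τ κ δ)))
          (≤-trans (<⇒≤ large) (≤-reflexive (sym M+t))))
          where
          spread : ∀ τ κ δ → suc τ * suc τ * suc δ * κ + suc τ + (suc τ * τ + suc τ * suc τ * δ) ≡ suc τ * suc τ * suc κ * suc δ
          spread = solve-∀
        M>0 : 0 < M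
        M>0 = m<n⇒0<n∸m (≤-trans (s≤s t≤ttkD) large)
        instance
          M≢0 : NonZero M
          M≢0 = >-nonZero M>0
        bad : ∑ Bad μ ≤ t * D * κ * H + H
        bad = *-cancelʳ-≤ _ _ M (begin
          ∑ Bad μ * M
            ≡⟨ ∑-*ʳ Bad μ M ⟨
          (∑[ y ∈ Bad ] (μ y * M))
            ≤⟨ ∑-mono Bad (λ {y} y∈ → *-monoʳ-≤ (μ y) (+-cancelʳ-≤ t _ _ (≤-trans (≤-reflexive M+t) (<⇒≤ (≰⇒> (proj₂ (∈-select⁻ {xs = B} y∈))))))) ⟩
          (∑[ y ∈ Bad ] (μ y * (c y * t)))
            ≤⟨ ≤-trans (m≤n+m _ (∑ (select Good B) (λ y → μ y * (c y * t)))) (≤-reflexive (sym (∑-partition Good B _))) ⟩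
          (∑[ y ∈ B ] (μ y * (c y * t)))
            ≡⟨ ∑-cong B (λ {y} _ → assoc (μ y) (c y) t) ⟩
          (∑[ y ∈ B ] (c y * μ y * t))
            ≡⟨ ∑-*ʳ B (λ y → c y * μ y) t ⟩
          (∑[ y ∈ B ] (c y * μ y)) * t
            ≤⟨ *-monoˡ-≤ t covered ⟩
          m * (D * (κ * H)) * t
            ≡⟨ cong (λ m → m * (D * (κ * H)) * t) M+t ⟨
          (M + t) * (D * (κ * H)) * t
            ≡⟨ expand M t D κ H ⟩
          t * D * κ * H * M + t * t * D * κ * H
            -- The remainder caused by m = M + t is absorbed by one H, because M is at least t t D
            -- κ.
            ≤⟨ +-monoʳ-≤ (t * D * κ * H * M) (*-monoˡ-≤ H M-large) ⟩
          t * D * κ * H * M + M * H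
            ≡⟨ collect (t * D * κ * H) M H ⟩
          (t * D * κ * H + H) * M ∎)
          where
          assoc : ∀ a b c → a * (b * c) ≡ b * a * c
          assoc = solve-∀
          expand : ∀ M t D κ H → (M + t) * (D * (κ * H)) * t ≡ t * D * κ * H * M + t * t * D * κ * H
          expand = solve-∀
          collect : ∀ a M H → a * M + M * H ≡ (a + H) * M
          collect = solve-∀

    -- Two regimes: for m at most t t k D the trivial count |A| |B| is already linear in |B|, and
    -- beyond that the excess estimate applies. The two hypotheses on β serve one regime each.
    negations-bound : ∀ β → t * t * k * D ≤ β → α * (t * D * k) ≤ β → E G A B ≤ β * (m + length B)
    negations-bound β small≤β large≤β with m ≤? t * t * k * D
    ... | yes small = begin
      E G A B             ≤⟨ E-trivial G A B ⟩
      m * length B        ≤⟨ *-mono-≤ (≤-trans small small≤β) (m≤n+m _ m) ⟩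
      β * (m + length B)  ∎
      where open ≤-Reasoning
    ... | no large = begin
      E G A B
        ≤⟨ within-excess d α B ⟩
      ∑ B μ + α * length B
        ≤⟨ +-mono-≤ (total (≰⇒> large)) (*-monoˡ-≤ (length B) (≤-trans (m≤m*n α (t * D * k)) large≤β)) ⟩
      t * D * k * (α * m) + β * length B
        ≡⟨ cong (_+ β * length B) (assoc (t * D * k) α m) ⟩
      α * (t * D * k) * m + β * length B
        ≤⟨ +-monoˡ-≤ (β * length B) (*-monoˡ-≤ m large≤β) ⟩
      β * m + β * length B
        ≡⟨ *-distribˡ-+ β m (length B) ⟨
      β * (m + length B) ∎
      where
      open ≤-Reasoning
      assoc : ∀ a b c → a * (b * c) ≡ b * a * c
      assoc = solve-∀

  -- Conjunctions

  n<2^n : ∀ n → n < 2 ^ n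
  n<2^n zero    = s≤s z≤n
  n<2^n (suc n) = ≤-trans (+-mono-≤ (m^n>0 2 n) (n<2^n n)) (≤-reflexive (cong (2 ^ n +_) (sym (+-identityʳ (2 ^ n)))))

  log₂-floor : ∀ n → 2 ≤ n → ∃[ q ] 1 ≤ q × 2 ^ q ≤ n × n < 2 ^ suc q
  log₂-floor n 2≤n with dyadic n {n} (≤-trans (s≤s z≤n) 2≤n) (≤-trans (n<2^n n) (^-monoʳ-≤ 2 (n≤1+n n)))
  ... | zero  , _ , _  , n<2 = contradiction 2≤n (<⇒≱ n<2)
  ... | suc q , _ , le , gt  = suc q , s≤s z≤n , le , gt

  -- The parameter q plays the role of the binary logarithm of m + 1. A positive conjunct
  -- contributes 2 k⁴ q², and raising the number of negations to D contributes 4 q t D k; replacing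
  -- q by 2 log (m + 1) gives 8 k⁴ log² (m + 1) and 8 t D k log (m + 1).
  negCoeff posCoeff : (k d t q : ℕ) → ℕ
  negCoeff k δ t q = 4 ^ δ * k ^ suc δ * suc δ ! * t ^ suc (suc δ) * q ^ δ
  posCoeff k d t q = (2 * k ^ 4 * q ^ 2) ^ d

  coeff : (k d d′ t q : ℕ) → ℕ
  coeff k d       (suc δ)  t q = posCoeff k d t q * negCoeff k δ t q
  coeff k zero    zero     t q = t ∸ 1
  coeff k (suc d) zero     t q = posCoeff k d t q * (k * (t ∸ 1))

  -- Induction on the number of negations. On a chain of fibres of `N i` the complements form the
  -- reversed chain, so `chain-bound` strips this negation at the cost of a factor q + 2 and leaves
  -- the others to the induction hypothesis; `negations-bound` then passes from chains to B.
  lin-neither : ∀ {κ τ m q} → 1 ≤ q → m < 2 ^ suc q → ∀ δ (N : Fin (suc δ) → REL X Y r) →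
                (∀ i → SemiEquation (suc κ) (N i)) → Lin (suc τ) m (Neither N) (negCoeff (suc κ) δ (suc τ) q)
  lin-neither {κ = κ} {τ} {m} {q} 1≤q m<2^ zero N semi {A} {B} uA uB A≤m free =
    negations-bound N semi uA uB free τ
      -- With one negation the complements are the fibres of the whole relation, so `chain-linear`
      -- applies and the induction starts without a logarithm.
      (λ { Fin.zero C uC C⊆ ch → chain-linear τ (Neither N) uA uC (reverse ch) (KFree-mono id C⊆ (λ _ _ → id) free) })
      _ (≤-reflexive (c₁ (suc κ) (suc τ))) (≤-trans (m≤m+n _ _) (≤-reflexive (c₂ κ τ)))
    where
    reverse : ∀ {C} → Chain (Below (N Fin.zero) A) C → Chain (Below (Neither N) A) C
    reverse ch y∈ z∈ with ch y∈ z∈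
    ... | inj₁ y⊑z = inj₂ (λ { x∈ ¬N Fin.zero Nxy → ¬N Fin.zero (y⊑z x∈ Nxy) })
    ... | inj₂ z⊑y = inj₁ (λ { x∈ ¬N Fin.zero Nxy → ¬N Fin.zero (z⊑y x∈ Nxy) })
    c₁ : ∀ k t → t * t * k * 1 ≡ 1 * (k * 1) * 1 * (t * (t * 1)) * 1
    c₁ = solve-∀
    c₂ : ∀ κ τ → τ * (suc τ * 1 * suc κ) + suc τ * suc κ ≡ 1 * (suc κ * 1) * 1 * (suc τ * (suc τ * 1)) * 1
    c₂ = solve-∀
  lin-neither {X = X} {Y = Y} {κ = κ} {τ} {m} {q} 1≤q m<2^ (suc δ) N semi {A} {B} uA uB A≤m free =
    negations-bound N semi uA uB free (suc (suc q) * c) chains _ small large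
    where
    open ≤-Reasoning
    k = suc κ
    t = suc τ
    D = suc (suc δ)
    c = negCoeff k δ t q
    rest : Fin D → Fin (suc δ) → REL X Y _
    rest i j = N (punchIn i j)
    split : ∀ i {x y} → Neither N x y → ((λ x y → ¬ N i x y) ∧ Neither (rest i)) x y
    split i ¬N = ¬N i , λ j → ¬N (punchIn i j)
    join : ∀ i {x y} → ((λ x y → ¬ N i x y) ∧ Neither (rest i)) x y → Neither N x y
    join i (¬Ni , ¬rest) j with i Finₚ.≟ j
    ... | yes refl = ¬Ni
    ... | no i≢j   = subst (λ j → ¬ N j _ _) (punchIn-punchOut i≢j) (¬rest (punchOut i≢j))
    reverse : ∀ i {C} → Chain (Below (N i) A) C → Chain (Below (λ x y → ¬ N i x y) A) C
    reverse i ch y∈ z∈ with ch y∈ z∈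
    ... | inj₁ y⊑z = inj₂ (λ x∈ ¬Nxz Nxy → ¬Nxz (y⊑z x∈ Nxy))
    ... | inj₂ z⊑y = inj₁ (λ x∈ ¬Nxz Nxy → ¬Nxz (z⊑y x∈ Nxy))
    chains : ∀ i C → Unique C → C ⊆ B → Chain (Below (N i) A) C →
             E (Neither N) A C ≤ suc (suc q) * c * (length A + length C)
    chains i C uC C⊆ ch = ≤-trans (E-mono (Neither N) _ A C (λ _ _ → split i))
      (chain-bound {α = c} (lin-neither 1≤q m<2^ δ (rest i) (λ j → semi (punchIn i j)))
        (λ x y → ¬ N i x y) (suc q) (≤-trans A≤m (<⇒≤ m<2^)) A≤m uA uC (reverse i ch)
        (KFree-mono id C⊆ (λ _ _ → join i) free))
    instance
      q≢0 : NonZero q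
      q≢0 = >-nonZero 1≤q
    t≤ : ∀ n → t ≤ t ^ suc n
    t≤ n = m≤m*n t (t ^ n) {{m^n≢0 t n}}
    small : t * t * k * D ≤ negCoeff k (suc δ) t q
    small = begin
      t * t * k * D
        ≡⟨ rearrange t k D ⟩
      1 * k * D * (t * t) * 1
        ≤⟨ *-mono-≤ (*-mono-≤ (*-mono-≤ (*-mono-≤ (m^n>0 4 (suc δ)) (m≤m*n k (k ^ suc δ) {{m^n≢0 k (suc δ)}}))
             (m≤m*n D (suc δ !) {{suc δ !≢0}})) (*-monoʳ-≤ t (t≤ (suc δ)))) (m^n>0 q (suc δ)) ⟩
      negCoeff k (suc δ) t q ∎
      where
      rearrange : ∀ t k D → t * t * k * D ≡ 1 * k * D * (t * t) * 1
      rearrange = solve-∀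
    large : suc (suc q) * c * (t * D * k) ≤ negCoeff k (suc δ) t q
    large = begin
      suc (suc q) * c * (t * D * k)
        -- As q is at least 1, q + 2 is at most 4 q.
        ≤⟨ *-monoˡ-≤ (t * D * k) (*-monoˡ-≤ c (≤-trans (+-monoˡ-≤ q (≤-trans (+-mono-≤ 1≤q 1≤q) (m≤m+n (q + q) q))) (≤-reflexive (four q)))) ⟩
      4 * q * c * (t * D * k)
        ≡⟨ rearrange (4 ^ δ) (k ^ suc δ) (suc δ !) (t ^ suc (suc δ)) (q ^ δ) t D k q ⟩
      negCoeff k (suc δ) t q ∎
      where
      four : ∀ q → q + q + q + q ≡ 4 * q
      four = solve-∀
      rearrange : ∀ f kk dd tt qq t D k q →
        4 * q * (f * kk * dd * tt * qq) * (t * D * k) ≡ (4 * f) * (k * kk) * (D * dd) * (t * tt) * (q * qq)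
      rearrange = solve-∀

  semi-1-empty : (P : REL X Y r) → SemiEquation 1 P → ∀ {x y} → ¬ P x y
  semi-1-empty P semi {x} {y} Pxy with semi (λ _ → y) (x , λ _ → Pxy)
  ... | Fin.zero , Fin.zero , i≢j , _ = i≢j refl

  lin-positive : ∀ {p q κ t m α} {P : REL X Y p} {Q : REL X Y r} → 1 ≤ q → m < 2 ^ suc q → SemiEquation (suc κ) P →
                 Lin t m Q α → Lin t m (P ∧ Q) (2 * suc κ ^ 4 * q ^ 2 * α)
  -- For k = 1 the relation is empty. The general estimate would give the factor q + 2, which
  -- exceeds 2 q² at q = 1.
  lin-positive {κ = zero} {P = P} {Q} 1≤q m<2^ semi lin {A} {B} uA uB A≤m free =
    ≤-trans (≤-reflexive (E-empty (P ∧ Q) A B (λ _ _ (Pxy , _) → semi-1-empty P semi Pxy))) z≤n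
  lin-positive {q = q} {suc κ} {α = α} {P} {Q} 1≤q m<2^ semi lin {A} {B} uA uB A≤m free =
    ≤-trans (lin-∧ (suc κ) {α = α} {s = q} P Q semi m<2^ lin uA uB A≤m free) (*-monoˡ-≤ (length A + length B) (begin
      suc (suc q) * α * (2 * suc κ * suc q + 1)
        ≤⟨ *-mono-≤ (*-monoˡ-≤ α (+-monoˡ-≤ q (+-mono-≤ 1≤q 1≤q)))
             (+-mono-≤ (*-monoʳ-≤ (2 * suc κ) (+-monoˡ-≤ q 1≤q)) 1≤q) ⟩
      (q + q + q) * α * (2 * suc κ * (q + q) + q)
        -- The added polynomial is the exact difference between 2 (κ + 2)⁴ and 3 (4 (κ + 1) + 1).
        ≤⟨ m≤m+n _ _ ⟩
      (q + q + q) * α * (2 * suc κ * (q + q) + q) + (17 + 52 * κ + 48 * κ * κ + 16 * κ * κ * κ + 2 * κ * κ * κ * κ) * q * q * α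
        ≡⟨ arith q α κ ⟩
      2 * suc (suc κ) ^ 4 * q ^ 2 * α ∎))
    where
    open ≤-Reasoning
    arith : ∀ q α κ → (q + q + q) * α * (2 * suc κ * (q + q) + q) + (17 + 52 * κ + 48 * κ * κ + 16 * κ * κ * κ + 2 * κ * κ * κ * κ) * q * q * α
            ≡ 2 * (suc (suc κ) * (suc (suc κ) * (suc (suc κ) * (suc (suc κ) * 1)))) * (q * (q * 1)) * α
    arith = solve-∀

  -- A × B is itself a biclique, so one side has at most τ elements.
  lin-full : ∀ τ m → Lin {X = X} {Y = Y} (suc τ) m (λ _ _ → Unit.⊤ {r}) τ
  lin-full {r = r} τ m {A} {B} uA uB _ free with suc τ ≤? length A | suc τ ≤? length B
  ... | yes t≤A | yes t≤B = ⊥-elim (biclique uA t≤A id uB t≤B id (λ _ _ → _) free)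
  ... | no t≰A  | _       = ≤-trans (E-trivial _ A B) (*-mono-≤ (≤-pred (≰⇒> t≰A)) (m≤n+m _ (length A)))
  ... | _       | no t≰B  = ≤-trans (E-trivial _ A B) (≤-trans (*-monoʳ-≤ (length A) (≤-pred (≰⇒> t≰B)))
    (≤-trans (≤-reflexive (*-comm (length A) τ)) (*-monoʳ-≤ τ (m≤m+n (length A) _))))

  module _ {κ τ m q : ℕ} (1≤q : 1 ≤ q) (m<2^ : m < 2 ^ suc q) where

    lin-conjunction : ∀ d d′ (P : Fin d → REL X Y r) (N : Fin d′ → REL X Y r) →
      (∀ i → SemiEquation (suc κ) (P i)) → (∀ j → SemiEquation (suc κ) (N j)) →
      Lin (suc τ) m (Conjunction P N) (coeff (suc κ) d d′ (suc τ) q)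
    lin-conjunction zero zero P N semiP semiN =
      Lin-resp {Q = Conjunction P N} {α = τ} (λ _ → (λ ()) , (λ ())) _ (lin-full {r = 0ℓ} τ m)
    -- Without negations the recursion ends at one positive conjunct, where `lin-semi` costs no
    -- logarithm; hence the exponent 2 d - 2 rather than 2 d.
    lin-conjunction (suc zero) zero P N semiP semiN =
      Lin-≤ {R = Conjunction P N} (≤-reflexive (sym (+-identityʳ (suc κ * τ))))
        (Lin-resp {R = P Fin.zero} {α = suc κ * τ} (λ Pxy → (λ { Fin.zero → Pxy }) , λ ()) (λ (Ps , _) → Ps Fin.zero)
          (lin-semi κ τ m (P Fin.zero) (semiP Fin.zero)))
    lin-conjunction zero (suc δ) P N semiP semiN =
      Lin-≤ {R = Conjunction P N} (≤-reflexive (sym (+-identityʳ (negCoeff (suc κ) δ (suc τ) q))))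
        (Lin-resp {R = Neither N} {α = negCoeff (suc κ) δ (suc τ) q} (λ Ns → (λ ()) , Ns) proj₂ (lin-neither 1≤q m<2^ δ N semiN))
    lin-conjunction (suc (suc d)) zero P N semiP semiN =
      Lin-≤ {R = Conjunction P N} (≤-reflexive (sym (*-assoc (2 * suc κ ^ 4 * q ^ 2) (posCoeff (suc κ) d (suc τ) q) _)))
        (Lin-resp {R = P Fin.zero ∧ Conjunction (P ∘ Fin.suc) N} {α = 2 * suc κ ^ 4 * q ^ 2 * coeff (suc κ) (suc d) zero (suc τ) q}
          (λ (P0 , Ps , Ns) → (λ { Fin.zero → P0 ; (Fin.suc i) → Ps i }) , Ns)
          (λ (Ps , Ns) → Ps Fin.zero , Ps ∘ Fin.suc , Ns)
          (lin-positive {α = coeff (suc κ) (suc d) zero (suc τ) q} 1≤q m<2^ (semiP Fin.zero) (lin-conjunction (suc d) zero (P ∘ Fin.suc) N (semiP ∘ Fin.suc) semiN)))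
    lin-conjunction (suc d) (suc δ) P N semiP semiN =
      Lin-≤ {R = Conjunction P N} (≤-reflexive (sym (*-assoc (2 * suc κ ^ 4 * q ^ 2) (posCoeff (suc κ) d (suc τ) q) _)))
        (Lin-resp {R = P Fin.zero ∧ Conjunction (P ∘ Fin.suc) N} {α = 2 * suc κ ^ 4 * q ^ 2 * coeff (suc κ) d (suc δ) (suc τ) q}
          (λ (P0 , Ps , Ns) → (λ { Fin.zero → P0 ; (Fin.suc i) → Ps i }) , Ns)
          (λ (Ps , Ns) → Ps Fin.zero , Ps ∘ Fin.suc , Ns)
          (lin-positive {α = coeff (suc κ) d (suc δ) (suc τ) q} 1≤q m<2^ (semiP Fin.zero) (lin-conjunction d (suc δ) (P ∘ Fin.suc) N (semiP ∘ Fin.suc) semiN)))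

  greatest-≤ : ∀ (P : ℕ → Set p) n {b} → (∀ s → P s → s ≤ b) → greatest P n ≤ b
  greatest-≤ P zero    bound = z≤n
  greatest-≤ P (suc n) bound with em {P = P (suc n)}
  ... | yes Pn = bound (suc n) Pn
  ... | no _   = greatest-≤ P n bound

  zarankiewicz-≤ : ∀ {t m n α} (R : REL X Y r) → Lin t m R α → zarankiewicz R t m n ≤ α * (m + n)
  zarankiewicz-≤ {t = t} {m} {n} R lin = greatest-≤ _ (m * n)
    λ { s (A , B , uA , refl , uB , refl , free , refl) →
          ≤-trans (≤-reflexive (edges≡∑deg R A B)) (lin uA uB ≤-refl free) }

  -- Boolean combinations

  ^-distribʳ-* : ∀ o m n → (m * n) ^ o ≡ m ^ o * n ^ o
  ^-distribʳ-* zero    m n = refl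
  ^-distribʳ-* (suc o) m n = trans (cong (m * n *_) (^-distribʳ-* o m n)) (interchange m n (m ^ o) (n ^ o))
    where
    interchange : ∀ a b c e → a * b * (c * e) ≡ a * c * (b * e)
    interchange = solve-∀

  posConst negConst : (k d t : ℕ) → ℕ
  posConst k d t = (2 * k ^ 4) ^ d * (k * (t ∸ 1))
  negConst k δ t = 4 ^ δ * k ^ suc δ * suc δ ! * t ^ suc (suc δ)

  posCoeff-^ : ∀ k d t q → posCoeff k d t q ≡ (2 * k ^ 4) ^ d * q ^ (2 * d)
  posCoeff-^ k d t q = trans (^-distribʳ-* d (2 * k ^ 4) (q ^ 2)) (cong ((2 * k ^ 4) ^ d *_) (^-*-assoc q 2 d))

  coeff-positive : ∀ k d t q → coeff k (suc d) 0 t q ≡ posConst k d t * q ^ (2 * d)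
  coeff-positive k d t q = trans (cong (_* (k * (t ∸ 1))) (posCoeff-^ k d t q))
    (rearrange ((2 * k ^ 4) ^ d) (q ^ (2 * d)) (k * (t ∸ 1)))
    where
    rearrange : ∀ a b c → a * b * c ≡ a * c * b
    rearrange = solve-∀

  coeff-negative : ∀ k d δ t q → coeff k d (suc δ) t q ≡ (2 * k ^ 4) ^ d * negConst k δ t * q ^ (2 * d + δ)
  coeff-negative k d δ t q = trans (cong (_* negCoeff k δ t q) (posCoeff-^ k d t q))
    (trans (rearrange ((2 * k ^ 4) ^ d) (q ^ (2 * d)) (negConst k δ t) (q ^ δ))
      (cong ((2 * k ^ 4) ^ d * negConst k δ t *_) (sym (^-distribˡ-+-* q (2 * d) δ))))
    where
    rearrange : ∀ a b c e → a * b * (c * e) ≡ a * c * (b * e)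
    rearrange = solve-∀

  coeff-polynomial : ∀ k d d′ t → ∃[ C ] ∃[ e ] ∀ q → coeff k d d′ t q ≡ C * q ^ e
  coeff-polynomial k zero    zero    t = t ∸ 1 , 0 , λ q → sym (*-identityʳ (t ∸ 1))
  coeff-polynomial k (suc d) zero    t = posConst k d t , 2 * d , coeff-positive k d t
  coeff-polynomial k d       (suc δ) t = (2 * k ^ 4) ^ d * negConst k δ t , 2 * d + δ , coeff-negative k d δ t

  -- The factor 2 ^ (2 d) arises when q ^ (2 d) is replaced by (2 log (m + 1)) ^ (2 d).
  eight-powers : ∀ k d → (2 * k ^ 4) ^ d * 2 ^ (2 * d) ≡ 8 ^ d * k ^ (4 * d)
  eight-powers k d = begin
    (2 * k ^ 4) ^ d * 2 ^ (2 * d)  ≡⟨ cong ((2 * k ^ 4) ^ d *_) (^-*-assoc 2 2 d) ⟨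
    (2 * k ^ 4) ^ d * 4 ^ d        ≡⟨ ^-distribʳ-* d (2 * k ^ 4) 4 ⟨
    (2 * k ^ 4 * 4) ^ d            ≡⟨ cong (_^ d) (eight (k ^ 4)) ⟩
    (8 * k ^ 4) ^ d                ≡⟨ ^-distribʳ-* d 8 (k ^ 4) ⟩
    8 ^ d * (k ^ 4) ^ d            ≡⟨ cong (8 ^ d *_) (^-*-assoc k 4 d) ⟩
    8 ^ d * k ^ (4 * d)            ∎
    where
    open ≡-Reasoning
    eight : ∀ a → 2 * a * 4 ≡ 8 * a
    eight = solve-∀

  positive-const : ∀ k d t s → posConst k d t * s * 2 ^ (2 * suc d ∸ 2) ≤
                   8 ^ (suc d ∸ 1) * k ^ (4 * suc d ∸ 3) * (t ∸ 1) ^ 2 * s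
  positive-const k d t s = begin
    posConst k d t * s * 2 ^ (2 * suc d ∸ 2)
      ≡⟨ cong (λ e → posConst k d t * s * 2 ^ e) (exp₁ d) ⟩
    (2 * k ^ 4) ^ d * (k * τ) * s * 2 ^ (2 * d)
      ≡⟨ rearrange ((2 * k ^ 4) ^ d) (2 ^ (2 * d)) k τ s ⟩
    (2 * k ^ 4) ^ d * 2 ^ (2 * d) * k * τ * s
      ≡⟨ cong (λ x → x * k * τ * s) (eight-powers k d) ⟩
    8 ^ d * k ^ (4 * d) * k * τ * s
      ≡⟨ cong (λ x → x * τ * s) (*-assoc (8 ^ d) (k ^ (4 * d)) k) ⟩
    8 ^ d * (k ^ (4 * d) * k) * τ * s
      ≡⟨ cong (λ x → 8 ^ d * x * τ * s) (trans (cong (k ^ (4 * d) *_) (sym (*-identityʳ k))) (sym (^-distribˡ-+-* k (4 * d) 1))) ⟩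
    8 ^ d * k ^ (4 * d + 1) * τ * s
      ≡⟨ cong (λ e → 8 ^ d * k ^ e * τ * s) (exp₂ d) ⟨
    8 ^ d * k ^ (4 * suc d ∸ 3) * τ * s
      -- The only loss in the comparison: t - 1 occurs linearly and is estimated by its square.
      ≤⟨ *-monoˡ-≤ s (*-monoʳ-≤ (8 ^ d * k ^ (4 * suc d ∸ 3)) (square τ)) ⟩
    8 ^ d * k ^ (4 * suc d ∸ 3) * τ ^ 2 * s ∎
    where
    open ≤-Reasoning
    τ = t ∸ 1
    square : ∀ n → n ≤ n ^ 2
    square zero    = z≤n
    square (suc n) = m≤m*n (suc n) (suc n ^ 1)
    exp₁ : ∀ d → 2 * suc d ∸ 2 ≡ 2 * d
    exp₁ d = trans (cong (_∸ 2) (*-suc 2 d)) (m+n∸m≡n 2 (2 * d))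
    exp₂ : ∀ d → 4 * suc d ∸ 3 ≡ 4 * d + 1
    exp₂ d = trans (cong (_∸ 3) (*-suc 4 d)) (+-comm 1 (4 * d))
    rearrange : ∀ a b k τ s → a * (k * τ) * s * b ≡ a * b * k * τ * s
    rearrange = solve-∀

  negative-const : ∀ k d δ t s → (2 * k ^ 4) ^ d * negConst k δ t * s * 2 ^ (2 * d + suc δ ∸ 1) ≡
                   8 ^ (d + suc δ ∸ 1) * k ^ (4 * d + suc δ) * suc δ ! * t ^ (suc δ + 1) * s
  negative-const k d δ t s = begin
    (2 * k ^ 4) ^ d * negConst k δ t * s * 2 ^ (2 * d + suc δ ∸ 1)
      ≡⟨ cong (λ e → (2 * k ^ 4) ^ d * negConst k δ t * s * 2 ^ e) (exp₁ (2 * d)) ⟩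
    (2 * k ^ 4) ^ d * negConst k δ t * s * 2 ^ (2 * d + δ)
      ≡⟨ cong ((2 * k ^ 4) ^ d * negConst k δ t * s *_) (^-distribˡ-+-* 2 (2 * d) δ) ⟩
    (2 * k ^ 4) ^ d * (4 ^ δ * k ^ suc δ * suc δ ! * t ^ suc (suc δ)) * s * (2 ^ (2 * d) * 2 ^ δ)
      ≡⟨ rearrange ((2 * k ^ 4) ^ d) (4 ^ δ) (k ^ suc δ) (suc δ !) (t ^ suc (suc δ)) s (2 ^ (2 * d)) (2 ^ δ) ⟩
    (2 * k ^ 4) ^ d * 2 ^ (2 * d) * (4 ^ δ * 2 ^ δ) * k ^ suc δ * suc δ ! * t ^ suc (suc δ) * s
      ≡⟨ cong₂ (λ x y → x * y * k ^ suc δ * suc δ ! * t ^ suc (suc δ) * s) (eight-powers k d) (sym (^-distribʳ-* δ 4 2)) ⟩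
    8 ^ d * k ^ (4 * d) * 8 ^ δ * k ^ suc δ * suc δ ! * t ^ suc (suc δ) * s
      ≡⟨ cong (λ x → x * suc δ ! * t ^ suc (suc δ) * s) (regroup (8 ^ d) (k ^ (4 * d)) (8 ^ δ) (k ^ suc δ)) ⟩
    8 ^ d * 8 ^ δ * (k ^ (4 * d) * k ^ suc δ) * suc δ ! * t ^ suc (suc δ) * s
      ≡⟨ cong₂ (λ x y → x * y * suc δ ! * t ^ suc (suc δ) * s) (sym (^-distribˡ-+-* 8 d δ)) (sym (^-distribˡ-+-* k (4 * d) (suc δ))) ⟩
    8 ^ (d + δ) * k ^ (4 * d + suc δ) * suc δ ! * t ^ suc (suc δ) * s
      ≡⟨ cong₂ (λ x y → 8 ^ x * k ^ (4 * d + suc δ) * suc δ ! * t ^ y * s) (sym (exp₁ d)) (+-comm 1 (suc δ)) ⟩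
    8 ^ (d + suc δ ∸ 1) * k ^ (4 * d + suc δ) * suc δ ! * t ^ (suc δ + 1) * s ∎
    where
    open ≡-Reasoning
    exp₁ : ∀ n → n + suc δ ∸ 1 ≡ n + δ
    exp₁ n = cong (_∸ 1) (+-suc n δ)
    rearrange : ∀ a b c e f s g h → a * (b * c * e * f) * s * (g * h) ≡ a * g * (b * h) * c * e * f * s
    rearrange = solve-∀
    regroup : ∀ a b c e → a * b * c * e ≡ a * c * (b * e)
    regroup = solve-∀

  -- Induction on e by halving. With M half of N rounded down, suc N is at most 2 suc M; one factor
  -- suc M is bounded by 2 ^ M and the rest by 2 ^ M from the induction hypothesis with constant C 2
  -- ^ suc e.
  exp-beats-poly : ∀ e C → ∃[ N₀ ] ∀ N → N₀ ≤ N → C * suc N ^ e < 2 ^ N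
  exp-beats-poly zero C = C , λ N C≤N → ≤-trans (s≤s (≤-reflexive (*-identityʳ C)))
    (≤-trans (n<2^n C) (^-monoʳ-≤ 2 C≤N))
  exp-beats-poly (suc e) C with exp-beats-poly e (C * 2 ^ suc e)
  ... | N₀ , beats = N₀ + N₀ , λ N N₀+N₀≤N → let M = ⌊ N /2⌋ in begin-strict
    C * suc N ^ suc e
      ≤⟨ *-monoʳ-≤ C (^-monoˡ-≤ (suc e) (sucN≤ N)) ⟩
    C * (2 * suc M) ^ suc e
      ≡⟨ cong (C *_) (^-distribʳ-* (suc e) 2 (suc M)) ⟩
    C * (2 ^ suc e * suc M ^ suc e)
      ≡⟨ rearrange C (2 ^ suc e) (suc M) (suc M ^ e) ⟩
    C * 2 ^ suc e * suc M ^ e * suc M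
      <⟨ *-monoˡ-< (suc M) (beats M (half N₀+N₀≤N)) ⟩
    2 ^ M * suc M
      ≤⟨ *-monoʳ-≤ (2 ^ M) (n<2^n M) ⟩
    2 ^ M * 2 ^ M
      ≡⟨ ^-distribˡ-+-* 2 M M ⟨
    2 ^ (M + M)
      ≤⟨ ^-monoʳ-≤ 2 (≤-trans (+-monoʳ-≤ M (⌊n/2⌋≤⌈n/2⌉ N)) (≤-reflexive (⌊n/2⌋+⌈n/2⌉≡n N))) ⟩
    2 ^ N ∎
    where
    open ≤-Reasoning
    rearrange : ∀ C a b c → C * (a * (b * c)) ≡ C * a * c * b
    rearrange = solve-∀
    sucN≤ : ∀ N → suc N ≤ 2 * suc ⌊ N /2⌋
    sucN≤ zero          = s≤s z≤n
    sucN≤ (suc zero)    = ≤-refl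
    sucN≤ (suc (suc N)) = ≤-trans (s≤s (s≤s (sucN≤ N))) (≤-reflexive (sym (*-suc 2 (suc ⌊ N /2⌋))))
    half : ∀ {n N} → n + n ≤ N → n ≤ ⌊ N /2⌋
    half {n} le = ≤-trans (≤-reflexive (n≡⌊n+n/2⌋ n)) (⌊n/2⌋-mono le)

  signs : ∀ l → List (Vec Bool l)
  signs zero    = [] ∷ []
  signs (suc l) = map (true ∷_) (signs l) ++ map (false ∷_) (signs l)

  ∈-signs : ∀ {l} (v : Vec Bool l) → v ∈ signs l
  ∈-signs []                        = here refl
  ∈-signs (true  ∷ v) = ∈-++⁺ˡ (∈-map⁺ _ (∈-signs v))
  ∈-signs {suc l} (false ∷ v) = ∈-++⁺ʳ (map _ (signs l)) (∈-map⁺ _ (∈-signs v))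

  ⟦⟧ᵇ-cong : ∀ {l} (e : BoolExpr l) {P Q : Fin l → Set r} → (∀ i → P i ⇔ Q i) → ⟦ e ⟧ᵇ P ⇔ ⟦ e ⟧ᵇ Q
  ⟦⟧ᵇ-cong (var i)   P⇔Q = P⇔Q i
  ⟦⟧ᵇ-cong true      P⇔Q = mk⇔ id id
  ⟦⟧ᵇ-cong (not e)   P⇔Q = ¬-cong-⇔ (⟦⟧ᵇ-cong e P⇔Q)
  ⟦⟧ᵇ-cong (e and f) P⇔Q = ⟦⟧ᵇ-cong e P⇔Q ×-⇔ ⟦⟧ᵇ-cong f P⇔Q
  ⟦⟧ᵇ-cong (e or f)  P⇔Q = ⟦⟧ᵇ-cong e P⇔Q ⊎-⇔ ⟦⟧ᵇ-cong f P⇔Q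

  full empty : REL X Y r
  full  x y = Unit.⊤
  empty x y = Empty.⊥

  semi-suc : ∀ {k} {R : REL X Y r} → SemiEquation k R → SemiEquation (suc k) R
  semi-suc semi y (x , Rxy) with semi (y ∘ Fin.suc) (x , Rxy ∘ Fin.suc)
  ... | i , j , i≢j , nested = Fin.suc i , Fin.suc j , (λ { refl → i≢j refl }) , nested

  semi-full : ∀ k → SemiEquation {X = X} {Y} (suc (suc k)) (full {r = r})
  semi-full k y _ = Fin.zero , Fin.suc Fin.zero , (λ ()) , _

  semi-empty : ∀ k → SemiEquation {X = X} {Y} (suc k) (empty {r = r})
  semi-empty k y (_ , e) = contradiction (e Fin.zero) λ ()

  -- The atom of a sign vector is padded with trivial semi-equations, so that all atoms
  -- have the same numbers of positive and of negative conjuncts.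
  positives negatives : ∀ {l} → (Fin l → REL X Y r) → Vec Bool l → Fin l → REL X Y r
  positives S v i = if Vec.lookup v i then S i else full
  negatives S v i = if Vec.lookup v i then empty else S i

  Atom : ∀ {l} → (Fin l → REL X Y r) → Vec Bool l → REL X Y r
  Atom S v = Conjunction (positives S v) (negatives S v)

  atom-agree : ∀ {l} (S : Fin l → REL X Y r) v {x y x′ y′} → Atom S v x y → Atom S v x′ y′ →
               ∀ i → S i x y ⇔ S i x′ y′
  atom-agree S v (Ps , Ns) (Ps′ , Ns′) i with Vec.lookup v i | Ps i | Ns i | Ps′ i | Ns′ i
  ... | true  | Sxy | _ | Sxy′ | _ = mk⇔ (λ _ → Sxy′) (λ _ → Sxy)
  ... | false | _ | ¬Sxy | _ | ¬Sxy′ = mk⇔ (λ Sxy → contradiction Sxy ¬Sxy) (λ Sxy → contradiction Sxy ¬Sxy′)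

  type : ∀ {l} (S : Fin l → REL X Y r) → X → Y → Vec Bool l
  type S x y = Vec.tabulate (λ i → does (em {P = S i x y}))

  type-atom : ∀ {l} (S : Fin l → REL X Y r) x y → Atom S (type S x y) x y
  type-atom S x y = positive , negative
    where
    positive : ∀ i → positives S (type S x y) i x y
    positive i rewrite Vecₚ.lookup∘tabulate (λ i → does (em {P = S i x y})) i with em {P = S i x y}
    ... | yes Sxy = Sxy
    ... | no _    = _
    negative : ∀ i → ¬ negatives S (type S x y) i x y
    negative i rewrite Vecₚ.lookup∘tabulate (λ i → does (em {P = S i x y})) i with em {P = S i x y}
    ... | yes _   = λ ()
    ... | no ¬Sxy = ¬Sxy

  -- Almost linearity stated in ℕ, with C and e independent of m and q. Both the real bound and the
  -- exclusion of infinite fields start from it.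
  PolyLin : ℕ → REL X Y r → Set _
  PolyLin t R = ∃[ C ] ∃[ e ] ∀ {m q} → 1 ≤ q → m < 2 ^ suc q → Lin t m R (C * q ^ e)

  boolean-bound : ∀ {k l} (S : Fin l → REL X Y r) {R : REL X Y r} → (∀ i → SemiEquation (suc k) (S i)) →
                  BooleanCombination S R → ∀ τ → PolyLin (suc τ) R
  boolean-bound {X = X} {Y = Y} {k = k} {l} S {R} semi (expr , R⇔) τ =
    length (signs l) * C , e , λ {m} {q} 1≤q m<2^ {A} {B} uA uB A≤m free → begin
      E R A B
        ≤⟨ ∑-mono B (λ {y} _ → ∑-mono A (λ {x} _ → ⟨⟩-bound (λ Rxy → ≤-trans
             (≤-reflexive (sym (⟨⟩≡1 (Rxy , type-atom S x y))))
             (∑-member (signs l) (λ v → ⟨ (R ∧ Atom S v) x y ⟩) (∈-signs (type S x y)))))) ⟩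
      (∑[ y ∈ B ] ∑[ x ∈ A ] ∑[ v ∈ signs l ] ⟨ (R ∧ Atom S v) x y ⟩)
        ≡⟨ ∑-cong B (λ {y} _ → ∑-swap A (signs l) (λ x v → ⟨ (R ∧ Atom S v) x y ⟩)) ⟩
      (∑[ y ∈ B ] ∑[ v ∈ signs l ] ∑[ x ∈ A ] ⟨ (R ∧ Atom S v) x y ⟩)
        ≡⟨ ∑-swap B (signs l) (λ y v → deg (R ∧ Atom S v) A y) ⟩
      (∑[ v ∈ signs l ] E (R ∧ Atom S v) A B)
        ≤⟨ ∑-bounded (signs l) (λ {v} _ → piece 1≤q m<2^ uA uB A≤m free v) ⟩
      length (signs l) * (C * q ^ e * (length A + length B))
        ≡⟨ rearrange (length (signs l)) C (q ^ e) _ ⟩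
      length (signs l) * C * q ^ e * (length A + length B) ∎
    where
    open ≤-Reasoning
    -- The index of the semi-equations is raised by one, since the full relation used for padding is
    -- in general a semi-equation only from index 2 on.
    poly = coeff-polynomial (suc (suc k)) l l (suc τ)
    C = proj₁ poly
    e = proj₁ (proj₂ poly)
    rearrange : ∀ a b c s → a * (b * c * s) ≡ a * b * c * s
    rearrange = solve-∀
    spread : ∀ {x y x′ y′} v → R x y → Atom S v x y → Atom S v x′ y′ → R x′ y′
    spread {x} {y} {x′} {y′} v Rxy at at′ = Equivalence.from (R⇔ x′ y′)
      (Equivalence.to (⟦⟧ᵇ-cong expr (atom-agree S v at at′)) (Equivalence.to (R⇔ x y) Rxy))
    semiP : ∀ v i → SemiEquation (suc (suc k)) (positives S v i)
    semiP v i with Vec.lookup v i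
    ... | true  = semi-suc {R = S i} (semi i)
    ... | false = semi-full k
    semiN : ∀ v i → SemiEquation (suc (suc k)) (negatives S v i)
    semiN v i with Vec.lookup v i
    ... | true  = semi-empty (suc k)
    ... | false = semi-suc {R = S i} (semi i)
    -- Pairs in one atom agree on every `S i`. An atom that meets R therefore lies inside R and
    -- inherits its freeness; any other atom contributes no edge.
    piece : ∀ {m q} → 1 ≤ q → m < 2 ^ suc q → ∀ {A B} → Unique A → Unique B → length A ≤ m →
            KFree (suc τ) R A B → ∀ v → E (R ∧ Atom S v) A B ≤ C * q ^ e * (length A + length B)
    piece {q = q} 1≤q m<2^ {A} {B} uA uB A≤m free v =
      by-cases (∃[ x ] ∃[ y ] (R ∧ Atom S v) x y)
        (λ (x , y , Rxy , at) → ≤-trans (E-mono (R ∧ Atom S v) (Atom S v) A B (λ _ _ → proj₂))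
          (≤-trans (lin-conjunction 1≤q m<2^ l l (positives S v) (negatives S v) (semiP v) (semiN v) uA uB A≤m
                     (KFree-mono id id (λ _ _ at′ → spread v Rxy at at′) free))
                   (≤-reflexive (cong (_* (length A + length B)) (proj₂ (proj₂ poly) q)))))
        (λ ¬∃ → ≤-trans (≤-reflexive (E-empty (R ∧ Atom S v) A B (λ {x} {y} _ _ Rxy → ¬∃ (x , y , Rxy)))) z≤n)

open import Level using (_⊔_)
open import Data.Nat.DivMod using (_%_; _/_; m≡m%n+[m/n]*n; m%n<n)
open import Relation.Binary.Bundles using (Poset)
open import Relation.Binary.Definitions using (tri<; tri≈; tri>)
open import Relation.Binary.Structures using (IsTotalOrder)


-- Arithmetic and order in the real field

module OrderedField (ℝ : CompleteOrderedField) where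
  open CompleteOrderedField ℝ
  open IsTotalOrder isTotalOrder public
    using (total; antisym; isPartialOrder)
    renaming (refl to ≤-refl; trans to ≤-trans; reflexive to ≤-reflexive)
  open import Algebra.Properties.Ring ring public using (-‿distribˡ-*)
  open import Algebra.Properties.Semiring.Mult semiring public using (×1-homo-*; ×-congˡ)
  open import Algebra.Properties.Monoid.Mult +-monoid public using (×-homo-+)
  open import Algebra.Properties.CommutativeSemiring.Exp commutativeSemiring public using (^-distrib-*)
  open import Algebra.Solver.Ring.NaturalCoefficients.Default commutativeSemiring public
    using (solve; _:=_; _:+_; _:*_; con)

  poset : Poset 0ℓ 0ℓ 0ℓ
  poset = record { isPartialOrder = isPartialOrder }

  open import Relation.Binary.Reasoning.PartialOrder poset public
    using (begin_; begin-equality_; _∎; step-≤; step-≈; step-≈-⟩; step-≈-⟨)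

  +-monoʳ-≤ : ∀ z {x y} → x ≤ y → z + x ≤ z + y
  +-monoʳ-≤ z {x} {y} x≤y = begin
    z + x  ≈⟨ +-comm z x ⟩
    x + z  ≤⟨ +-monoˡ-≤ z x≤y ⟩
    y + z  ≈⟨ +-comm y z ⟩
    z + y  ∎

  +-mono-≤ : ∀ {w x y z} → w ≤ x → y ≤ z → w + y ≤ x + z
  +-mono-≤ {x = x} {y} w≤x y≤z = ≤-trans (+-monoˡ-≤ y w≤x) (+-monoʳ-≤ x y≤z)

  +-cancelʳ-≤ : ∀ z {x y} → x + z ≤ y + z → x ≤ y
  +-cancelʳ-≤ z {x} {y} p = begin
    x              ≈⟨ cancel x ⟨
    x + z + - z    ≤⟨ +-monoˡ-≤ (- z) p ⟩
    y + z + - z    ≈⟨ cancel y ⟩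
    y              ∎
    where
    cancel : ∀ x → x + z + - z ≈ x
    cancel x = trans (+-assoc x z (- z)) (trans (+-congˡ (-‿inverseʳ z)) (+-identityʳ x))

  x≤y+x : ∀ {x y} → 0# ≤ y → x ≤ y + x
  x≤y+x {x} {y} 0≤y = ≤-trans (≤-reflexive (sym (+-identityˡ x))) (+-monoˡ-≤ x 0≤y)

  x≤x+y : ∀ {x y} → 0# ≤ y → x ≤ x + y
  x≤x+y 0≤y = ≤-trans (x≤y+x 0≤y) (≤-reflexive (+-comm _ _))

  +-nonNeg : ∀ {x y} → 0# ≤ x → 0# ≤ y → 0# ≤ x + y
  +-nonNeg 0≤x 0≤y = ≤-trans 0≤x (x≤x+y 0≤y)

  *-monoʳ-≤ : ∀ {z x y} → 0# ≤ z → x ≤ y → x * z ≤ y * z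
  *-monoʳ-≤ {z} {x} {y} 0≤z x≤y = +-cancelʳ-≤ (- (x * z)) (begin
    x * z + - (x * z)  ≈⟨ -‿inverseʳ (x * z) ⟩
    0#                 ≤⟨ *-nonNeg (≤-trans (≤-reflexive (sym (-‿inverseʳ x))) (+-monoˡ-≤ (- x) x≤y)) 0≤z ⟩
    (y + - x) * z      ≈⟨ distribʳ z y (- x) ⟩
    y * z + - x * z    ≈⟨ +-congˡ (-‿distribˡ-* x z) ⟨
    y * z + - (x * z)  ∎)

  *-monoˡ-≤ : ∀ {z x y} → 0# ≤ z → x ≤ y → z * x ≤ z * y
  *-monoˡ-≤ {z} {x} {y} 0≤z x≤y =
    ≤-trans (≤-reflexive (*-comm z x)) (≤-trans (*-monoʳ-≤ 0≤z x≤y) (≤-reflexive (*-comm y z)))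

  *-mono-≤ : ∀ {w x y z} → 0# ≤ x → 0# ≤ y → w ≤ x → y ≤ z → w * y ≤ x * z
  *-mono-≤ 0≤x 0≤y w≤x y≤z = ≤-trans (*-monoʳ-≤ 0≤y w≤x) (*-monoˡ-≤ 0≤x y≤z)

  0≤1 : 0# ≤ 1#
  0≤1 with total 0# 1#
  ... | inj₁ 0≤1 = 0≤1
  ... | inj₂ 1≤0 = begin
    0#             ≤⟨ *-nonNeg 0≤-1 0≤-1 ⟩
    - 1# * - 1#    ≈⟨ -‿distribˡ-* 1# (- 1#) ⟨
    - (1# * - 1#)  ≈⟨ -‿cong (*-identityˡ (- 1#)) ⟩
    - (- 1#)       ≈⟨ -‿involutive 1# ⟩
    1#             ∎
    where
    open import Algebra.Properties.Ring ring using (-‿involutive)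
    0≤-1 : 0# ≤ - 1#
    0≤-1 = begin
      0#          ≈⟨ -‿inverseʳ 1# ⟨
      1# + - 1#   ≤⟨ +-monoˡ-≤ (- 1#) 1≤0 ⟩
      0# + - 1#   ≈⟨ +-identityˡ (- 1#) ⟩
      - 1#        ∎

  1≰0 : ¬ 1# ≤ 0#
  1≰0 1≤0 = proj₁ isField (antisym 1≤0 0≤1)

  fromℕ-nonNeg : ∀ n → 0# ≤ fromℕ n
  fromℕ-nonNeg zero    = ≤-refl
  fromℕ-nonNeg (suc n) = +-nonNeg 0≤1 (fromℕ-nonNeg n)

  fromℕ-mono : ∀ {m n} → m ℕ.≤ n → fromℕ m ≤ fromℕ n
  fromℕ-mono {n = n} z≤n = fromℕ-nonNeg n
  fromℕ-mono (s≤s m≤n)   = +-monoʳ-≤ 1# (fromℕ-mono m≤n)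

  fromℕ-+ : ∀ m n → fromℕ (m ℕ.+ n) ≈ fromℕ m + fromℕ n
  fromℕ-+ = ×-homo-+ 1#

  fromℕ-* : ∀ m n → fromℕ (m ℕ.* n) ≈ fromℕ m * fromℕ n
  fromℕ-* = ×1-homo-*

  fromℕ-^ : ∀ m n → fromℕ (m ℕ.^ n) ≈ fromℕ m ^ n
  fromℕ-^ m zero    = +-identityʳ 1#
  fromℕ-^ m (suc n) = trans (fromℕ-* m (m ℕ.^ n)) (*-congˡ (fromℕ-^ m n))

  positive≉0 : ∀ {x} → 1# ≤ x → ¬ (x ≈ 0#)
  positive≉0 1≤x x≈0 = 1≰0 (≤-trans 1≤x (≤-reflexive x≈0))

  fromℕ-suc≥1 : ∀ n → 1# ≤ fromℕ (suc n)
  fromℕ-suc≥1 n = x≤x+y (fromℕ-nonNeg n)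

  fromℕ≉0 : ∀ n → .{{NonZero n}} → ¬ (fromℕ n ≈ 0#)
  fromℕ≉0 (suc n) = positive≉0 (fromℕ-suc≥1 n)

  ^-nonNeg : ∀ {x} n → 0# ≤ x → 0# ≤ x ^ n
  ^-nonNeg zero    0≤x = 0≤1
  ^-nonNeg (suc n) 0≤x = *-nonNeg 0≤x (^-nonNeg n 0≤x)

  ^-mono : ∀ {x y} n → 0# ≤ x → x ≤ y → x ^ n ≤ y ^ n
  ^-mono zero    0≤x x≤y = ≤-refl
  ^-mono (suc n) 0≤x x≤y = *-mono-≤ (≤-trans 0≤x x≤y) (^-nonNeg n 0≤x) x≤y (^-mono n 0≤x x≤y)

-- The exponential series and the logarithm

module RealAnalysis (em : ∀ {ℓ} → ExcludedMiddle ℓ) (ℝ : CompleteOrderedField) where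
  open CompleteOrderedField ℝ
  open OrderedField ℝ
  open Classical em
  open RealFunctions ℝ

  ⁻¹-inverse : ∀ {x} → ¬ (x ≈ 0#) → x * x ⁻¹ ≈ 1#
  ⁻¹-inverse {x} x≉0 with em {P = x ≈ 0#}
  ... | yes x≈0 = contradiction x≈0 x≉0
  ... | no  x≉0 = proj₂ (proj₂ isField x x≉0)

  ⁻¹-nonNeg : ∀ {x} → 0# ≤ x → ¬ (x ≈ 0#) → 0# ≤ x ⁻¹
  ⁻¹-nonNeg {x} 0≤x x≉0 with total 0# (x ⁻¹)
  ... | inj₁ 0≤x⁻¹ = 0≤x⁻¹
  ... | inj₂ x⁻¹≤0 = ⊥-elim (1≰0 (begin
    1#          ≈⟨ ⁻¹-inverse x≉0 ⟨
    x * x ⁻¹    ≤⟨ *-monoˡ-≤ 0≤x x⁻¹≤0 ⟩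
    x * 0#      ≈⟨ zeroʳ x ⟩
    0#          ∎))

  ⁻¹-≉0 : ∀ {x} → ¬ (x ≈ 0#) → ¬ (x ⁻¹ ≈ 0#)
  ⁻¹-≉0 x≉0 x⁻¹≈0 = proj₁ isField (trans (sym (⁻¹-inverse x≉0)) (trans (*-congˡ x⁻¹≈0) (zeroʳ _)))

  *-inverseʳ : ∀ {z} x → ¬ (z ≈ 0#) → x * z * z ⁻¹ ≈ x
  *-inverseʳ {z} x z≉0 = trans (*-assoc x z (z ⁻¹)) (trans (*-congˡ (⁻¹-inverse z≉0)) (*-identityʳ x))

  *-cancelʳ-≤ : ∀ {z x y} → 0# ≤ z → ¬ (z ≈ 0#) → x * z ≤ y * z → x ≤ y
  *-cancelʳ-≤ {z} {x} {y} 0≤z z≉0 p = begin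
    x               ≈⟨ *-inverseʳ x z≉0 ⟨
    x * z * z ⁻¹    ≤⟨ *-monoʳ-≤ (⁻¹-nonNeg 0≤z z≉0) p ⟩
    y * z * z ⁻¹    ≈⟨ *-inverseʳ y z≉0 ⟩
    y               ∎

  *-cancelʳ-≈ : ∀ {z x y} → ¬ (z ≈ 0#) → x * z ≈ y * z → x ≈ y
  *-cancelʳ-≈ {z} {x} {y} z≉0 p = trans (sym (*-inverseʳ x z≉0)) (trans (*-congʳ p) (*-inverseʳ y z≉0))

  *-≉0 : ∀ {x y} → ¬ (x ≈ 0#) → ¬ (y ≈ 0#) → ¬ (x * y ≈ 0#)
  *-≉0 {x} {y} x≉0 y≉0 xy≈0 = x≉0 (*-cancelʳ-≈ y≉0 (trans xy≈0 (sym (zeroˡ y))))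

  -- Otherwise x bounds the set of elements below some natural number. Since n + 1 belongs to the
  -- set whenever n does, its supremum s would leave s - 1 as an upper bound.
  archimedean : ∀ x → ∃[ n ] x ≤ fromℕ n
  archimedean x with em {P = ∃[ n ] x ≤ fromℕ n}
  ... | yes found = found
  ... | no none with complete (λ y → ∃[ n ] y ≤ fromℕ n) (0# , 0 , ≤-refl)
                       (x , λ y (n , y≤n) → [ (λ x≤n → contradiction (n , x≤n) none) , ≤-trans y≤n ]′ (total x (fromℕ n)))
  ... | s , upper , least = ⊥-elim (1≰0 (+-cancelʳ-≤ s (begin
    1# + s           ≤⟨ +-monoʳ-≤ 1# (least (- 1# + s) (λ y (n , y≤n) → below y n y≤n)) ⟩
    1# + (- 1# + s)  ≈⟨ +-assoc 1# (- 1#) s ⟨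
    1# + - 1# + s    ≈⟨ +-congʳ (-‿inverseʳ 1#) ⟩
    0# + s           ∎)))
    where
    below : ∀ y n → y ≤ fromℕ n → y ≤ - 1# + s
    below y n y≤n = begin
      y                 ≤⟨ y≤n ⟩
      fromℕ n           ≈⟨ trans (+-congʳ (-‿inverseˡ 1#)) (+-identityˡ _) ⟨
      - 1# + 1# + fromℕ n  ≈⟨ +-assoc (- 1#) 1# (fromℕ n) ⟩
      - 1# + fromℕ (suc n)  ≤⟨ +-monoʳ-≤ (- 1#) (upper _ (suc n , ≤-refl)) ⟩
      - 1# + s          ∎

  sup-isSupremum : ∀ {S} → ∃ S → ∃ (UpperBound S) → IsSupremum S (sup S)
  sup-isSupremum {S} inh bdd with em {P = ∃ S × ∃ (UpperBound S)}
  ... | yes (inh , bdd) = proj₂ (complete S inh bdd)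
  ... | no ¬both        = contradiction (inh , bdd) ¬both

  term : Carrier → ℕ → Carrier
  term x n = x ^ n * fromℕ (n !) ⁻¹

  n!≉0 : ∀ n → ¬ (fromℕ (n !) ≈ 0#)
  n!≉0 n = fromℕ≉0 (n !) {{n ℕₚ.!≢0}}

  term-zero : ∀ x → term x 0 ≈ 1#
  term-zero x = *-cancelʳ-≈ (n!≉0 0) (begin-equality
    1# * fromℕ 1 ⁻¹ * fromℕ 1    ≈⟨ *-congʳ (*-identityˡ _) ⟩
    fromℕ 1 ⁻¹ * fromℕ 1         ≈⟨ trans (*-comm _ _) (⁻¹-inverse (n!≉0 0)) ⟩
    1#                           ≈⟨ trans (*-identityˡ _) (+-identityʳ 1#) ⟨
    1# * fromℕ 1                 ∎)

  term-suc : ∀ x n → fromℕ (suc n) * term x (suc n) ≈ x * term x n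
  term-suc x n = *-cancelʳ-≈ (n!≉0 n) (begin-equality
    fromℕ (suc n) * (x * x ^ n * fromℕ (suc n !) ⁻¹) * fromℕ (n !)
      ≈⟨ solve 5 (λ a x p i f → a :* (x :* p :* i) :* f := x :* p :* (a :* f :* i)) refl (fromℕ (suc n)) x (x ^ n) (fromℕ (suc n !) ⁻¹) (fromℕ (n !)) ⟩
    x * x ^ n * (fromℕ (suc n) * fromℕ (n !) * fromℕ (suc n !) ⁻¹)
      ≈⟨ *-congˡ (*-congʳ (fromℕ-* (suc n) (n !))) ⟨
    x * x ^ n * (fromℕ (suc n !) * fromℕ (suc n !) ⁻¹)
      ≈⟨ *-congˡ (⁻¹-inverse (n!≉0 (suc n))) ⟩
    x * x ^ n * 1#
      ≈⟨ *-congˡ (⁻¹-inverse (n!≉0 n)) ⟨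
    x * x ^ n * (fromℕ (n !) * fromℕ (n !) ⁻¹)
      ≈⟨ solve 4 (λ x p f i → x :* p :* (f :* i) := x :* (p :* i) :* f) refl x (x ^ n) (fromℕ (n !)) (fromℕ (n !) ⁻¹) ⟩
    x * (x ^ n * fromℕ (n !) ⁻¹) * fromℕ (n !) ∎)

  n!⁻¹-nonNeg : ∀ n → 0# ≤ fromℕ (n !) ⁻¹
  n!⁻¹-nonNeg n = ⁻¹-nonNeg (fromℕ-nonNeg (n !)) (n!≉0 n)

  term-nonNeg : ∀ {x} n → 0# ≤ x → 0# ≤ term x n
  term-nonNeg n 0≤x = *-nonNeg (^-nonNeg n 0≤x) (n!⁻¹-nonNeg n)

  term-mono : ∀ {x y} n → 0# ≤ x → x ≤ y → term x n ≤ term y n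
  term-mono n 0≤x x≤y = *-monoʳ-≤ (n!⁻¹-nonNeg n) (^-mono n 0≤x x≤y)

  expSum-mono : ∀ {x y} n → 0# ≤ x → x ≤ y → expSum x n ≤ expSum y n
  expSum-mono zero    0≤x x≤y = ≤-refl
  expSum-mono (suc n) 0≤x x≤y = +-mono-≤ (expSum-mono n 0≤x x≤y) (term-mono n 0≤x x≤y)

  expSum-nonNeg : ∀ {x} n → 0# ≤ x → 0# ≤ expSum x n
  expSum-nonNeg zero    0≤x = ≤-refl
  expSum-nonNeg (suc n) 0≤x = +-nonNeg (expSum-nonNeg n 0≤x) (term-nonNeg n 0≤x)

  expSum-increasing : ∀ {x m n} → 0# ≤ x → m ℕ.≤ n → expSum x m ≤ expSum x n
  expSum-increasing {x} 0≤x m≤n = go (ℕₚ.≤⇒≤′ m≤n)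
    where
    go : ∀ {m n} → m ℕ.≤′ n → expSum x m ≤ expSum x n
    go (ℕ.≤′-reflexive ≡.refl) = ≤-refl
    go {n = suc n} (ℕ.≤′-step m≤n) = ≤-trans (go m≤n) (x≤x+y (term-nonNeg n 0≤x))

  1+1≉0 : ¬ (1# + 1# ≈ 0#)
  1+1≉0 = positive≉0 (x≤x+y 0≤1)

  half : Carrier
  half = (1# + 1#) ⁻¹

  half+half : half + half ≈ 1#
  half+half = trans (sym (trans (distribʳ half 1# 1#) (+-cong (*-identityˡ half) (*-identityˡ half)))) (⁻¹-inverse 1+1≉0)

  0≤half : 0# ≤ half
  0≤half = ⁻¹-nonNeg (+-nonNeg 0≤1 0≤1) 1+1≉0

  -- The Cauchy product of the exponential series of x with the geometric series of
  -- ratio 1/2 dominates the exponential series of x + 1/2.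
  product : Carrier → ℕ → Carrier
  product x zero    = term x 0
  product x (suc n) = half * product x n + term x (suc n)

  product-nonNeg : ∀ {x} n → 0# ≤ x → 0# ≤ product x n
  product-nonNeg zero    0≤x = term-nonNeg 0 0≤x
  product-nonNeg (suc n) 0≤x = +-nonNeg (*-nonNeg 0≤half (product-nonNeg n 0≤x)) (term-nonNeg (suc n) 0≤x)

  -- The counterpart of `term-suc` at x + 1/2, as an inequality; with it `term-≤-product` compares
  -- the two sequences by induction.
  product-step : ∀ {x} n → 0# ≤ x → (x + half) * product x n ≤ fromℕ (suc n) * product x (suc n)
  product-step {x} zero 0≤x = ≤-reflexive (begin-equality
    (x + half) * term x 0                   ≈⟨ distribʳ (term x 0) x half ⟩
    x * term x 0 + half * term x 0          ≈⟨ +-congʳ (term-suc x 0) ⟨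
    fromℕ 1 * term x 1 + half * term x 0    ≈⟨ +-congˡ (trans (*-congʳ (+-identityʳ 1#)) (*-identityˡ _)) ⟨
    fromℕ 1 * term x 1 + fromℕ 1 * (half * term x 0)  ≈⟨ solve 3 (λ a b c → a :* b :+ a :* c := a :* (c :+ b)) refl (fromℕ 1) (term x 1) (half * term x 0) ⟩
    fromℕ 1 * (half * term x 0 + term x 1)  ∎)
  product-step {x} (suc n) 0≤x = begin
    (x + half) * (half * c + g)
      ≈⟨ solve 4 (λ x h c g → (x :+ h) :* (h :* c :+ g) := h :* (x :* c) :+ x :* g :+ h :* (h :* c :+ g)) refl x half c g ⟩
    half * (x * c) + x * g + half * c₁
      ≤⟨ +-monoˡ-≤ _ (+-monoˡ-≤ _ (*-monoˡ-≤ 0≤half (≤-trans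
           (*-monoʳ-≤ (product-nonNeg n 0≤x) (x≤x+y 0≤half)) (product-step n 0≤x)))) ⟩
    half * (fromℕ (suc n) * c₁) + x * g + half * c₁
      ≈⟨ +-congʳ (+-congˡ (term-suc x (suc n))) ⟨
    half * (fromℕ (suc n) * c₁) + (1# + fromℕ (suc n)) * g₁ + half * c₁
      ≈⟨ solve 4 (λ h a c g → h :* (a :* c) :+ (con 1 :+ a) :* g :+ h :* c := (con 1 :+ a) :* (h :* c :+ g)) refl half (fromℕ (suc n)) c₁ g₁ ⟩
    (1# + fromℕ (suc n)) * (half * c₁ + g₁) ∎
    where
    c = product x n
    g = term x (suc n)
    c₁ = product x (suc n)
    g₁ = term x (suc (suc n))

  term-≤-product : ∀ {x} n → 0# ≤ x → term (x + half) n ≤ product x n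
  term-≤-product {x} zero    0≤x = ≤-reflexive (trans (term-zero (x + half)) (sym (term-zero x)))
  term-≤-product {x} (suc n) 0≤x = *-cancelʳ-≤ (fromℕ-nonNeg (suc n)) (fromℕ≉0 (suc n)) (begin
    term (x + half) (suc n) * fromℕ (suc n)  ≈⟨ *-comm _ _ ⟩
    fromℕ (suc n) * term (x + half) (suc n)  ≈⟨ term-suc (x + half) n ⟩
    (x + half) * term (x + half) n           ≤⟨ *-monoˡ-≤ (+-nonNeg 0≤x 0≤half) (term-≤-product n 0≤x) ⟩
    (x + half) * product x n                 ≤⟨ product-step n 0≤x ⟩
    fromℕ (suc n) * product x (suc n)        ≈⟨ *-comm _ _ ⟩
    product x (suc n) * fromℕ (suc n)        ∎)

  productSum : Carrier → ℕ → Carrier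
  productSum x zero    = 0#
  productSum x (suc n) = productSum x n + product x n

  productSum-suc : ∀ x n → productSum x (suc n) ≈ half * productSum x n + expSum x (suc n)
  productSum-suc x zero = solve 2 (λ h t → con 0 :+ t := h :* con 0 :+ (con 0 :+ t)) refl half (term x 0)
  productSum-suc x (suc n) = trans (+-congʳ (productSum-suc x n))
    (solve 5 (λ h s e c t → (h :* s :+ e) :+ (h :* c :+ t) := h :* (s :+ c) :+ (e :+ t)) refl
       half (productSum x n) (expSum x (suc n)) (product x n) (term x (suc n)))

  -- The sums S satisfy S (n + 1) = S n / 2 + e (n + 1) with e the exponential sums. As S increases,
  -- half of S (n + 1) can be cancelled.
  half-productSum : ∀ {x} n → 0# ≤ x → half * productSum x n ≤ expSum x n
  half-productSum zero 0≤x = ≤-reflexive (zeroʳ half)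
  half-productSum {x} (suc n) 0≤x = +-cancelʳ-≤ (half * S) (begin
    half * S + half * S
      ≈⟨ trans (sym (distribʳ S half half)) (trans (*-congʳ half+half) (*-identityˡ S)) ⟩
    S
      ≈⟨ productSum-suc x n ⟩
    half * productSum x n + expSum x (suc n)
      ≤⟨ +-monoˡ-≤ _ (*-monoˡ-≤ 0≤half (x≤x+y (product-nonNeg n 0≤x))) ⟩
    half * S + expSum x (suc n)
      ≈⟨ +-comm _ _ ⟩
    expSum x (suc n) + half * S ∎)
    where S = productSum x (suc n)

  expSum-≤-productSum : ∀ {x} n → 0# ≤ x → expSum (x + half) n ≤ productSum x n
  expSum-≤-productSum zero    0≤x = ≤-refl
  expSum-≤-productSum (suc n) 0≤x = +-mono-≤ (expSum-≤-productSum n 0≤x) (term-≤-product n 0≤x)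

  -- On partial sums this expresses exp (1/2) ≤ 2, that is log 2 ≥ 1/2, the numerical fact behind
  -- the constants of the bounds.
  expSum-half : ∀ {x} n → 0# ≤ x → expSum (x + half) n ≤ expSum x n + expSum x n
  expSum-half {x} n 0≤x = begin
    expSum (x + half) n    ≤⟨ expSum-≤-productSum n 0≤x ⟩
    S                      ≈⟨ trans (sym (*-identityˡ S)) (trans (*-congʳ (sym half+half)) (distribʳ S half half)) ⟩
    half * S + half * S    ≤⟨ +-mono-≤ (half-productSum n 0≤x) (half-productSum n 0≤x) ⟩
    expSum x n + expSum x n ∎
    where S = productSum x n

  halves : ℕ → Carrier
  halves zero    = 0#
  halves (suc q) = halves q + half

  halves-nonNeg : ∀ q → 0# ≤ halves q
  halves-nonNeg zero    = ≤-refl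
  halves-nonNeg (suc q) = +-nonNeg (halves-nonNeg q) 0≤half

  halves+halves : ∀ q → halves q + halves q ≈ fromℕ q
  halves+halves zero    = +-identityʳ 0#
  halves+halves (suc q) = trans
    (solve 2 (λ a h → (a :+ h) :+ (a :+ h) := (h :+ h) :+ (a :+ a)) refl (halves q) half)
    (+-cong half+half (halves+halves q))

  expSum-zero : ∀ n → expSum 0# n ≤ 1#
  expSum-zero zero          = 0≤1
  expSum-zero (suc zero)    = ≤-reflexive (trans (+-identityˡ _) (term-zero 0#))
  expSum-zero (suc (suc n)) = ≤-trans (≤-reflexive (trans (+-congˡ (trans (*-congʳ (zeroˡ _)) (zeroˡ _))) (+-identityʳ _)))
    (expSum-zero (suc n))

  expSum-halves : ∀ q n → expSum (halves q) n ≤ fromℕ (2 ℕ.^ q)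
  expSum-halves zero    n = ≤-trans (expSum-zero n) (≤-reflexive (sym (+-identityʳ 1#)))
  expSum-halves (suc q) n = begin
    expSum (halves q + half) n                     ≤⟨ expSum-half n (halves-nonNeg q) ⟩
    expSum (halves q) n + expSum (halves q) n      ≤⟨ +-mono-≤ (expSum-halves q n) (expSum-halves q n) ⟩
    fromℕ (2 ℕ.^ q) + fromℕ (2 ℕ.^ q)              ≈⟨ fromℕ-+ (2 ℕ.^ q) (2 ℕ.^ q) ⟨
    fromℕ (2 ℕ.^ q ℕ.+ 2 ℕ.^ q)                    ≈⟨ ×-congˡ (≡.cong (2 ℕ.^ q ℕ.+_) (ℕₚ.+-identityʳ (2 ℕ.^ q))) ⟨
    fromℕ (2 ℕ.^ suc q) ∎

  -- The set of eventual lower bounds defining `lim` contains 0, and it is bounded because x is at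
  -- most some number of halves, where `expSum-halves` applies.
  exp-isSupremum : ∀ {x} → 0# ≤ x → IsSupremum (λ a → ∃[ N ] ∀ n → N ℕ.≤ n → a ≤ expSum x n) (exp x)
  exp-isSupremum {x} 0≤x = sup-isSupremum (0# , 0 , λ n _ → expSum-nonNeg n 0≤x) (fromℕ (2 ℕ.^ (q ℕ.+ q)) ,
    λ a (N , a≤) → ≤-trans (a≤ N ℕₚ.≤-refl) (≤-trans (expSum-mono N 0≤x x≤halves) (expSum-halves (q ℕ.+ q) N)))
    where
    q = proj₁ (archimedean x)
    halves-+ : ∀ m n → halves (m ℕ.+ n) ≈ halves m + halves n
    halves-+ zero    n = sym (+-identityˡ _)
    halves-+ (suc m) n = trans (+-congʳ (halves-+ m n))
      (solve 3 (λ a b h → a :+ b :+ h := a :+ h :+ b) refl (halves m) (halves n) half)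
    x≤halves : x ≤ halves (q ℕ.+ q)
    x≤halves = ≤-trans (proj₂ (archimedean x)) (≤-reflexive (sym (trans (halves-+ q q) (halves+halves q))))

  expSum-≤-exp : ∀ {x} n → 0# ≤ x → expSum x n ≤ exp x
  expSum-≤-exp n 0≤x = proj₁ (exp-isSupremum 0≤x) _ (n , λ m n≤m → expSum-increasing 0≤x n≤m)

  exp-least : ∀ {x b} → 0# ≤ x → (∀ n → expSum x n ≤ b) → exp x ≤ b
  exp-least {b = b} 0≤x bound = proj₂ (exp-isSupremum 0≤x) b (λ a (N , a≤) → ≤-trans (a≤ N ℕₚ.≤-refl) (bound N))

  exp-mono : ∀ {x y} → 0# ≤ x → x ≤ y → exp x ≤ exp y
  exp-mono 0≤x x≤y = exp-least 0≤x (λ n → ≤-trans (expSum-mono n 0≤x x≤y) (expSum-≤-exp n (≤-trans 0≤x x≤y)))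

  1≤exp : ∀ {x} → 0# ≤ x → 1# ≤ exp x
  1≤exp {x} 0≤x = ≤-trans (≤-reflexive (sym (trans (+-identityˡ _) (term-zero x)))) (expSum-≤-exp 1 0≤x)

  x≤exp : ∀ {x} → 0# ≤ x → x ≤ exp x
  x≤exp {x} 0≤x = begin
    x                        ≈⟨ trans (*-congˡ (term-zero x)) (*-identityʳ x) ⟨
    x * term x 0             ≈⟨ term-suc x 0 ⟨
    fromℕ 1 * term x 1       ≈⟨ trans (*-congʳ (+-identityʳ 1#)) (*-identityˡ _) ⟩
    term x 1                 ≤⟨ x≤y+x (expSum-nonNeg 1 0≤x) ⟩
    expSum x 2               ≤⟨ expSum-≤-exp 2 0≤x ⟩
    exp x                    ∎

  -- The left side is one of the binomial terms of the right side. Induction through `term-suc`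
  -- takes the place of the binomial theorem.
  shifted-term : ∀ {a b} n → 0# ≤ a → 0# ≤ b → b * term a n ≤ term (a + b) (suc n)
  shifted-term {a} {b} n 0≤a 0≤b = *-cancelʳ-≤ (fromℕ-nonNeg (suc n)) (fromℕ≉0 (suc n)) (begin
    b * term a n * fromℕ (suc n)
      ≈⟨ solve 3 (λ b g m → b :* g :* (con 1 :+ m) := b :* (m :* g) :+ b :* g) refl b (term a n) (fromℕ n) ⟩
    b * (fromℕ n * term a n) + b * term a n
      ≤⟨ +-mono-≤ (lower n) (*-monoˡ-≤ 0≤b (term-mono n 0≤a (x≤x+y 0≤b))) ⟩
    a * term (a + b) n + b * term (a + b) n
      ≈⟨ distribʳ (term (a + b) n) a b ⟨
    (a + b) * term (a + b) n
      ≈⟨ term-suc (a + b) n ⟨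
    fromℕ (suc n) * term (a + b) (suc n)
      ≈⟨ *-comm _ _ ⟩
    term (a + b) (suc n) * fromℕ (suc n) ∎)
    where
    lower : ∀ n → b * (fromℕ n * term a n) ≤ a * term (a + b) n
    lower zero = ≤-trans (≤-reflexive (trans (*-congˡ (zeroˡ _)) (zeroʳ b)))
      (*-nonNeg 0≤a (term-nonNeg 0 (+-nonNeg 0≤a 0≤b)))
    lower (suc n) = begin
      b * (fromℕ (suc n) * term a (suc n))  ≈⟨ *-congˡ (term-suc a n) ⟩
      b * (a * term a n)                    ≈⟨ solve 3 (λ a b g → b :* (a :* g) := a :* (b :* g)) refl a b (term a n) ⟩
      a * (b * term a n)                    ≤⟨ *-monoˡ-≤ 0≤a (shifted-term n 0≤a 0≤b) ⟩
      a * term (a + b) (suc n)              ∎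

  -- A weak form of the functional equation, with b in the place of exp b. It suffices for gaining
  -- one factor per step in `power-bound`.
  exp-+ : ∀ {a b} → 0# ≤ a → 0# ≤ b → b * exp a ≤ exp (a + b)
  exp-+ {a} {b} 0≤a 0≤b with em {P = b ≈ 0#}
  ... | yes b≈0 = ≤-trans (≤-reflexive (trans (*-congʳ b≈0) (zeroˡ _))) (≤-trans 0≤1 (1≤exp (+-nonNeg 0≤a 0≤b)))
  ... | no b≉0 = begin
    b * exp a                     ≤⟨ *-monoˡ-≤ 0≤b (exp-least 0≤a below) ⟩
    b * (exp (a + b) * b ⁻¹)      ≈⟨ solve 3 (λ b e i → b :* (e :* i) := e :* b :* i) refl b (exp (a + b)) (b ⁻¹) ⟩
    exp (a + b) * b * b ⁻¹        ≈⟨ *-inverseʳ (exp (a + b)) b≉0 ⟩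
    exp (a + b)                   ∎
    where
    shifted : ∀ n → b * expSum a n ≤ expSum (a + b) (suc n)
    shifted zero    = ≤-trans (≤-reflexive (zeroʳ b)) (expSum-nonNeg 1 (+-nonNeg 0≤a 0≤b))
    shifted (suc n) = ≤-trans (≤-reflexive (distribˡ b _ _)) (+-mono-≤ (shifted n) (shifted-term n 0≤a 0≤b))
    below : ∀ n → expSum a n ≤ exp (a + b) * b ⁻¹
    below n = *-cancelʳ-≤ 0≤b b≉0 (begin
      expSum a n * b                ≈⟨ *-comm _ b ⟩
      b * expSum a n                ≤⟨ shifted n ⟩
      expSum (a + b) (suc n)        ≤⟨ expSum-≤-exp (suc n) (+-nonNeg 0≤a 0≤b) ⟩
      exp (a + b)                   ≈⟨ *-inverseʳ (exp (a + b)) b≉0 ⟨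
      exp (a + b) * b * b ⁻¹        ≈⟨ solve 3 (λ b e i → e :* b :* i := e :* i :* b) refl b (exp (a + b)) (b ⁻¹) ⟩
      exp (a + b) * b ⁻¹ * b        ∎)

  -- For nonnegative x the bound follows from x ≤ exp x. Negative x lie below y anyway, so the
  -- values of `exp` there do not matter.
  log-isSupremum : ∀ {y} → 1# ≤ y → IsSupremum (λ x → exp x ≤ y) (log y)
  log-isSupremum {y} 1≤y = sup-isSupremum (0# , exp-least ≤-refl (λ n → ≤-trans (expSum-zero n) 1≤y))
    (y , λ x expx≤y → [ (λ 0≤x → ≤-trans (x≤exp 0≤x) expx≤y) , (λ x≤0 → ≤-trans x≤0 (≤-trans 0≤1 1≤y)) ]′ (total 0# x))

  ≤-log : ∀ {x y} → 1# ≤ y → exp x ≤ y → x ≤ log y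
  ≤-log 1≤y = proj₁ (log-isSupremum 1≤y) _

  -- Replaces exp (log y) = y, which would require continuity: an argument beyond the supremum
  -- cannot have its exponential at most y.
  beyond-log : ∀ {y δ} → 1# ≤ y → 0# < δ → y ≤ exp (log y + δ)
  beyond-log {y} {δ} 1≤y (0≤δ , 0≉δ) with total y (exp (log y + δ))
  ... | inj₁ le = le
  ... | inj₂ ge = contradiction (antisym 0≤δ δ≤0) 0≉δ
    where
    δ≤0 : δ ≤ 0#
    δ≤0 = +-cancelʳ-≤ (log y) (begin
      δ + log y    ≈⟨ +-comm δ (log y) ⟩
      log y + δ    ≤⟨ ≤-log 1≤y ge ⟩
      log y        ≈⟨ +-identityˡ (log y) ⟨
      0# + log y   ∎)

  halves-≤-log : ∀ q n → 2 ℕ.^ q ℕ.≤ n → halves q ≤ log (fromℕ n)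
  halves-≤-log q n 2^q≤n = ≤-log 1≤n (exp-least (halves-nonNeg q) (λ i → ≤-trans (expSum-halves q i) (fromℕ-mono 2^q≤n)))
    where
    1≤n : 1# ≤ fromℕ n
    1≤n = ≤-trans (≤-reflexive (sym (+-identityʳ 1#))) (fromℕ-mono (ℕₚ.≤-trans (ℕₚ.m^n>0 2 q) 2^q≤n))

-- From counting bounds to real bounds

module RealBounds (em : ∀ {ℓ} → ExcludedMiddle ℓ) (ℝ : CompleteOrderedField) where
  open CompleteOrderedField ℝ hiding (zero)
  open OrderedField ℝ
  open RealAnalysis em ℝ
  open Classical em
  open RealFunctions ℝ
  open Combinatorics em using (coeff; posConst; negConst; coeff-positive; coeff-negative; positive-const; negative-const; log₂-floor; zarankiewicz-≤; lin-conjunction; PolyLin)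

  private
    variable
      a b r : Level
      X : Set a
      Y : Set b

  fromℕ-≤-2log : ∀ q n → 2 ℕ.^ q ℕ.≤ n → fromℕ q ≤ fromℕ 2 * log (fromℕ n)
  fromℕ-≤-2log q n 2^q≤n = begin
    fromℕ q              ≈⟨ halves+halves q ⟨
    halves q + halves q  ≤⟨ +-mono-≤ (halves-≤-log q n 2^q≤n) (halves-≤-log q n 2^q≤n) ⟩
    log (fromℕ n) + log (fromℕ n)  ≈⟨ solve 1 (λ l → l :+ l := (con 1 :+ (con 1 :+ con 0)) :* l) refl (log (fromℕ n)) ⟩
    fromℕ 2 * log (fromℕ n) ∎

  polylog-bound : ∀ {L} K q e → fromℕ q ≤ fromℕ 2 * L → fromℕ (K ℕ.* q ℕ.^ e) ≤ fromℕ (K ℕ.* 2 ℕ.^ e) * L ^ e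
  polylog-bound {L} K q e q≤ = begin
    fromℕ (K ℕ.* q ℕ.^ e)             ≈⟨ trans (fromℕ-* K (q ℕ.^ e)) (*-congˡ (fromℕ-^ q e)) ⟩
    fromℕ K * fromℕ q ^ e             ≤⟨ *-monoˡ-≤ (fromℕ-nonNeg K) (^-mono e (fromℕ-nonNeg q) q≤) ⟩
    fromℕ K * (fromℕ 2 * L) ^ e       ≈⟨ *-congˡ (^-distrib-* (fromℕ 2) L e) ⟩
    fromℕ K * (fromℕ 2 ^ e * L ^ e)   ≈⟨ *-assoc _ _ _ ⟨
    fromℕ K * fromℕ 2 ^ e * L ^ e     ≈⟨ *-congʳ (*-congˡ (fromℕ-^ 2 e)) ⟨
    fromℕ K * fromℕ (2 ℕ.^ e) * L ^ e ≈⟨ *-congʳ (fromℕ-* K (2 ℕ.^ e)) ⟨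
    fromℕ (K ℕ.* 2 ℕ.^ e) * L ^ e     ∎

  coeff-≤-zBound : ∀ k d d′ t m n q → 2 ℕ.^ q ℕ.≤ m ℕ.+ 1 → 1 ℕ.≤ q →
                   fromℕ (coeff k d d′ t q ℕ.* (m ℕ.+ n)) ≤ zBound k d d′ t m n
  coeff-≤-zBound k zero zero t m n q 2^q≤ 1≤q = ≤-refl
  coeff-≤-zBound k (suc d) zero t m n q 2^q≤ 1≤q = begin
    fromℕ (coeff k (suc d) 0 t q ℕ.* (m ℕ.+ n))
      ≈⟨ ×-congˡ (≡.trans (≡.cong (ℕ._* (m ℕ.+ n)) (coeff-positive k d t q))
           (≡.trans (rearrange (posConst k d t) (q ℕ.^ (2 ℕ.* d)) (m ℕ.+ n))
             (≡.cong (λ e → posConst k d t ℕ.* (m ℕ.+ n) ℕ.* q ℕ.^ e) (≡.sym (exponent d))))) ⟩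
    fromℕ (posConst k d t ℕ.* (m ℕ.+ n) ℕ.* q ℕ.^ (2 ℕ.* suc d ℕ.∸ 2))
      ≤⟨ polylog-bound (posConst k d t ℕ.* (m ℕ.+ n)) q (2 ℕ.* suc d ℕ.∸ 2) (fromℕ-≤-2log q (m ℕ.+ 1) 2^q≤) ⟩
    fromℕ (posConst k d t ℕ.* (m ℕ.+ n) ℕ.* 2 ℕ.^ (2 ℕ.* suc d ℕ.∸ 2)) * log (fromℕ (m ℕ.+ 1)) ^ (2 ℕ.* suc d ℕ.∸ 2)
      ≤⟨ *-monoʳ-≤ (^-nonNeg (2 ℕ.* suc d ℕ.∸ 2) (log-nonNeg m)) (fromℕ-mono (positive-const k d t (m ℕ.+ n))) ⟩
    zBound k (suc d) zero t m n ∎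
    where
    rearrange : ∀ a b c → a ℕ.* b ℕ.* c ≡ a ℕ.* c ℕ.* b
    rearrange = solve-∀
    exponent : ∀ d → 2 ℕ.* suc d ℕ.∸ 2 ≡ 2 ℕ.* d
    exponent d = ≡.trans (≡.cong (ℕ._∸ 2) (ℕₚ.*-suc 2 d)) (ℕₚ.m+n∸m≡n 2 (2 ℕ.* d))
    log-nonNeg : ∀ m → 0# ≤ log (fromℕ (m ℕ.+ 1))
    log-nonNeg m = halves-≤-log 0 (m ℕ.+ 1) (ℕₚ.m≤n+m 1 m)
  coeff-≤-zBound k d (suc δ) t m n q 2^q≤ 1≤q = begin
    fromℕ (coeff k d (suc δ) t q ℕ.* (m ℕ.+ n))
      ≈⟨ ×-congˡ (≡.trans (≡.cong (ℕ._* (m ℕ.+ n)) (coeff-negative k d δ t q))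
           (≡.trans (rearrange K (q ℕ.^ (2 ℕ.* d ℕ.+ δ)) (m ℕ.+ n))
             (≡.cong (λ e → K ℕ.* (m ℕ.+ n) ℕ.* q ℕ.^ e) (≡.sym (≡.cong (ℕ._∸ 1) (ℕₚ.+-suc (2 ℕ.* d) δ)))))) ⟩
    fromℕ (K ℕ.* (m ℕ.+ n) ℕ.* q ℕ.^ e)
      ≤⟨ polylog-bound (K ℕ.* (m ℕ.+ n)) q e (fromℕ-≤-2log q (m ℕ.+ 1) 2^q≤) ⟩
    fromℕ (K ℕ.* (m ℕ.+ n) ℕ.* 2 ℕ.^ e) * log (fromℕ (m ℕ.+ 1)) ^ e
      ≈⟨ *-congʳ (×-congˡ (negative-const k d δ t (m ℕ.+ n))) ⟩
    fromℕ (8 ℕ.^ (d ℕ.+ suc δ ℕ.∸ 1) ℕ.* k ℕ.^ (4 ℕ.* d ℕ.+ suc δ) ℕ.* suc δ ! ℕ.* t ℕ.^ (suc δ ℕ.+ 1) ℕ.* (m ℕ.+ n))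
      * log (fromℕ (m ℕ.+ 1)) ^ e
      -- `zBound` splits on d before d′, so its last clause reduces only once d is known to be zero
      -- or a successor.
      ≈⟨ unfold d ⟩
    zBound k d (suc δ) t m n ∎
    where
    K = (2 ℕ.* k ℕ.^ 4) ℕ.^ d ℕ.* negConst k δ t
    e = 2 ℕ.* d ℕ.+ suc δ ℕ.∸ 1
    rearrange : ∀ a b c → a ℕ.* b ℕ.* c ≡ a ℕ.* c ℕ.* b
    rearrange = solve-∀
    unfold : ∀ d → fromℕ (8 ℕ.^ (d ℕ.+ suc δ ℕ.∸ 1) ℕ.* k ℕ.^ (4 ℕ.* d ℕ.+ suc δ) ℕ.* suc δ ! ℕ.* t ℕ.^ (suc δ ℕ.+ 1) ℕ.* (m ℕ.+ n))
      * log (fromℕ (m ℕ.+ 1)) ^ (2 ℕ.* d ℕ.+ suc δ ℕ.∸ 1) ≈ zBound k d (suc δ) t m n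
    unfold zero    = refl
    unfold (suc _) = refl

  zarankiewicz-≤-zBound : ∀ {k} → .{{NonZero k}} → ∀ {X : Set a} {Y : Set b} d d′ (P : Fin d → REL X Y r) (N : Fin d′ → REL X Y r) →
    (∀ i → SemiEquation k (P i)) → (∀ j → SemiEquation k (N j)) →
    ∀ t m n → .{{NonZero t}} → .{{NonZero m}} → .{{NonZero n}} →
    fromℕ (zarankiewicz (Conjunction P N) t m n) ≤ zBound k d d′ t m n
  zarankiewicz-≤-zBound {k = suc κ} d d′ P N semiP semiN (suc τ) m@(suc _) n
    -- Taking m + 1, which is at least 2, ensures q ≥ 1 even for m = 1.
    with log₂-floor (suc m) (s≤s (s≤s z≤n))
  ... | q , 1≤q , 2^q≤ , 1+m<2^ = ≤-trans
    (fromℕ-mono (zarankiewicz-≤ {α = coeff (suc κ) d d′ (suc τ) q} (Conjunction P N) (lin-conjunction 1≤q (ℕₚ.≤-trans (ℕₚ.n≤1+n _) 1+m<2^) d d′ P N semiP semiN)))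
    (coeff-≤-zBound (suc κ) d d′ (suc τ) m n q (ℕₚ.≤-trans 2^q≤ (ℕₚ.≤-reflexive (ℕₚ.+-comm 1 m))) 1≤q)

  -- With L = log n and η = L ε split into suc e equal steps σ, the first step lifts
  -- exp L above n and each further step gains a factor σ.
  power-bound : ∀ e ε n → 0# < ε → 2 ℕ.≤ n →
                (log (fromℕ n) * (ε * fromℕ (suc e) ⁻¹)) ^ e * fromℕ n ≤ fromℕ n ^ʳ (1# + ε)
  power-bound e ε n (0≤ε , 0≉ε) 2≤n = begin
    σ ^ e * fromℕ n              ≤⟨ steps e ⟩
    exp (L + fromℕ (suc e) * σ)  ≤⟨ exp-mono (+-nonNeg 0≤L (*-nonNeg (fromℕ-nonNeg (suc e)) 0≤σ)) (≤-reflexive total-steps) ⟩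
    exp ((1# + ε) * L)           ∎
    where
    L = log (fromℕ n)
    σ = L * (ε * fromℕ (suc e) ⁻¹)
    half≤L : half ≤ L
    half≤L = ≤-trans (≤-reflexive (sym (+-identityˡ half))) (halves-≤-log 1 n 2≤n)
    0≤L : 0# ≤ L
    0≤L = ≤-trans 0≤half half≤L
    L≉0 : ¬ (L ≈ 0#)
    L≉0 L≈0 = 1≰0 (begin
      1#           ≈⟨ half+half ⟨
      half + half  ≤⟨ +-mono-≤ half≤L half≤L ⟩
      L + L        ≈⟨ +-cong L≈0 L≈0 ⟩
      0# + 0#      ≈⟨ +-identityʳ 0# ⟩
      0#           ∎)
    0≤e⁻¹ : 0# ≤ fromℕ (suc e) ⁻¹
    0≤e⁻¹ = ⁻¹-nonNeg (fromℕ-nonNeg (suc e)) (fromℕ≉0 (suc e))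
    0≤σ : 0# ≤ σ
    0≤σ = *-nonNeg 0≤L (*-nonNeg 0≤ε 0≤e⁻¹)
    σ≉0 : ¬ (0# ≈ σ)
    σ≉0 0≈σ = *-≉0 L≉0 (*-≉0 (λ ε≈0 → 0≉ε (sym ε≈0)) (⁻¹-≉0 (fromℕ≉0 (suc e)))) (sym 0≈σ)
    1≤n : 1# ≤ fromℕ n
    1≤n = ≤-trans (≤-reflexive (sym (+-identityʳ 1#))) (fromℕ-mono (ℕₚ.≤-trans (s≤s z≤n) 2≤n))
    total-steps : L + fromℕ (suc e) * σ ≈ (1# + ε) * L
    total-steps = trans
      (solve 4 (λ l s ε i → l :+ s :* (l :* (ε :* i)) := l :+ l :* ε :* (s :* i)) refl L (fromℕ (suc e)) ε (fromℕ (suc e) ⁻¹))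
      (trans (+-congˡ (trans (*-congˡ (⁻¹-inverse (fromℕ≉0 (suc e)))) (*-identityʳ _)))
        (solve 2 (λ l ε → l :+ l :* ε := (con 1 :+ ε) :* l) refl L ε))
    steps : ∀ i → σ ^ i * fromℕ n ≤ exp (L + fromℕ (suc i) * σ)
    steps zero = begin
      1# * fromℕ n           ≈⟨ *-identityˡ _ ⟩
      fromℕ n                ≤⟨ beyond-log 1≤n (0≤σ , σ≉0) ⟩
      exp (L + σ)            ≤⟨ exp-mono (+-nonNeg 0≤L 0≤σ) (≤-reflexive (solve 2 (λ l s → l :+ s := l :+ (con 1 :+ con 0) :* s) refl L σ)) ⟩
      exp (L + fromℕ 1 * σ)  ∎
    steps (suc i) = begin
      σ * σ ^ i * fromℕ n                    ≈⟨ *-assoc _ _ _ ⟩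
      σ * (σ ^ i * fromℕ n)                  ≤⟨ *-monoˡ-≤ 0≤σ (steps i) ⟩
      σ * exp (L + fromℕ (suc i) * σ)        ≤⟨ exp-+ 0≤M 0≤σ ⟩
      exp (L + fromℕ (suc i) * σ + σ)        ≤⟨ exp-mono (+-nonNeg 0≤M 0≤σ) (≤-reflexive
        (solve 3 (λ l m s → l :+ m :* s :+ s := l :+ (con 1 :+ m) :* s) refl L (fromℕ (suc i)) σ)) ⟩
      exp (L + fromℕ (suc (suc i)) * σ)      ∎
      where
      0≤M : 0# ≤ L + fromℕ (suc i) * σ
      0≤M = +-nonNeg 0≤L (*-nonNeg (fromℕ-nonNeg (suc i)) 0≤σ)

  -- With ρ = ε / (e + 1) and L = log n, the binary logarithm is at most 4 L = (4 / ρ) (L ρ). Its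
  -- e-th power times n is then the left side of `power-bound` up to a constant.
  polylinear⇒almost-linear : ∀ {R : REL X Y r} → (∀ τ → PolyLin (suc τ) R) → AlmostLinearZarankiewiczBounds R
  polylinear⇒almost-linear {R = R} poly (suc τ) ε 0<ε with poly τ
  ... | C₀ , e , lin = C , bound
    where
    ρ = ε * fromℕ (suc e) ⁻¹
    0≤ε = proj₁ 0<ε
    ρ≉0 : ¬ (ρ ≈ 0#)
    ρ≉0 = *-≉0 (λ ε≈0 → proj₂ 0<ε (sym ε≈0)) (⁻¹-≉0 (fromℕ≉0 (suc e)))
    0≤ρ : 0# ≤ ρ
    0≤ρ = *-nonNeg 0≤ε (⁻¹-nonNeg (fromℕ-nonNeg (suc e)) (fromℕ≉0 (suc e)))
    -- The factor 2 comes from m + n with m = n.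
    K = C₀ ℕ.* 2
    C₁ = fromℕ K * (fromℕ 4 * ρ ⁻¹) ^ e
    -- The summand for `K` covers n = 1, where `power-bound` with its assumption 2 ≤ n does not
    -- apply.
    C = C₁ + fromℕ K
    0≤C₁ : 0# ≤ C₁
    0≤C₁ = *-nonNeg (fromℕ-nonNeg K) (^-nonNeg e (*-nonNeg (fromℕ-nonNeg 4) (⁻¹-nonNeg 0≤ρ ρ≉0)))
    count : ∀ n q → n ℕ.< 2 ℕ.^ suc (suc q) → zarankiewicz R (suc τ) n n ℕ.≤ K ℕ.* (suc q ℕ.^ e ℕ.* n)
    count n q n<2^ = ℕₚ.≤-trans (zarankiewicz-≤ {α = C₀ ℕ.* suc q ℕ.^ e} R (lin (s≤s z≤n) n<2^)) (ℕₚ.≤-reflexive (rearrange C₀ (suc q ℕ.^ e) n))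
      where
      rearrange : ∀ c p n → c ℕ.* p ℕ.* (n ℕ.+ n) ≡ c ℕ.* 2 ℕ.* (p ℕ.* n)
      rearrange = solve-∀
    large : ∀ n → 2 ℕ.≤ n → fromℕ (zarankiewicz R (suc τ) n n) ≤ C * fromℕ n ^ʳ (1# + ε)
    large n 2≤n with log₂-floor n 2≤n
    ... | q , 1≤q , lower , upper = begin
      fromℕ (zarankiewicz R (suc τ) n n)
        ≤⟨ fromℕ-mono (count n q (ℕₚ.≤-trans upper (ℕₚ.^-monoʳ-≤ 2 (ℕₚ.n≤1+n (suc q))))) ⟩
      fromℕ (K ℕ.* (suc q ℕ.^ e ℕ.* n))
        ≈⟨ trans (fromℕ-* K _) (*-congˡ (trans (fromℕ-* (suc q ℕ.^ e) n) (*-congʳ (fromℕ-^ (suc q) e)))) ⟩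
      fromℕ K * (fromℕ (suc q) ^ e * fromℕ n)
        ≤⟨ *-monoˡ-≤ (fromℕ-nonNeg K) (*-monoʳ-≤ (fromℕ-nonNeg n) (^-mono e (fromℕ-nonNeg (suc q)) q≤)) ⟩
      fromℕ K * ((fromℕ 4 * ρ ⁻¹ * (L * ρ)) ^ e * fromℕ n)
        ≈⟨ *-congˡ (*-congʳ (^-distrib-* (fromℕ 4 * ρ ⁻¹) (L * ρ) e)) ⟩
      fromℕ K * ((fromℕ 4 * ρ ⁻¹) ^ e * (L * ρ) ^ e * fromℕ n)
        ≈⟨ solve 4 (λ k a b c → k :* (a :* b :* c) := k :* a :* (b :* c)) refl (fromℕ K) ((fromℕ 4 * ρ ⁻¹) ^ e) ((L * ρ) ^ e) (fromℕ n) ⟩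
      C₁ * ((L * ρ) ^ e * fromℕ n)
        ≤⟨ *-monoˡ-≤ 0≤C₁ (power-bound e ε n 0<ε 2≤n) ⟩
      C₁ * fromℕ n ^ʳ (1# + ε)
        ≤⟨ *-monoʳ-≤ (≤-trans 0≤1 (1≤exp (*-nonNeg (+-nonNeg 0≤1 0≤ε) 0≤L))) (x≤x+y (fromℕ-nonNeg K)) ⟩
      C * fromℕ n ^ʳ (1# + ε) ∎
      where
      L = log (fromℕ n)
      0≤L : 0# ≤ L
      0≤L = ≤-trans (halves-nonNeg q) (halves-≤-log q n lower)
      q≤ : fromℕ (suc q) ≤ fromℕ 4 * ρ ⁻¹ * (L * ρ)
      q≤ = begin
        fromℕ (suc q)              ≤⟨ fromℕ-mono (ℕₚ.+-monoˡ-≤ q 1≤q) ⟩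
        fromℕ (q ℕ.+ q)            ≈⟨ fromℕ-+ q q ⟩
        fromℕ q + fromℕ q          ≤⟨ +-mono-≤ (fromℕ-≤-2log q n lower) (fromℕ-≤-2log q n lower) ⟩
        fromℕ 2 * L + fromℕ 2 * L  ≈⟨ solve 1 (λ l → (con 1 :+ (con 1 :+ con 0)) :* l :+ (con 1 :+ (con 1 :+ con 0)) :* l
                                         := (con 1 :+ (con 1 :+ (con 1 :+ (con 1 :+ con 0)))) :* l) refl L ⟩
        fromℕ 4 * L                ≈⟨ *-inverseʳ (fromℕ 4 * L) ρ≉0 ⟨
        fromℕ 4 * L * ρ * ρ ⁻¹     ≈⟨ solve 4 (λ f l r i → f :* l :* r :* i := f :* i :* (l :* r)) refl (fromℕ 4) L ρ (ρ ⁻¹) ⟩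
        fromℕ 4 * ρ ⁻¹ * (L * ρ)   ∎
    bound : ∀ n → .{{NonZero n}} → fromℕ (zarankiewicz R (suc τ) n n) ≤ C * fromℕ n ^ʳ (1# + ε)
    bound (suc (suc n)) = large (suc (suc n)) (s≤s (s≤s z≤n))
    bound (suc zero) = begin
      fromℕ (zarankiewicz R (suc τ) 1 1)   ≤⟨ fromℕ-mono (count 1 0 (s≤s (s≤s z≤n))) ⟩
      fromℕ (K ℕ.* (1 ℕ.^ e ℕ.* 1))        ≈⟨ ×-congˡ (≡.trans (≡.cong (λ p → K ℕ.* (p ℕ.* 1)) (ℕₚ.^-zeroˡ e)) (ℕₚ.*-identityʳ K)) ⟩
      fromℕ K                              ≤⟨ x≤y+x 0≤C₁ ⟩
      C                                    ≈⟨ *-identityʳ C ⟨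
      C * 1#                               ≤⟨ *-monoˡ-≤ (+-nonNeg 0≤C₁ (fromℕ-nonNeg K)) (1≤exp (*-nonNeg (+-nonNeg 0≤1 0≤ε) (halves-≤-log 0 1 ℕₚ.≤-refl))) ⟩
      C * fromℕ 1 ^ʳ (1# + ε)              ∎

-- Finite subsets with few sums of products

length-cartesianProductWith : ∀ {a b c} {A : Set a} {B : Set b} {C : Set c} (f : A → B → C) xs ys →
  length (cartesianProductWith f xs ys) ≡ length xs ℕ.* length ys
length-cartesianProductWith f []       ys = ≡.refl
length-cartesianProductWith f (x ∷ xs) ys = ≡.trans (length-++ (map (f x) ys))
  (≡.cong₂ ℕ._+_ (length-map (f x) ys) (length-cartesianProductWith f xs ys))

module FiniteSubsets (em : ∀ {ℓ} → ExcludedMiddle ℓ) {c e : Level} (F : CommutativeRing c e) where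
  open Combinatorics em using (∑; ∑-mono; ∑-bounded; ∑-swap; ∑-member; length≡∑1; ⟨_⟩; ⟨⟩≡0; ⟨⟩≡1; ⟨⟩≤1; by-cases; n<2^n)
  open CommutativeRing F hiding (zero)
  open import Data.List.Base using (_++_)
  open import Algebra.Definitions.RawSemiring (Semiring.rawSemiring semiring) using () renaming (_×_ to _·_)
  open import Algebra.Properties.Semiring.Mult semiring using (×1-homo-*)
  open import Algebra.Properties.Monoid.Mult +-monoid using (×-homo-+; ×-congˡ)
  open import Algebra.Properties.Ring ring using (-1*x≈-x)
  open import Algebra.Solver.Ring.NaturalCoefficients.Default commutativeSemiring
    using (solve; _:=_; _:+_; _:*_; con)
  import Relation.Binary.Reasoning.Setoid setoid as ≈-Reasoning

  infix 4 _∈≈_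
  _∈≈_ : Carrier → List Carrier → Set _
  x ∈≈ xs = Any (x ≈_) xs

  ∈≈-resp : ∀ {x y xs} → x ≈ y → x ∈≈ xs → y ∈≈ xs
  ∈≈-resp x≈y = Any.map (trans (sym x≈y))

  ∈⇒∈≈ : ∀ {x xs} → x ∈ xs → x ∈≈ xs
  ∈⇒∈≈ x∈ = lose x∈ refl

  Distinct : List Carrier → Set _
  Distinct = AllPairs (λ x y → ¬ (x ≈ y))

  nub : List Carrier → List Carrier
  nub []       = []
  nub (x ∷ xs) with em {P = x ∈≈ nub xs}
  ... | yes _ = nub xs
  ... | no  _ = x ∷ nub xs

  nub-distinct : ∀ xs → Distinct (nub xs)
  nub-distinct []       = []
  nub-distinct (x ∷ xs) with em {P = x ∈≈ nub xs}
  ... | yes _ = nub-distinct xs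
  ... | no x∉ = All.tabulate (λ y∈ x≈y → x∉ (lose y∈ x≈y)) ∷ nub-distinct xs

  nub⁺ : ∀ {x} xs → x ∈≈ xs → x ∈≈ nub xs
  nub⁺ (y ∷ xs) x∈ with em {P = y ∈≈ nub xs}
  nub⁺ (y ∷ xs) (here x≈y) | yes y∈ = ∈≈-resp (sym x≈y) y∈
  nub⁺ (y ∷ xs) (there x∈) | yes y∈ = nub⁺ xs x∈
  nub⁺ (y ∷ xs) (here x≈y) | no y∉  = here x≈y
  nub⁺ (y ∷ xs) (there x∈) | no y∉  = there (nub⁺ xs x∈)

  nub⁻ : ∀ {x} xs → x ∈≈ nub xs → x ∈≈ xs
  nub⁻ (y ∷ xs) x∈ with em {P = y ∈≈ nub xs}
  nub⁻ (y ∷ xs) x∈         | yes _ = there (nub⁻ xs x∈)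
  nub⁻ (y ∷ xs) (here x≈y) | no _  = here x≈y
  nub⁻ (y ∷ xs) (there x∈) | no _  = there (nub⁻ xs x∈)

  length-nub : ∀ xs → length (nub xs) ℕ.≤ length xs
  length-nub []       = z≤n
  length-nub (x ∷ xs) with em {P = x ∈≈ nub xs}
  ... | yes _ = ℕₚ.m≤n⇒m≤1+n (length-nub xs)
  ... | no  _ = s≤s (length-nub xs)

  -- Double counting of pairs x ≈ y: each x has a partner, and distinctness leaves each y at most
  -- one.
  distinct-length : ∀ xs ys → Distinct xs → (∀ {x} → x ∈ xs → x ∈≈ ys) → length xs ℕ.≤ length ys
  distinct-length xs ys dist sub = begin
    length xs                              ≡⟨ length≡∑1 xs ⟩
    (∑[ _ ∈ xs ] 1)                        ≤⟨ ∑-mono xs (λ {x} x∈ → found (sub x∈)) ⟩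
    (∑[ x ∈ xs ] ∑[ y ∈ ys ] ⟨ x ≈ y ⟩)    ≡⟨ ∑-swap xs ys (λ x y → ⟨ x ≈ y ⟩) ⟩
    (∑[ y ∈ ys ] ∑[ x ∈ xs ] ⟨ x ≈ y ⟩)    ≤⟨ ∑-bounded ys (λ {y} _ → once y xs dist) ⟩
    length ys ℕ.* 1                        ≡⟨ ℕₚ.*-identityʳ (length ys) ⟩
    length ys                              ∎
    where
    open ℕₚ.≤-Reasoning
    found : ∀ {x} → x ∈≈ ys → 1 ℕ.≤ (∑[ y ∈ ys ] ⟨ x ≈ y ⟩)
    found {x} x∈ with find x∈
    ... | y , y∈ , x≈y = ℕₚ.≤-trans (ℕₚ.≤-reflexive (≡.sym (⟨⟩≡1 x≈y))) (∑-member ys (λ y → ⟨ x ≈ y ⟩) y∈)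
    once : ∀ y xs → Distinct xs → (∑[ x ∈ xs ] ⟨ x ≈ y ⟩) ℕ.≤ 1
    once y []       []         = z≤n
    once y (x ∷ xs) (x∉ ∷ dist) = by-cases (x ≈ y)
      (λ x≈y → ℕₚ.≤-trans (ℕₚ.+-mono-≤ (⟨⟩≤1 (x ≈ y)) (ℕₚ.≤-trans
          (∑-bounded xs (λ z∈ → ℕₚ.≤-reflexive (⟨⟩≡0 (λ z≈y → All.lookup x∉ z∈ (trans x≈y (sym z≈y))))))
          (ℕₚ.≤-reflexive (ℕₚ.*-zeroʳ (length xs))))) (ℕₚ.≤-reflexive (ℕₚ.+-identityʳ 1)))
      (λ x≉y → ℕₚ.≤-trans (ℕₚ.≤-reflexive (≡.cong (ℕ._+ _) (⟨⟩≡0 x≉y))) (once y xs dist))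

  -- Finite sets for which the points U × W and the lines y = a x + b with (a , b) ∈ U × V
  -- have |U|² |V| incidences.
  record Grid (γ δ n : ℕ) : Set (c ⊔ e) where
    field
      {U V W}    : List Carrier
      U-distinct : Distinct U
      V-distinct : Distinct V
      W-distinct : Distinct W
      closed     : ∀ {a x b} → a ∈ U → x ∈ U → b ∈ V → a * x + b ∈≈ W
      n≤U        : n ℕ.≤ length U
      V-nonempty : 1 ℕ.≤ length V
      W≤V        : length W ℕ.≤ γ ℕ.* length V
      W≤U        : length W ℕ.≤ length U ℕ.^ δ

  Grids : Set (c ⊔ e)
  Grids = ∃[ γ ] ∃[ δ ] ∀ n → Grid γ δ n

  fromℕ : ℕ → Carrier
  fromℕ n = n · 1#

  private
    cancel : ∀ x y → x + y + - y ≈ x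
    cancel x y = trans (+-assoc x y (- y)) (trans (+-congˡ (-‿inverseʳ y)) (+-identityʳ x))

    fromℕ-∸ : ∀ {i j} → i ℕ.≤ j → fromℕ i ≈ fromℕ j → fromℕ (j ℕ.∸ i) ≈ 0#
    fromℕ-∸ {i} {j} i≤j i≈j = begin
      fromℕ (j ℕ.∸ i)                          ≈⟨ cancel _ (fromℕ i) ⟨
      fromℕ (j ℕ.∸ i) + fromℕ i + - fromℕ i    ≈⟨ +-congʳ (×-homo-+ 1# (j ℕ.∸ i) i) ⟨
      fromℕ (j ℕ.∸ i ℕ.+ i) + - fromℕ i        ≈⟨ +-congʳ (×-congˡ (ℕₚ.m∸n+n≡m i≤j)) ⟩
      fromℕ j + - fromℕ i                      ≈⟨ +-congʳ i≈j ⟨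
      fromℕ i + - fromℕ i                      ≈⟨ -‿inverseʳ (fromℕ i) ⟩
      0#                                       ∎
      where open ≈-Reasoning

  module CharacteristicZero (char0 : ∀ n → ¬ (fromℕ (suc n) ≈ 0#)) where

    fromℕ-≉ : ∀ {i j} → i ℕ.< j → ¬ (fromℕ i ≈ fromℕ j)
    fromℕ-≉ {i} {j} i<j i≈j with j ℕ.∸ i in eq | fromℕ-∸ (ℕₚ.<⇒≤ i<j) i≈j
    ... | zero  | _    = contradiction (ℕₚ.m∸n≡0⇒m≤n eq) (ℕₚ.<⇒≱ i<j)
    ... | suc k | k≈0 = char0 k k≈0

    fromℕ-injective : ∀ {i j} → i ≢ j → ¬ (fromℕ i ≈ fromℕ j)
    fromℕ-injective {i} {j} i≢j with ℕₚ.<-cmp i j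
    ... | tri< i<j _ _ = fromℕ-≉ i<j
    ... | tri≈ _ i≡j _ = contradiction i≡j i≢j
    ... | tri> _ _ j<i = fromℕ-≉ j<i ∘ sym

    initial : ℕ → List Carrier
    initial n = map fromℕ (upTo n)

    initial-distinct : ∀ n → Distinct (initial n)
    initial-distinct n = AllPairsₚ.map⁺ (AllPairs.map fromℕ-injective (Uniqueₚ.upTo⁺ n))

    length-initial : ∀ n → length (initial n) ≡ n
    length-initial n = ≡.trans (length-map fromℕ (upTo n)) (length-upTo n)

    -- The sets are the numbers below N, N² and 2 N². Starting at N = 2 makes 2 N² at most N³, which
    -- gives the exponent 3.
    grids : Grids
    grids = 2 , 3 , λ n → let N = 2 ℕ.+ n in record
      { U = initial N ; V = initial (N ℕ.* N) ; W = initial (2 ℕ.* (N ℕ.* N))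
      ; U-distinct = initial-distinct N
      ; V-distinct = initial-distinct (N ℕ.* N)
      ; W-distinct = initial-distinct (2 ℕ.* (N ℕ.* N))
      ; closed = closed N
      ; n≤U = ℕₚ.≤-trans (ℕₚ.m≤n+m n 2) (ℕₚ.≤-reflexive (≡.sym (length-initial N)))
      ; V-nonempty = ℕₚ.≤-trans (s≤s z≤n) (ℕₚ.≤-reflexive (≡.sym (length-initial (N ℕ.* N))))
      ; W≤V = ℕₚ.≤-reflexive (≡.trans (length-initial (2 ℕ.* (N ℕ.* N))) (≡.cong (2 ℕ.*_) (≡.sym (length-initial (N ℕ.* N)))))
      ; W≤U = ≡.subst₂ ℕ._≤_ (≡.sym (length-initial (2 ℕ.* (N ℕ.* N)))) (≡.cong (ℕ._^ 3) (≡.sym (length-initial N)))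
                (ℕₚ.≤-trans (ℕₚ.*-monoˡ-≤ (N ℕ.* N) (ℕₚ.m≤m+n 2 n)) (ℕₚ.≤-reflexive (cube N)))
      }
      where
      cube : ∀ N → N ℕ.* (N ℕ.* N) ≡ N ℕ.* (N ℕ.* (N ℕ.* 1))
      cube = solve-∀
      closed : ∀ N {a x b} → a ∈ initial N → x ∈ initial N → b ∈ initial (N ℕ.* N) →
               a * x + b ∈≈ initial (2 ℕ.* (N ℕ.* N))
      closed N a∈ x∈ b∈ with ∈-map⁻ fromℕ a∈ | ∈-map⁻ fromℕ x∈ | ∈-map⁻ fromℕ b∈
      ... | i , i∈ , ≡.refl | j , j∈ , ≡.refl | k , k∈ , ≡.refl =
        lose (∈-map⁺ fromℕ (∈-upTo⁺ {i = i ℕ.* j ℕ.+ k} bound))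
             (trans (+-congʳ (sym (×1-homo-* i j))) (sym (×-homo-+ 1# (i ℕ.* j) k)))
        where
        bound : i ℕ.* j ℕ.+ k ℕ.< 2 ℕ.* (N ℕ.* N)
        bound = ℕₚ.≤-trans (ℕₚ.+-mono-≤-< (ℕₚ.*-mono-≤ (ℕₚ.<⇒≤ (∈-upTo⁻ i∈)) (ℕₚ.<⇒≤ (∈-upTo⁻ j∈))) (∈-upTo⁻ k∈))
          (ℕₚ.≤-reflexive (≡.cong (N ℕ.* N ℕ.+_) (≡.sym (ℕₚ.+-identityʳ (N ℕ.* N)))))

  -- Finite subrings in positive characteristic

  record Subring (R : List Carrier) : Set (c ⊔ e) where
    field
      distinct : Distinct R
      0∈       : 0# ∈≈ R
      1∈       : 1# ∈≈ R
      -- Together with the products this gives closure under negation.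
      -1∈      : - 1# ∈≈ R
      +-closed : ∀ {x y} → x ∈≈ R → y ∈≈ R → x + y ∈≈ R
      *-closed : ∀ {x y} → x ∈≈ R → y ∈≈ R → x * y ∈≈ R

  -- The image of ℕ, which is periodic with period p. Any positive p that annihilates 1 will do, and
  -- p - 1 represents -1.
  prime-subring : ∀ p → .{{NonZero p}} → fromℕ p ≈ 0# → ∃ Subring
  prime-subring p@(suc p-1) p≈0 = R , record
    { distinct = nub-distinct _
    ; 0∈ = contains 0
    ; 1∈ = ∈≈-resp (+-identityʳ 1#) (contains 1)
    ; -1∈ = ∈≈-resp -1≈ (contains p-1)
    ; +-closed = λ x∈ y∈ → let (i , x≈) = values x∈ ; (j , y≈) = values y∈ in
        ∈≈-resp (trans (×-homo-+ 1# i j) (sym (+-cong x≈ y≈))) (contains (i ℕ.+ j))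
    ; *-closed = λ x∈ y∈ → let (i , x≈) = values x∈ ; (j , y≈) = values y∈ in
        ∈≈-resp (trans (×1-homo-* i j) (sym (*-cong x≈ y≈))) (contains (i ℕ.* j))
    }
    where
    R = nub (map fromℕ (upTo p))
    open ≈-Reasoning
    reduce : ∀ n → fromℕ n ≈ fromℕ (n % p)
    reduce n = begin
      fromℕ n                                  ≈⟨ ×-congˡ (m≡m%n+[m/n]*n n p) ⟩
      fromℕ (n % p ℕ.+ n / p ℕ.* p)            ≈⟨ ×-homo-+ 1# (n % p) (n / p ℕ.* p) ⟩
      fromℕ (n % p) + fromℕ (n / p ℕ.* p)      ≈⟨ +-congˡ (×1-homo-* (n / p) p) ⟩
      fromℕ (n % p) + fromℕ (n / p) * fromℕ p  ≈⟨ +-congˡ (trans (*-congˡ p≈0) (zeroʳ _)) ⟩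
      fromℕ (n % p) + 0#                       ≈⟨ +-identityʳ _ ⟩
      fromℕ (n % p)                            ∎
    contains : ∀ n → fromℕ n ∈≈ R
    contains n = ∈≈-resp (sym (reduce n)) (nub⁺ _ (∈⇒∈≈ (∈-map⁺ fromℕ (∈-upTo⁺ (m%n<n n p)))))
    values : ∀ {x} → x ∈≈ R → ∃[ i ] x ≈ fromℕ i
    values x∈ with find (nub⁻ (map fromℕ (upTo p)) x∈)
    ... | y , y∈ , x≈y with ∈-map⁻ fromℕ {xs = upTo p} y∈
    ... | i , _ , ≡.refl = i , x≈y
    -1≈ : fromℕ p-1 ≈ - 1#
    -1≈ = begin
      fromℕ p-1                  ≈⟨ cancel _ 1# ⟨
      fromℕ p-1 + 1# + - 1#      ≈⟨ +-congʳ (+-comm _ 1#) ⟩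
      fromℕ p + - 1#             ≈⟨ +-congʳ p≈0 ⟩
      0# + - 1#                  ≈⟨ +-identityˡ _ ⟩
      - 1#                       ∎

  subring-grid : ∀ {n R} → Subring R → n ℕ.≤ length R → Grid 1 1 n
  subring-grid {R = R} sub n≤ = record
    { U-distinct = distinct ; V-distinct = distinct ; W-distinct = distinct
    ; closed = λ a∈ x∈ b∈ → +-closed (*-closed (∈⇒∈≈ a∈) (∈⇒∈≈ x∈)) (∈⇒∈≈ b∈)
    ; n≤U = n≤
    ; V-nonempty = nonempty 0∈
    ; W≤V = ℕₚ.≤-reflexive (≡.sym (ℕₚ.+-identityʳ (length R)))
    ; W≤U = ℕₚ.≤-reflexive (≡.sym (ℕₚ.*-identityʳ (length R)))
    }
    where
    open Subring sub
    nonempty : ∀ {x xs} → x ∈≈ xs → 1 ℕ.≤ length xs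
    nonempty (here _)  = s≤s z≤n
    nonempty (there _) = s≤s z≤n

  -- The recursion measure n is the amount by which the length can still grow.
  maximal-subring : ∀ n R → Subring R → (∀ R′ → Subring R′ → length R′ ℕ.≤ length R ℕ.+ n) →
                    ∃[ R ] Subring R × (∀ R′ → Subring R′ → length R′ ℕ.≤ length R)
  maximal-subring zero    R sub bound = R , sub , λ R′ sub′ → ℕₚ.≤-trans (bound R′ sub′) (ℕₚ.≤-reflexive (ℕₚ.+-identityʳ (length R)))
  maximal-subring (suc n) R sub bound with em {P = ∃[ R′ ] Subring R′ × length R ℕ.< length R′}
  ... | yes (R′ , sub′ , larger) = maximal-subring n R′ sub′ λ R″ sub″ → ℕₚ.≤-trans (bound R″ sub″)
    (ℕₚ.≤-trans (ℕₚ.≤-reflexive (ℕₚ.+-suc (length R) n)) (ℕₚ.+-monoˡ-≤ n larger))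
  ... | no none = R , sub , λ R′ sub′ → ℕₚ.≮⇒≥ (λ larger → none (R′ , sub′ , larger))

  -- Polynomials of degree < N in an element t outside a maximal finite subring R: their
  -- number at least doubles with N, since otherwise they would form a larger finite subring.
  module Polynomials (1≉0 : ¬ (1# ≈ 0#)) {R : List Carrier} (sub : Subring R) (maximal : ∀ R′ → Subring R′ → length R′ ℕ.≤ length R)
                     {t : Carrier} (t∉R : ¬ (t ∈≈ R)) where
    open Subring sub

    -- Values at t of polynomials in Horner form with coefficients in R; different coefficients may
    -- give the same value.
    Poly : ℕ → Carrier → Set (c ⊔ e)
    Poly zero    x = Level.Lift c (x ≈ 0#)
    Poly (suc N) x = ∃[ r ] ∃[ s ] r ∈≈ R × Poly N s × x ≈ r + t * s

    poly-resp : ∀ N {x y} → x ≈ y → Poly N x → Poly N y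
    poly-resp zero    x≈y (Level.lift x≈0)      = Level.lift (trans (sym x≈y) x≈0)
    poly-resp (suc N) x≈y (r , s , r∈ , ps , x≈) = r , s , r∈ , ps , trans (sym x≈y) x≈

    poly-0 : ∀ N → Poly N 0#
    poly-0 zero    = Level.lift refl
    poly-0 (suc N) = 0# , 0# , 0∈ , poly-0 N , solve 1 (λ t → con 0 := con 0 :+ t :* con 0) refl t

    poly-+ : ∀ N {x y} → Poly N x → Poly N y → Poly N (x + y)
    poly-+ zero (Level.lift x≈0) (Level.lift y≈0) = Level.lift (trans (+-cong x≈0 y≈0) (+-identityʳ 0#))
    poly-+ (suc N) (r , s , r∈ , ps , x≈) (r′ , s′ , r′∈ , ps′ , y≈) =
      r + r′ , s + s′ , +-closed r∈ r′∈ , poly-+ N ps ps′ ,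
      trans (+-cong x≈ y≈) (solve 5 (λ r s r′ s′ t → (r :+ t :* s) :+ (r′ :+ t :* s′) := (r :+ r′) :+ t :* (s :+ s′)) refl r s r′ s′ t)

    poly-scale : ∀ N {r x} → r ∈≈ R → Poly N x → Poly N (r * x)
    poly-scale zero {r} r∈ (Level.lift x≈0) = Level.lift (trans (*-congˡ x≈0) (zeroʳ r))
    poly-scale (suc N) {r} r∈ (r′ , s , r′∈ , ps , x≈) = r * r′ , r * s , *-closed r∈ r′∈ , poly-scale N r∈ ps ,
      trans (*-congˡ x≈) (solve 4 (λ r r′ s t → r :* (r′ :+ t :* s) := r :* r′ :+ t :* (r :* s)) refl r r′ s t)

    poly-suc : ∀ N {x} → Poly N x → Poly (suc N) x
    poly-suc zero    (Level.lift x≈0) = poly-resp 1 (sym x≈0) (poly-0 1)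
    poly-suc (suc N) (r , s , r∈ , ps , x≈) = r , s , r∈ , poly-suc N ps , x≈

    poly-shift : ∀ N {x} → Poly N x → Poly (suc N) (t * x)
    poly-shift N {x} px = 0# , x , 0∈ , px , sym (+-identityˡ _)

    poly-raise : ∀ M {N x} → Poly N x → Poly (M ℕ.+ N) x
    poly-raise zero    px = px
    poly-raise (suc M) px = poly-suc _ (poly-raise M px)

    poly-* : ∀ M {N x y} → Poly M x → Poly N y → Poly (M ℕ.+ N) (x * y)
    poly-* zero {N} {x} {y} (Level.lift x≈0) py = poly-resp N (sym (trans (*-congʳ x≈0) (zeroˡ y))) (poly-0 N)
    poly-* (suc M) {N} {x} {y} (r , s , r∈ , ps , x≈) py = poly-resp (suc M ℕ.+ N)
      (trans (solve 4 (λ r s t y → r :* y :+ t :* (s :* y) := (r :+ t :* s) :* y) refl r s t y) (*-congʳ (sym x≈)))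
      (poly-+ (suc M ℕ.+ N) (poly-raise (suc M) (poly-scale N r∈ py)) (poly-shift (M ℕ.+ N) (poly-* M ps py)))

    poly-const : ∀ N {r} → r ∈≈ R → Poly (suc N) r
    poly-const N {r} r∈ = r , 0# , r∈ , poly-0 N , solve 2 (λ r t → r := r :+ t :* con 0) refl r t

    poly-neg : ∀ N {x} → Poly N x → Poly N (- x)
    poly-neg N px = poly-resp N (-1*x≈-x _) (poly-scale N -1∈ px)

    polys : ℕ → List Carrier
    polys zero    = 0# ∷ []
    polys (suc N) = nub (cartesianProductWith (λ r s → r + t * s) R (polys N))

    polys-distinct : ∀ N → Distinct (polys N)
    polys-distinct zero    = [] ∷ []
    polys-distinct (suc N) = nub-distinct (cartesianProductWith (λ r s → r + t * s) R (polys N))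

    polys⁺ : ∀ N {x} → Poly N x → x ∈≈ polys N
    polys⁺ zero    (Level.lift x≈0) = here x≈0
    polys⁺ (suc N) (r , s , r∈ , ps , x≈) with find r∈ | find (polys⁺ N ps)
    ... | r′ , r′∈ , r≈ | s′ , s′∈ , s≈ = nub⁺ (cartesianProductWith (λ r s → r + t * s) R (polys N)) (lose (∈-cartesianProductWith⁺ (λ r s → r + t * s) r′∈ s′∈)
                                                 (trans x≈ (+-cong r≈ (*-congˡ s≈))))

    polys⁻ : ∀ N {x} → x ∈≈ polys N → Poly N x
    polys⁻ zero    (here x≈0) = Level.lift x≈0
    polys⁻ (suc N) x∈ with find (nub⁻ (cartesianProductWith (λ r s → r + t * s) R (polys N)) x∈)
    ... | y , y∈ , x≈y with ∈-cartesianProductWith⁻ (λ r s → r + t * s) R (polys N) y∈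
    ... | r , s , r∈ , s∈ , ≡.refl = r , s , ∈⇒∈≈ r∈ , polys⁻ N (∈⇒∈≈ s∈) , x≈y

    length-polys : ∀ N → length (polys N) ℕ.≤ length R ℕ.^ N
    length-polys zero    = ℕₚ.≤-refl
    length-polys (suc N) = ℕₚ.≤-trans (length-nub (cartesianProductWith (λ r s → r + t * s) R (polys N)))
      (ℕₚ.≤-trans (ℕₚ.≤-reflexive (length-cartesianProductWith (λ r s → r + t * s) R (polys N))) (ℕₚ.*-monoʳ-≤ (length R) (length-polys N)))

    -- In Horner form the inner polynomial can be reduced first, so one stable step brings all
    -- higher degrees down. Products then stay in the set.
    collapse : ∀ N → (∀ {x} → Poly (suc N) x → Poly N x) → ∀ M {x} → Poly (M ℕ.+ N) x → Poly N x
    collapse N stable zero    px = px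
    collapse N stable (suc M) (r , s , r∈ , ps , x≈) = stable (r , s , r∈ , collapse N stable M ps , x≈)

    unstable : ∀ N → ∃[ x ] Poly (suc N) x × ¬ Poly N x
    unstable zero = 1# , poly-const 0 1∈ , λ (Level.lift 1≈0) → 1≉0 1≈0
    unstable (suc N) with em {P = ∃[ x ] Poly (suc (suc N)) x × ¬ Poly (suc N) x}
    ... | yes found = found
    ... | no none = contradiction (maximal (polys (suc N)) subring) (ℕₚ.<⇒≱ larger)
      where
      stable : ∀ {x} → Poly (suc (suc N)) x → Poly (suc N) x
      stable {x} px = by-cases (Poly (suc N) x) id (λ ¬px → contradiction (x , px , ¬px) none)
      subring : Subring (polys (suc N))
      subring = record
        { distinct = polys-distinct (suc N)
        ; 0∈ = polys⁺ (suc N) (poly-0 (suc N))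
        ; 1∈ = polys⁺ (suc N) (poly-const N 1∈)
        ; -1∈ = polys⁺ (suc N) (poly-const N -1∈)
        ; +-closed = λ x∈ y∈ → polys⁺ (suc N) (poly-+ (suc N) (polys⁻ (suc N) x∈) (polys⁻ (suc N) y∈))
        ; *-closed = λ x∈ y∈ → polys⁺ (suc N) (collapse (suc N) stable (suc N) (poly-* (suc N) (polys⁻ (suc N) x∈) (polys⁻ (suc N) y∈)))
        }
      larger : length R ℕ.< length (polys (suc N))
      larger = distinct-length (t ∷ R) (polys (suc N)) (All.tabulate (λ y∈ t≈y → t∉R (lose y∈ t≈y)) ∷ distinct)
        λ { (here ≡.refl) → polys⁺ (suc N) (stable (poly-resp (suc (suc N)) (*-identityʳ t) (poly-shift (suc N) (poly-const N 1∈))))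
          ; (there r∈)    → polys⁺ (suc N) (poly-const N (∈⇒∈≈ r∈)) }

    -- For a value x new at degree N, the translate of the additive group `Poly N` by x is disjoint
    -- from that group, and both lie in `Poly (suc N)`.
    polys-grow : ∀ N → 2 ℕ.^ N ℕ.≤ length (polys N)
    polys-grow zero    = ℕₚ.≤-refl
    polys-grow (suc N) with unstable N
    ... | x , px , ¬px = begin
      2 ℕ.* 2 ℕ.^ N                       ≤⟨ ℕₚ.*-monoʳ-≤ 2 (polys-grow N) ⟩
      2 ℕ.* length (polys N)              ≡⟨ ≡.cong (length (polys N) ℕ.+_) (ℕₚ.+-identityʳ _) ⟩
      length (polys N) ℕ.+ length (polys N) ≡⟨ ≡.cong (ℕ._+ length (polys N)) (length-map (x +_) (polys N)) ⟨
      length shifted ℕ.+ length (polys N)   ≡⟨ length-++ shifted ⟨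
      length (shifted ++ polys N)           ≤⟨ distinct-length (shifted ++ polys N) (polys (suc N)) dist members ⟩
      length (polys (suc N))                ∎
      where
      open ℕₚ.≤-Reasoning
      shifted = map (x +_) (polys N)
      minus : ∀ {s s′} → x + s ≈ s′ → x ≈ s′ + - s
      minus {s} p = trans (sym (cancel x s)) (+-congʳ p)
      dist : Distinct (shifted ++ polys N)
      dist = AllPairsₚ.++⁺
        (AllPairsₚ.map⁺ (AllPairs.map (λ {s} {s′} s≉s′ p → s≉s′ (trans (sym (cancel s x)) (trans
          (+-congʳ (trans (+-comm s x) (trans p (+-comm x s′)))) (cancel s′ x)))) (polys-distinct N)))
        (polys-distinct N)
        (All.tabulate (λ y∈ → All.tabulate (λ z∈ y≈z → apart y∈ z∈ y≈z)))
        where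
        apart : ∀ {y z} → y ∈ shifted → z ∈ polys N → ¬ (y ≈ z)
        apart y∈ z∈ y≈z with ∈-map⁻ (x +_) y∈
        ... | s , s∈ , ≡.refl = ¬px (poly-resp N (sym (minus y≈z))
          (poly-+ N (polys⁻ N (∈⇒∈≈ z∈)) (poly-neg N (polys⁻ N (∈⇒∈≈ s∈)))))
      members : ∀ {y} → y ∈ shifted ++ polys N → y ∈≈ polys (suc N)
      members y∈ with ∈-++⁻ shifted y∈
      ... | inj₂ y∈ = polys⁺ (suc N) (poly-suc N (polys⁻ N (∈⇒∈≈ y∈)))
      ... | inj₁ y∈ with ∈-map⁻ (x +_) y∈
      ... | s , s∈ , ≡.refl = polys⁺ (suc N) (poly-+ (suc N) px (poly-suc N (polys⁻ N (∈⇒∈≈ s∈))))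

    -- U has degrees below N and V = W degrees below 2 N, so products from U fit into V. The
    -- exponent 2 |R| comes from |W| ≤ |R| ^ (2 N) ≤ (2 ^ N) ^ (2 |R|) and 2 ^ N ≤ |U|.
    grids : Grids
    grids = 1 , length R ℕ.* 2 , λ N → record
      { U = polys N ; V = polys (N ℕ.+ N) ; W = polys (N ℕ.+ N)
      ; U-distinct = polys-distinct N
      ; V-distinct = polys-distinct (N ℕ.+ N)
      ; W-distinct = polys-distinct (N ℕ.+ N)
      ; closed = λ a∈ x∈ b∈ → polys⁺ (N ℕ.+ N) (poly-+ (N ℕ.+ N)
          (poly-* N (polys⁻ N (∈⇒∈≈ a∈)) (polys⁻ N (∈⇒∈≈ x∈))) (polys⁻ (N ℕ.+ N) (∈⇒∈≈ b∈)))
      ; n≤U = ℕₚ.≤-trans (ℕₚ.<⇒≤ (n<2^n N)) (polys-grow N)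
      ; V-nonempty = ℕₚ.≤-trans (ℕₚ.m^n>0 2 (N ℕ.+ N)) (polys-grow (N ℕ.+ N))
      ; W≤V = ℕₚ.≤-reflexive (≡.sym (ℕₚ.+-identityʳ _))
      ; W≤U = begin
          length (polys (N ℕ.+ N))               ≤⟨ length-polys (N ℕ.+ N) ⟩
          length R ℕ.^ (N ℕ.+ N)                 ≤⟨ ℕₚ.^-monoˡ-≤ (N ℕ.+ N) (ℕₚ.<⇒≤ (n<2^n (length R))) ⟩
          (2 ℕ.^ length R) ℕ.^ (N ℕ.+ N)         ≡⟨ ℕₚ.^-*-assoc 2 (length R) (N ℕ.+ N) ⟩
          2 ℕ.^ (length R ℕ.* (N ℕ.+ N))         ≡⟨ ≡.cong (2 ℕ.^_) (exponent (length R) N) ⟩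
          2 ℕ.^ (N ℕ.* (length R ℕ.* 2))         ≡⟨ ℕₚ.^-*-assoc 2 N (length R ℕ.* 2) ⟨
          (2 ℕ.^ N) ℕ.^ (length R ℕ.* 2)         ≤⟨ ℕₚ.^-monoˡ-≤ (length R ℕ.* 2) (polys-grow N) ⟩
          length (polys N) ℕ.^ (length R ℕ.* 2)  ∎
      }
      where
      open ℕₚ.≤-Reasoning
      exponent : ∀ r N → r ℕ.* (N ℕ.+ N) ≡ N ℕ.* (r ℕ.* 2)
      exponent = solve-∀

  infinite-field-grids : IsField F → Infinite F → Grids
  infinite-field-grids (1≉0 , _) infinite with em {P = ∃[ n ] fromℕ (suc n) ≈ 0#}
  ... | no char0 = CharacteristicZero.grids (λ n n≈0 → char0 (n , n≈0))
  ... | yes (p-1 , p≈0) with em {P = ∃[ n ] ∀ R → Subring R → length R ℕ.≤ n}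
  ...   | no unbounded = 1 , 1 , λ n → by-cases (∃[ R ] Subring R × n ℕ.≤ length R)
            (λ (R , sub , n≤R) → subring-grid sub n≤R)
            (λ none → contradiction (n , λ R sub → ℕₚ.≮⇒≥ (λ n<R → none (R , sub , ℕₚ.<⇒≤ n<R))) unbounded)
  ...   | yes (n , bound) with prime-subring (suc p-1) p≈0
  ...     | R₀ , sub₀ with maximal-subring n R₀ sub₀ (λ R sub → ℕₚ.≤-trans (bound R sub) (ℕₚ.m≤n+m n (length R₀)))
  ...       | R , sub , maximal with em {P = ∃[ t ] ¬ (t ∈≈ R)}
  ...         | yes (t , t∉R) = Polynomials.grids 1≉0 sub maximal t∉R
  ...         | no all∈R = contradiction (R , λ x → by-cases (x ∈≈ R) id (λ x∉ → contradiction (x , x∉) all∈R)) infinite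

open import Data.Nat.Base using (⌊_/2⌋)
open import Data.Fin.Base using (zero; suc; _↑ˡ_; _↑ʳ_; splitAt)
open import Data.Vec.Base using (_++_; lookup)
open import Data.Vec.Properties using (++-injective; lookup-++ˡ; lookup-++ʳ; lookup-splitAt)

private
  variable
    s ℓ : Level
    L : Language s
    m n : ℕ


-- Renaming of variables in formulas

renTerm  : (Fin m → Fin n) → Term L m → Term L n
renTerms : ∀ {k} → (Fin m → Fin n) → Vec (Term L m) k → Vec (Term L n) k
renTerm  f (var i)    = var (f i)
renTerm  f (fun g ts) = fun g (renTerms f ts)
renTerms f []         = []
renTerms f (t ∷ ts)   = renTerm f t ∷ renTerms f ts

lift : (Fin m → Fin n) → Fin (suc m) → Fin (suc n)
lift f zero    = zero
lift f (suc i) = suc (f i)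

rename : (Fin m → Fin n) → Formula L m → Formula L n
rename f (equal t u)   = equal (renTerm f t) (renTerm f u)
rename f (rel R ts)    = rel R (renTerms f ts)
rename f false         = false
rename f (and φ ψ)     = and (rename f φ) (rename f ψ)
rename f (or φ ψ)      = or (rename f φ) (rename f ψ)
rename f (implies φ ψ) = implies (rename f φ) (rename f ψ)
rename f (all φ)       = all (rename (lift f) φ)
rename f (exists φ)    = exists (rename (lift f) φ)

existsⁿ : ∀ k → Formula L (k ℕ.+ n) → Formula L n
existsⁿ zero    φ = φ
existsⁿ (suc k) φ = existsⁿ k (exists φ)

module _ (M : Structure L ℓ) where
  open Structure M using (Carrier)

  -- As a record rather than a function type, it lets unification recover the renaming and both
  -- assignments.
  record Agree (f : Fin m → Fin n) (ρ : Vec Carrier m) (σ : Vec Carrier n) : Set ℓ where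
    constructor agreement
    field at : ∀ i → lookup σ (f i) ≡ lookup ρ i
  open Agree

  eval-renTerm  : ∀ {f : Fin m → Fin n} {ρ σ} → Agree f ρ σ → ∀ t → evalTerm M σ (renTerm f t) ≡ evalTerm M ρ t
  eval-renTerms : ∀ {f : Fin m → Fin n} {ρ σ} → Agree f ρ σ → ∀ {k} (ts : Vec _ k) →
                  evalTerms M σ (renTerms f ts) ≡ evalTerms M ρ ts
  eval-renTerm  agree (var i)    = at agree i
  eval-renTerm  agree (fun g ts) = ≡.cong (Structure.function M g) (eval-renTerms agree ts)
  eval-renTerms agree []         = ≡.refl
  eval-renTerms agree (t ∷ ts)   = ≡.cong₂ _∷_ (eval-renTerm agree t) (eval-renTerms agree ts)

  lift-agree : ∀ {f : Fin m → Fin n} {ρ σ} → Agree f ρ σ → ∀ a → Agree (lift f) (a ∷ ρ) (a ∷ σ)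
  lift-agree agree a = agreement λ { zero → ≡.refl ; (suc i) → at agree i }

  Sat-rename : ∀ {f : Fin m → Fin n} {ρ σ} → Agree f ρ σ → ∀ φ → Sat M (rename f φ) σ ⇔ Sat M φ ρ
  Sat-rename agree (equal t u) rewrite eval-renTerm agree t | eval-renTerm agree u = mk⇔ id id
  Sat-rename agree (rel R ts) rewrite eval-renTerms agree ts = mk⇔ id id
  Sat-rename agree false         = mk⇔ id id
  Sat-rename agree (and φ ψ)     = Sat-rename agree φ ×-⇔ Sat-rename agree ψ
  Sat-rename agree (or φ ψ)      = Sat-rename agree φ ⊎-⇔ Sat-rename agree ψ
  Sat-rename agree (implies φ ψ) = →-cong-⇔ (Sat-rename agree φ) (Sat-rename agree ψ)
  Sat-rename agree (all φ) = mk⇔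
    (λ h a → Equivalence.to (Sat-rename (lift-agree agree a) φ) (h a))
    (λ h a → Equivalence.from (Sat-rename (lift-agree agree a) φ) (h a))
  Sat-rename agree (exists φ) = mk⇔
    (λ (a , h) → a , Equivalence.to (Sat-rename (lift-agree agree a) φ) h)
    (λ (a , h) → a , Equivalence.from (Sat-rename (lift-agree agree a) φ) h)

  Sat-existsⁿ : ∀ k (φ : Formula L (k ℕ.+ n)) ρ → Sat M (existsⁿ k φ) ρ ⇔ (∃[ w ] Sat M φ (w ++ ρ))
  Sat-existsⁿ zero    φ ρ = mk⇔ (λ h → [] , h) (λ { ([] , h) → h })
  Sat-existsⁿ (suc k) φ ρ = let open Equivalence (Sat-existsⁿ k (exists φ) ρ) in mk⇔
    (λ h → let (w , a , h′) = to h in a ∷ w , h′)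
    (λ { (a ∷ w , h) → from (w , a , h) })

  infixr 5 _∥_
  _∥_ : ∀ {a b k} → (Fin a → Fin k) → (Fin b → Fin k) → Fin (a ℕ.+ b) → Fin k
  _∥_ {a} f g i = [ f , g ]′ (splitAt a i)

  agree-++ : ∀ {a b k} {f : Fin a → Fin k} {g : Fin b → Fin k} {xs ys σ} →
             Agree f xs σ → Agree g ys σ → Agree (f ∥ g) (xs ++ ys) σ
  agree-++ {a} {f = f} {g} {xs} {ys} {σ} agree-f agree-g = agreement go
    where
    go : ∀ i → lookup σ ((f ∥ g) i) ≡ lookup (xs ++ ys) i
    go i rewrite lookup-splitAt a xs ys i with splitAt a i
    ... | inj₁ j = at agree-f j
    ... | inj₂ j = at agree-g j

-- Incidences of points and lines over an interpreted field

module PointsAndLines (em : ∀ {ℓ} → ExcludedMiddle ℓ) {c e : Level} {M : Structure L ℓ} {F : CommutativeRing c e}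
                      (field-F : IsField F) (I : Interpretation M F) where
  open Interpretation I
  open Structure M using () renaming (Carrier to ∣M∣)
  open CommutativeRing F hiding (zero) renaming (Carrier to ∣F∣)
  open Combinatorics em
  open FiniteSubsets em F
  open import Algebra.Solver.Ring.NaturalCoefficients.Default commutativeSemiring
    using (solve; _:=_; _:+_; _:*_)

  private
    k p : ℕ
    k = arity
    p = parameterCount

  -- The free variables are the coordinates of the point (u , v), the parameters, and the
  -- slope a and intercept b of the line; the bound tuple w is the product a u.
  incidence : Formula L ((k ℕ.+ k) ℕ.+ (p ℕ.+ (k ℕ.+ k)))
  incidence = existsⁿ k (and (rename (param ∥M w) domain)
    (and (rename (param ∥M (a ∥M (u ∥M w))) multiplication)
         (rename (param ∥M (w ∥M (b ∥M v))) addition)))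
    where
    _∥M_ = _∥_ M
    w u v a b : Fin k → Fin (k ℕ.+ ((k ℕ.+ k) ℕ.+ (p ℕ.+ (k ℕ.+ k))))
    param : Fin p → Fin (k ℕ.+ ((k ℕ.+ k) ℕ.+ (p ℕ.+ (k ℕ.+ k))))
    w i = i ↑ˡ _
    u i = k ↑ʳ ((i ↑ˡ k) ↑ˡ _)
    v i = k ↑ʳ ((k ↑ʳ i) ↑ˡ _)
    param i = k ↑ʳ ((k ℕ.+ k) ↑ʳ (i ↑ˡ _))
    a i = k ↑ʳ ((k ℕ.+ k) ↑ʳ (p ↑ʳ (i ↑ˡ k)))
    b i = k ↑ʳ ((k ℕ.+ k) ↑ʳ (p ↑ʳ (k ↑ʳ i)))

  Incident : REL (Vec ∣M∣ (k ℕ.+ k)) (Vec ∣M∣ (p ℕ.+ (k ℕ.+ k))) ℓ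
  Incident = Defined M (k ℕ.+ k) (p ℕ.+ (k ℕ.+ k)) incidence

  line : Vec ∣M∣ k → Vec ∣M∣ k → Vec ∣M∣ (p ℕ.+ (k ℕ.+ k))
  line a b = parameters ++ (a ++ b)

  -- The interpreting formulas are correct on the domain only, which is why the bound tuple w is
  -- required to lie there; conversely surjectivity provides a w representing the product.
  incident⇔ : ∀ {u v a b} → InDomain u → InDomain v → InDomain a → InDomain b →
              Incident (u ++ v) (line a b) ⇔ coordinate a * coordinate u + coordinate b ≈ coordinate v
  incident⇔ {u} {v} {a} {b} u∈ v∈ a∈ b∈ = mk⇔ to′ from′
    where
    ρ = (u ++ v) ++ line a b
    look-u : ∀ w → Agree M (λ i → k ↑ʳ ((i ↑ˡ k) ↑ˡ _)) u (w ++ ρ)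
    look-u w = agreement λ i → ≡.trans (lookup-++ʳ w ρ _) (≡.trans (lookup-++ˡ (u ++ v) (line a b) _) (lookup-++ˡ u v i))
    look-v : ∀ w → Agree M (λ i → k ↑ʳ ((k ↑ʳ i) ↑ˡ _)) v (w ++ ρ)
    look-v w = agreement λ i → ≡.trans (lookup-++ʳ w ρ _) (≡.trans (lookup-++ˡ (u ++ v) (line a b) _) (lookup-++ʳ u v i))
    look-line : ∀ w j → lookup (w ++ ρ) (k ↑ʳ ((k ℕ.+ k) ↑ʳ j)) ≡ lookup (line a b) j
    look-line w j = ≡.trans (lookup-++ʳ w ρ _) (lookup-++ʳ (u ++ v) (line a b) j)
    look-param : ∀ w → Agree M (λ i → k ↑ʳ ((k ℕ.+ k) ↑ʳ (i ↑ˡ _))) parameters (w ++ ρ)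
    look-param w = agreement λ i → ≡.trans (look-line w (i ↑ˡ _)) (lookup-++ˡ parameters (a ++ b) i)
    look-a : ∀ w → Agree M (λ i → k ↑ʳ ((k ℕ.+ k) ↑ʳ (p ↑ʳ (i ↑ˡ k)))) a (w ++ ρ)
    look-a w = agreement λ i → ≡.trans (look-line w (p ↑ʳ (i ↑ˡ k))) (≡.trans (lookup-++ʳ parameters (a ++ b) _) (lookup-++ˡ a b i))
    look-b : ∀ w → Agree M (λ i → k ↑ʳ ((k ℕ.+ k) ↑ʳ (p ↑ʳ (k ↑ʳ i)))) b (w ++ ρ)
    look-b w = agreement λ i → ≡.trans (look-line w (p ↑ʳ (k ↑ʳ i))) (≡.trans (lookup-++ʳ parameters (a ++ b) _) (lookup-++ʳ a b i))
    look-w : ∀ w → Agree M (λ i → i ↑ˡ _) w (w ++ ρ)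
    look-w w = agreement λ i → lookup-++ˡ w ρ i
    body : ∀ w → _ ⇔ (InDomain w × Sat M multiplication (parameters ++ (a ++ (u ++ w))) × Sat M addition (parameters ++ (w ++ (b ++ v))))
    body w = Sat-rename M (agree-++ M (look-param w) (look-w w)) domain
      ×-⇔ (Sat-rename M (agree-++ M (look-param w) (agree-++ M (look-a w) (agree-++ M (look-u w) (look-w w)))) multiplication
      ×-⇔ Sat-rename M (agree-++ M (look-param w) (agree-++ M (look-w w) (agree-++ M (look-b w) (look-v w)))) addition)
    to′ : Incident (u ++ v) (line a b) → coordinate a * coordinate u + coordinate b ≈ coordinate v
    to′ h with Equivalence.to (Sat-existsⁿ M k _ ρ) h
    ... | w , h′ with Equivalence.to (body w) h′
    ... | w∈ , mul , add = trans (+-congʳ (Equivalence.to (multiplication-correct a u w a∈ u∈ w∈) mul))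
                                 (Equivalence.to (addition-correct w b v w∈ b∈ v∈) add)
    from′ : coordinate a * coordinate u + coordinate b ≈ coordinate v → Incident (u ++ v) (line a b)
    from′ eq with surjective (coordinate a * coordinate u)
    ... | w , w∈ , w≈ = Equivalence.from (Sat-existsⁿ M k _ ρ) (w , Equivalence.from (body w)
      ( w∈ , Equivalence.from (multiplication-correct a u w a∈ u∈ w∈) (sym w≈)
      , Equivalence.from (addition-correct w b v w∈ b∈ v∈) (trans (+-congʳ w≈) eq)))

  rep : ∣F∣ → Vec ∣M∣ k
  rep x = proj₁ (surjective x)

  rep∈ : ∀ x → InDomain (rep x)
  rep∈ x = proj₁ (proj₂ (surjective x))

  rep≈ : ∀ x → coordinate (rep x) ≈ x
  rep≈ x = proj₂ (proj₂ (surjective x))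

  reps : List ∣F∣ → List (Vec ∣M∣ k)
  reps = map rep

  reps-unique : ∀ {xs} → Distinct xs → Unique (reps xs)
  reps-unique dist = AllPairsₚ.map⁺ (AllPairs.map (λ {x} {y} x≉y eq →
    x≉y (trans (sym (rep≈ x)) (trans (reflexive (≡.cong coordinate eq)) (rep≈ y)))) dist)

  reps-domain : ∀ xs {a} → a ∈ reps xs → InDomain a
  reps-domain xs a∈ with ∈-map⁻ rep a∈
  ... | x , _ , ≡.refl = rep∈ x

  -- Bicliques are counted up to ≡, field equations hold up to ≈; in a list without ≈-repetitions
  -- the two agree.
  distinct-≡ : ∀ {xs x y} → Distinct xs → x ∈ xs → y ∈ xs → x ≈ y → x ≡ y
  distinct-≡ (x∉ ∷ dist) (here ≡.refl) (here ≡.refl) x≈y = ≡.refl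
  distinct-≡ (x∉ ∷ dist) (here ≡.refl) (there y∈)    x≈y = contradiction x≈y (All.lookup x∉ y∈)
  distinct-≡ (x∉ ∷ dist) (there x∈)    (here ≡.refl) x≈y = contradiction (sym x≈y) (All.lookup x∉ x∈)
  distinct-≡ (x∉ ∷ dist) (there x∈)    (there y∈)    x≈y = distinct-≡ dist x∈ y∈ x≈y

  reps-≡ : ∀ {xs a b} → Distinct xs → a ∈ reps xs → b ∈ reps xs → coordinate a ≈ coordinate b → a ≡ b
  reps-≡ dist a∈ b∈ a≈b with ∈-map⁻ rep a∈ | ∈-map⁻ rep b∈
  ... | x , x∈ , ≡.refl | y , y∈ , ≡.refl =
    ≡.cong rep (distinct-≡ dist x∈ y∈ (trans (sym (rep≈ x)) (trans a≈b (rep≈ y))))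

  +-cancelʳ : ∀ x {y z} → y + x ≈ z + x → y ≈ z
  +-cancelʳ x {y} {z} eq = trans (sym (cancel y)) (trans (+-congʳ eq) (cancel z))
    where
    cancel : ∀ y → y + x + - x ≈ y
    cancel y = trans (+-assoc y x (- x)) (trans (+-congˡ (-‿inverseʳ x)) (+-identityʳ y))

  *-cancelˡ : ∀ {d x y} → ¬ (d ≈ 0#) → d * x ≈ d * y → x ≈ y
  *-cancelˡ {d} {x} {y} d≉0 eq with proj₂ field-F d d≉0
  ... | i , di≈1 = trans (sym (strip x)) (trans (*-congˡ eq) (strip y))
    where
    strip : ∀ x → i * (d * x) ≈ x
    strip x = trans (solve 3 (λ i d x → i :* (d :* x) := d :* i :* x) refl i d x) (trans (*-congʳ di≈1) (*-identityˡ x))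

  -- Adding the equations crosswise gives a u + a′ u′ = a u′ + a′ u, that is (a - a′) (u - u′) = 0.
  -- The semiring solver treats - a′ as opaque, so a′ u + a′ u′ is added to both sides instead of
  -- expanding the product.
  lines-meet-once : ∀ {a b a′ b′ u v u′ v′} → a * u + b ≈ v → a * u′ + b ≈ v′ → a′ * u + b′ ≈ v → a′ * u′ + b′ ≈ v′ →
                    a ≈ a′ ⊎ u ≈ u′
  lines-meet-once {a} {b} {a′} {b′} {u} {v} {u′} {v′} e₁ e₂ e₃ e₄ =
    by-cases (a + - a′ ≈ 0#)
      (λ d≈0 → inj₁ (+-cancelʳ (- a′) (trans d≈0 (sym (-‿inverseʳ a′)))))
      (λ d≉0 → inj₂ (*-cancelˡ d≉0 (+-cancelʳ (a′ * u + a′ * u′) (trans (difference u u′) (trans crossed (sym (trans (+-congˡ (+-comm _ _)) (difference u′ u))))))))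
    where
    difference : ∀ u u′ → (a + - a′) * u + (a′ * u + a′ * u′) ≈ a * u + a′ * u′
    difference u u′ = trans (solve 5 (λ a n a′ u u′ → (a :+ n) :* u :+ (a′ :* u :+ a′ :* u′) := (a :+ (n :+ a′)) :* u :+ a′ :* u′) refl a (- a′) a′ u u′)
      (+-congʳ (*-congʳ (trans (+-congˡ (-‿inverseˡ a′)) (+-identityʳ a))))
    crossed : a * u + a′ * u′ ≈ a * u′ + a′ * u
    crossed = +-cancelʳ (b + b′) (trans
      (solve 4 (λ x y b b′ → x :+ y :+ (b :+ b′) := (x :+ b) :+ (y :+ b′)) refl (a * u) (a′ * u′) b b′)
      (trans (+-cong e₁ e₄) (trans (+-comm v v′) (trans (sym (+-cong e₂ e₃))
      (solve 4 (λ x y b b′ → (x :+ b) :+ (y :+ b′) := x :+ y :+ (b :+ b′)) refl (a * u′) (a′ * u) b b′)))))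

  module _ {γ δ n : ℕ} (grid : Grid γ δ n) where
    open Grid grid

    points : List (Vec ∣M∣ (k ℕ.+ k))
    points = cartesianProductWith _++_ (reps U) (reps W)

    lines : List (Vec ∣M∣ (p ℕ.+ (k ℕ.+ k)))
    lines = cartesianProductWith line (reps U) (reps V)

    points-unique : Unique points
    points-unique = Uniqueₚ.cartesianProductWith⁺ _++_ (λ {w} {x} → ++-injective w x) (reps-unique U-distinct) (reps-unique W-distinct)

    lines-unique : Unique lines
    lines-unique = Uniqueₚ.cartesianProductWith⁺ line
      (λ {w} {x} {y} {z} eq → ++-injective w x (proj₂ (++-injective parameters parameters eq)))
      (reps-unique U-distinct) (reps-unique V-distinct)

    length-points : length points ≡ length U ℕ.* length W
    length-points = ≡.trans (length-cartesianProductWith _++_ (reps U) (reps W)) (≡.cong₂ ℕ._*_ (length-map rep U) (length-map rep W))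

    length-lines : length lines ≡ length U ℕ.* length V
    length-lines = ≡.trans (length-cartesianProductWith line (reps U) (reps V)) (≡.cong₂ ℕ._*_ (length-map rep U) (length-map rep V))

    K₂₂-free : KFree 2 Incident points lines
    K₂₂-free ((x₁ ∷ x₂ ∷ []) , (y₁ ∷ y₂ ∷ []) , ((x₁≢x₂ ∷ []) ∷ _) , ≡.refl , A⊆ , ((y₁≢y₂ ∷ []) ∷ _) , ≡.refl , B⊆ , inc)
      with ∈-cartesianProductWith⁻ _++_ (reps U) (reps W) (A⊆ (here ≡.refl))
         | ∈-cartesianProductWith⁻ _++_ (reps U) (reps W) (A⊆ (there (here ≡.refl)))
         | ∈-cartesianProductWith⁻ line (reps U) (reps V) (B⊆ (here ≡.refl))
         | ∈-cartesianProductWith⁻ line (reps U) (reps V) (B⊆ (there (here ≡.refl)))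
    ... | u , v , u∈ , v∈ , ≡.refl | u′ , v′ , u′∈ , v′∈ , ≡.refl | a , b , a∈ , b∈ , ≡.refl | a′ , b′ , a′∈ , b′∈ , ≡.refl =
      [ (λ a≈a′ → y₁≢y₂ (≡.cong₂ line (reps-≡ U-distinct a∈ a′∈ a≈a′) (reps-≡ V-distinct b∈ b′∈
          (+-cancelʳ (coordinate a * coordinate u) (trans (+-comm _ _) (trans e₁ (trans (sym e₃) (trans (+-congʳ (*-congʳ (sym a≈a′))) (+-comm _ _)))))))))
      , (λ u≈u′ → x₁≢x₂ (≡.cong₂ _++_ (reps-≡ U-distinct u∈ u′∈ u≈u′) (reps-≡ W-distinct v∈ v′∈
          (trans (sym e₁) (trans (+-congʳ (*-congˡ u≈u′)) e₂))))) ]′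
      (lines-meet-once e₁ e₂ e₃ e₄)
      where
      equation : ∀ {u v a b} → u ∈ reps U → v ∈ reps W → a ∈ reps U → b ∈ reps V → Incident (u ++ v) (line a b) →
                 coordinate a * coordinate u + coordinate b ≈ coordinate v
      equation u∈ v∈ a∈ b∈ = Equivalence.to (incident⇔ (reps-domain U u∈) (reps-domain W v∈) (reps-domain U a∈) (reps-domain V b∈))
      e₁ = equation u∈ v∈ a∈ b∈ (inc (here ≡.refl) (here ≡.refl))
      e₂ = equation u′∈ v′∈ a∈ b∈ (inc (there (here ≡.refl)) (here ≡.refl))
      e₃ = equation u∈ v∈ a′∈ b′∈ (inc (here ≡.refl) (there (here ≡.refl)))
      e₄ = equation u′∈ v′∈ a′∈ b′∈ (inc (there (here ≡.refl)) (there (here ≡.refl)))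

    ∑-≥ : ∀ {a} {A : Set a} (xs : List A) {f} {c} → (∀ {x} → x ∈ xs → c ℕ.≤ f x) → length xs ℕ.* c ℕ.≤ ∑ xs f
    ∑-≥ xs {c = c} c≤f = ℕₚ.≤-trans (ℕₚ.≤-reflexive (≡.sym (∑-const xs c))) (∑-mono xs c≤f)

    -- For each x in U, `closed` places a x + b in W, which yields one point of the line in the
    -- grid.
    rich-line : ∀ {a b} → a ∈ U → b ∈ V → length U ℕ.≤ deg Incident points (line (rep a) (rep b))
    rich-line {a} {b} a∈ b∈ = begin
      length U                     ≡⟨ length-map rep U ⟨
      length (reps U)              ≡⟨ ℕₚ.*-identityʳ _ ⟨
      length (reps U) ℕ.* 1        ≤⟨ ∑-≥ (reps U) meets ⟩
      (∑[ u ∈ reps U ] ∑[ v ∈ reps W ] ⟨ Incident (u ++ v) y ⟩)  ≡⟨ ∑-cartesianProductWith _++_ (reps U) (reps W) (λ x → ⟨ Incident x y ⟩) ⟨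
      deg Incident points y        ∎
      where
      open ℕₚ.≤-Reasoning
      y = line (rep a) (rep b)
      meets : ∀ {u} → u ∈ reps U → 1 ℕ.≤ (∑[ v ∈ reps W ] ⟨ Incident (u ++ v) y ⟩)
      meets u∈ with ∈-map⁻ rep u∈
      ... | x , x∈ , ≡.refl with find (closed a∈ x∈ b∈)
      ... | z , z∈ , ax+b≈z = ℕₚ.≤-trans
        (ℕₚ.≤-reflexive (≡.sym (⟨⟩≡1 (Equivalence.from (incident⇔ (rep∈ x) (rep∈ z) (rep∈ a) (rep∈ b))
          (trans (+-cong (*-cong (rep≈ a) (rep≈ x)) (rep≈ b)) (trans ax+b≈z (sym (rep≈ z))))))))
        (∑-member (reps W) (λ v → ⟨ Incident (rep x ++ v) y ⟩) (∈-map⁺ rep z∈))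

    many-incidences : length U ℕ.* (length V ℕ.* length U) ℕ.≤ E Incident points lines
    many-incidences = begin
      length U ℕ.* (length V ℕ.* length U)
        ≡⟨ ≡.cong₂ (λ m n → m ℕ.* (n ℕ.* length U)) (length-map rep U) (length-map rep V) ⟨
      length (reps U) ℕ.* (length (reps V) ℕ.* length U)
        ≤⟨ ∑-≥ (reps U) (λ a∈ → ∑-≥ (reps V) (λ b∈ → rich a∈ b∈)) ⟩
      (∑[ a ∈ reps U ] ∑[ b ∈ reps V ] deg Incident points (line a b))
        ≡⟨ ∑-cartesianProductWith line (reps U) (reps V) (deg Incident points) ⟨
      E Incident points lines ∎
      where
      open ℕₚ.≤-Reasoning
      rich : ∀ {a b} → a ∈ reps U → b ∈ reps V → length U ℕ.≤ deg Incident points (line a b)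
      rich a∈ b∈ with ∈-map⁻ rep a∈ | ∈-map⁻ rep b∈
      ... | x , x∈ , ≡.refl | y , y∈ , ≡.refl = rich-line x∈ y∈

    -- There are at least |U|² |V| incidences, while |U| |W| + |U| |V| is at most (γ + 1) |U| |V|;
    -- the factor |U| |V| cancels.
    grid-bound : ∀ {K} → E Incident points lines ℕ.≤ K ℕ.* (length points ℕ.+ length lines) → length U ℕ.≤ K ℕ.* suc γ
    grid-bound {K} bound with length U in eq
    ... | zero = z≤n
    ... | suc _ = ℕₚ.*-cancelˡ-≤ (length U ℕ.* length V) {{ℕₚ.m*n≢0 (length U) (length V) {{U≢0}} {{ℕ.>-nonZero V-nonempty}}}} (begin
      length U ℕ.* length V ℕ.* suc _
        ≡⟨ ≡.cong (length U ℕ.* length V ℕ.*_) eq ⟨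
      length U ℕ.* length V ℕ.* length U
        ≡⟨ ℕₚ.*-assoc (length U) (length V) (length U) ⟩
      length U ℕ.* (length V ℕ.* length U)
        ≤⟨ many-incidences ⟩
      E Incident points lines
        ≤⟨ bound ⟩
      K ℕ.* (length points ℕ.+ length lines)
        ≡⟨ ≡.cong₂ (λ m n → K ℕ.* (m ℕ.+ n)) length-points length-lines ⟩
      K ℕ.* (length U ℕ.* length W ℕ.+ length U ℕ.* length V)
        ≤⟨ ℕₚ.*-monoʳ-≤ K (ℕₚ.+-monoˡ-≤ _ (ℕₚ.*-monoʳ-≤ (length U) W≤V)) ⟩
      K ℕ.* (length U ℕ.* (γ ℕ.* length V) ℕ.+ length U ℕ.* length V)
        ≡⟨ rearrange K (length U) γ (length V) ⟩
      length U ℕ.* length V ℕ.* (K ℕ.* suc γ) ∎)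
      where
      open ℕₚ.≤-Reasoning
      U≢0 : NonZero (length U)
      U≢0 = ≡.subst NonZero (≡.sym eq) _
      rearrange : ∀ K u γ v → K ℕ.* (u ℕ.* (γ ℕ.* v) ℕ.+ u ℕ.* v) ≡ u ℕ.* v ℕ.* (K ℕ.* suc γ)
      rearrange = solve-∀

  -- With 2 ^ N ≤ |U| < 2 ^ suc N, the condition |W| ≤ |U| ^ δ keeps the binary logarithm of the
  -- number of points linear in N. A polylinear bound would then make |U| polynomial in N.
  incidence-not-polylinear : Infinite F → ¬ PolyLin 2 Incident
  incidence-not-polylinear infinite (C , e , lin) with infinite-field-grids field-F infinite
  -- The constant gathers C, the factor γ + 1 of `grid-bound`, and the part (δ + 1) ^ e of q ^ e for
  -- q = (N + 1) (δ + 1).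
  ... | γ , δ , grids with exp-beats-poly e (C ℕ.* suc γ ℕ.* suc δ ℕ.^ e)
  ... | N₀ , beats with grids (2 ℕ.^ N₀)
  ... | grid with dyadic (length (Grid.U grid)) (ℕₚ.≤-trans (ℕₚ.m^n>0 2 N₀) (Grid.n≤U grid))
                    (ℕₚ.≤-trans (n<2^n (length (Grid.U grid))) (ℕₚ.^-monoʳ-≤ 2 (ℕₚ.n≤1+n (length (Grid.U grid)))))
  ... | N , _ , 2^N≤U , U<2^ = contradiction 2^N≤U (ℕₚ.<⇒≱ (begin-strict
    length U
      ≤⟨ grid-bound grid {C ℕ.* q ℕ.^ e} (lin (s≤s z≤n) few-points (points-unique grid) (lines-unique grid) ℕₚ.≤-refl (K₂₂-free grid)) ⟩
    C ℕ.* q ℕ.^ e ℕ.* suc γ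
      ≡⟨ ≡.cong (λ x → C ℕ.* x ℕ.* suc γ) (^-distribʳ-* e (suc N) (suc δ)) ⟩
    C ℕ.* (suc N ℕ.^ e ℕ.* suc δ ℕ.^ e) ℕ.* suc γ
      ≡⟨ rearrange C (suc N ℕ.^ e) (suc δ ℕ.^ e) (suc γ) ⟩
    C ℕ.* suc γ ℕ.* suc δ ℕ.^ e ℕ.* suc N ℕ.^ e
      <⟨ beats N N₀≤N ⟩
    2 ℕ.^ N ∎))
    where
    open ℕₚ.≤-Reasoning
    open Grid grid
    q = suc N ℕ.* suc δ
    rearrange : ∀ C n d g → C ℕ.* (n ℕ.* d) ℕ.* g ≡ C ℕ.* g ℕ.* d ℕ.* n
    rearrange = solve-∀
    few-points : length (points grid) ℕ.< 2 ℕ.^ suc q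
    few-points = begin-strict
      length (points grid)           ≡⟨ length-points grid ⟩
      length U ℕ.* length W          ≤⟨ ℕₚ.*-monoʳ-≤ (length U) W≤U ⟩
      length U ℕ.^ suc δ             ≤⟨ ℕₚ.^-monoˡ-≤ (suc δ) (ℕₚ.<⇒≤ U<2^) ⟩
      (2 ℕ.^ suc N) ℕ.^ suc δ        ≡⟨ ℕₚ.^-*-assoc 2 (suc N) (suc δ) ⟩
      2 ℕ.^ q                        <⟨ ℕₚ.^-monoʳ-< 2 ℕₚ.≤-refl (ℕₚ.n<1+n q) ⟩
      2 ℕ.^ suc q                    ∎
    N₀≤N : N₀ ℕ.≤ N
    N₀≤N = ℕₚ.≮⇒≥ (λ N<N₀ → contradiction n≤U (ℕₚ.<⇒≱ (ℕₚ.≤-trans U<2^ (ℕₚ.^-monoʳ-≤ 2 N<N₀))))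

theorem3p4 :
    (em : ∀ {ℓ} → ExcludedMiddle ℓ) (ℝ : CompleteOrderedField) →
    let open Classical em
        open RealFunctions ℝ
        open CompleteOrderedField ℝ in
    ∀ {a b r s t ℓ c e} (k : ℕ) → .{{NonZero k}} →
    ({X : Set a} {Y : Set b} (d d' : ℕ)
     (P : Fin d → REL X Y r) (N : Fin d' → REL X Y r) →
     (∀ i → SemiEquation k (P i)) → (∀ j → SemiEquation k (N j)) →
     ∀ t m n → .{{NonZero t}} → .{{NonZero m}} → .{{NonZero n}} →
     fromℕ (zarankiewicz (Conjunction P N) t m n) ≤ zBound k d d' t m n)
    ×
    ({X : Set a} {Y : Set b} {l : ℕ} (S : Fin l → REL X Y r) (R : REL X Y r) →
     (∀ i → SemiEquation k (S i)) → BooleanCombination S R →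
     AlmostLinearZarankiewiczBounds R)
    ×
    ({L : Language s} (T : Theory L t) →
     SemiEquational ℓ k T → ¬ InterpretsInfiniteField ℓ c e T)
theorem3p4 em ℝ k@(suc _) =
  zarankiewicz-≤-zBound ,
  (λ S R semi comb → polylinear⇒almost-linear (boolean-bound S semi comb)) ,
  λ T semi (M , model , F , isField , infinite , I) →
    let open PointsAndLines em isField I
        (_ , ψ , expr , spec) = semi _ _ incidence
        (semi-ψ , equiv)      = spec M model
    -- The final argument 1 is t - 1 for t = 2, since two lines meet at most once.
    in incidence-not-polylinear infinite (boolean-bound (λ i → Defined M _ _ (ψ i)) semi-ψ (expr , equiv) 1)
  where
  open RealBounds em ℝ
  open Combinatorics em using (boolean-bound)
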